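{- Let $a$ and $b$ be integers with $b>a>1$. Suppose that there exist positive integers $N$ and $D$, and nonnegative integers $x_i, y_i$ ($i\in\{0,1,2,3,4\}$), such that $$N+iD = a^{x_i}+b^{y_i}, \quad \text{for } i \in \{0,1,2,3,4\}.$$ Then either $$(a,b,N,D)=(2,\,2^k+1,\,2^k+1,\,2^k) \quad\text{or}\quad (a,b,N,D)=(3,\,4\cdot 3^{k-1}+1,\,3^{k-1}+1,\,2\cdot 3^{k-1})$$ for some positive integer $k$, or $$(a,b,N,D)\in\{(2,3,5,2),(2,3,7,6),(2,3,9,8),(2,3,17,24),(2,3,41,24),(2,5,5,8),(2,9,17,24),(2,9,41,24),(3,4,7,6)\}.$$ -}

module Defs where

open import Data.Nat using (ℕ; suc; _+_; _*_; _^_)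
open import Data.Product using (_×_; ∃-syntax)
open import Data.Sum using (_⊎_)
open import Relation.Binary.PropositionalEquality using (_≡_)

Quad : ℕ → ℕ → ℕ → ℕ → ℕ → ℕ → ℕ → ℕ → Set
Quad a b N D a' b' N' D' = a ≡ a' × b ≡ b' × N ≡ N' × D ≡ D'

Family1 : ℕ → ℕ → ℕ → ℕ → Set
Family1 a b N D = ∃[ j ] (let k = suc j in Quad a b N D 2 (2 ^ k + 1) (2 ^ k + 1) (2 ^ k))

-- second infinite family: (3, 4·3^(k-1)+1, 3^(k-1)+1, 2·3^(k-1)), k ≥ 1
-- (written with j = k - 1 ≥ 0)
Family2 : ℕ → ℕ → ℕ → ℕ → Set
Family2 a b N D = ∃[ j ] Quad a b N D 3 (4 * 3 ^ j + 1) (3 ^ j + 1) (2 * 3 ^ j)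

Sporadic : ℕ → ℕ → ℕ → ℕ → Set
Sporadic a b N D =
  Quad a b N D 2 3 5 2 ⊎ Quad a b N D 2 3 7 6 ⊎ Quad a b N D 2 3 9 8 ⊎
  Quad a b N D 2 3 17 24 ⊎ Quad a b N D 2 3 41 24 ⊎ Quad a b N D 2 5 5 8 ⊎
  Quad a b N D 2 9 17 24 ⊎ Quad a b N D 2 9 41 24 ⊎ Quad a b N D 3 4 7 6

{-# OPTIONS --safe #-}
module Submission where

-- For powers u and v of the same base c and every m, either u ≤ cᵐ v or cᵐ⁺¹ v ≤ u. Finitely many such
-- comparisons among the ten powers split the progression into systems of linear inequalities. Each
-- of them is either infeasible, by a nonnegative combination of its inequalities, or forces linear
-- equations between the powers; for a large base it suffices to know that distinct powers differ by a factor
-- of at least 5 or 6, so that the splitting is uniform in b. The exponential equations that remain are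
-- solved by the factorisation of bⁿ - 1 by b - 1 and by fixed small moduli, except for
-- (1 + 3 · 2ʳ)ʸ = 1 + 2ʳ + 2ˣ, for which the moduli 2ˢ + 1 with s close to r are used: every power of
-- two is plus or minus a small one there.

open import Defs
open import Data.Bool using (Bool; true; false; _∧_; _∨_; not; T)
open import Data.Bool.Properties using (T-∧)
open import Data.Empty using (⊥; ⊥-elim)
open import Data.Fin using (Fin; toℕ)
open import Data.Fin.Patterns using (0F; 1F; 2F; 3F; 4F)
open import Data.List using (List; []; _∷_; _++_; map)
open import Data.List.Relation.Unary.All using (All; []; _∷_)
open import Data.List.Relation.Unary.All.Properties using (++⁺)
open import Data.List.Relation.Unary.Any using (Any; here; there)
open import Data.Nat
open import Data.Nat.Coprimality using (Coprime; coprime-divisor)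
open import Data.Nat.DivMod
open import Data.Nat.Divisibility
open import Data.Nat.Primality using (Prime; prime?; euclidsLemma; prime⇒irreducible; prime⇒nonZero)
open import Data.Nat.Properties
open import Data.Nat.Tactic.RingSolver using (solve-∀)
open import Data.Product using (_×_; _,_; proj₁; proj₂; ∃-syntax; ∃₂)
open import Data.Sum using (_⊎_; inj₁; inj₂)
open import Data.Unit using (tt)
open import Function using (_∘_; Equivalence)
open import Relation.Binary.Definitions using (tri<; tri≈; tri>)
open import Relation.Binary.PropositionalEquality
open import Relation.Nullary using (¬_; Dec; yes; no; contradiction)
open import Relation.Nullary.Decidable using (from-yes; from-no)

-- Linear certificates

-- The two infinite families remain feasible for every k, so no certificate can close the branches
-- that contain them. These branches are recognised by a power that occurs three times, at the
-- places 0, 1, 3 or 1, 2, 4 or 0, 1, 4, and they are split again by certificates of their own. The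
-- other open leaves are sporadic solutions or systems that only arithmetic can exclude.
--
-- The equation (1 + 3 · 2ʳ)ʸ = 1 + 2ʳ + 2ˣ has the solution y = 1, x = r + 1 for every r, so
-- congruences without a condition on the size of x cannot refute it. The system that leads to it
-- supplies x ≥ r + 2. After division by 2ʳ this becomes y ≡ 3 modulo 4, which tells the equation
-- apart from its true solutions. The exponent s of the modulus 2ˢ + 1 is then always taken even:
-- exponents are reduced modulo 2s, and they keep their class modulo 4 in that reduction.

Env Form Row Term Eqn : Set
Env  = ℕ → ℕ
Form = List ℕ
Row  = Form × Form
Term = List (ℕ × ℕ)
Eqn  = Term × Term

dot : Form → Env → ℕ
dot []       ρ = 0
dot (c ∷ cs) ρ = c * ρ 0 + dot cs (ρ ∘ suc)

infix 4 _⊨_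
-- Coefficients are natural numbers, so an inequality keeps terms on both sides, and cancellation is
-- postponed to the comparison of coefficients.
_⊨_ : Env → Row → Set
ρ ⊨ (l , r) = dot l ρ ≤ dot r ρ

unit : ℕ → ℕ → Form
unit zero    c = c ∷ []
unit (suc i) c = 0 ∷ unit i c

infixl 6 _⊕_
_⊕_ : Form → Form → Form
[]       ⊕ es       = es
(c ∷ cs) ⊕ []       = c ∷ cs
(c ∷ cs) ⊕ (e ∷ es) = c + e ∷ cs ⊕ es

infixl 7 _⊛_
_⊛_ : ℕ → Form → Form
k ⊛ cs = map (k *_) cs

dot-unit : ∀ i c ρ → dot (unit i c) ρ ≡ c * ρ i
dot-unit zero    c ρ = +-identityʳ _
dot-unit (suc i) c ρ = dot-unit i c (ρ ∘ suc)

dot-⊕ : ∀ cs es ρ → dot (cs ⊕ es) ρ ≡ dot cs ρ + dot es ρ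
dot-⊕ []       es       ρ = refl
dot-⊕ (c ∷ cs) []       ρ = sym (+-identityʳ _)
dot-⊕ (c ∷ cs) (e ∷ es) ρ = begin
  (c + e) * ρ 0 + dot (cs ⊕ es) ρ′               ≡⟨ cong₂ _+_ (*-distribʳ-+ (ρ 0) c e) (dot-⊕ cs es ρ′) ⟩
  (c * ρ 0 + e * ρ 0) + (dot cs ρ′ + dot es ρ′)  ≡⟨ +-assoc (c * ρ 0) _ _ ⟩
  c * ρ 0 + (e * ρ 0 + (dot cs ρ′ + dot es ρ′))  ≡⟨ cong (c * ρ 0 +_) (x+[y+z]≡y+[x+z] (e * ρ 0) (dot cs ρ′) _) ⟩
  c * ρ 0 + (dot cs ρ′ + (e * ρ 0 + dot es ρ′))  ≡⟨ +-assoc (c * ρ 0) _ _ ⟨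
  (c * ρ 0 + dot cs ρ′) + (e * ρ 0 + dot es ρ′)  ∎
  where
  open ≡-Reasoning
  ρ′ = ρ ∘ suc
  x+[y+z]≡y+[x+z] : ∀ x y z → x + (y + z) ≡ y + (x + z)
  x+[y+z]≡y+[x+z] x y z = trans (sym (+-assoc x y z)) (trans (cong (_+ z) (+-comm x y)) (+-assoc y x z))

dot-⊛ : ∀ k cs ρ → dot (k ⊛ cs) ρ ≡ k * dot cs ρ
dot-⊛ k []       ρ = sym (*-zeroʳ k)
dot-⊛ k (c ∷ cs) ρ = begin
  k * c * ρ 0 + dot (k ⊛ cs) (ρ ∘ suc)    ≡⟨ cong₂ _+_ (*-assoc k c _) (dot-⊛ k cs (ρ ∘ suc)) ⟩
  k * (c * ρ 0) + k * dot cs (ρ ∘ suc)    ≡⟨ *-distribˡ-+ k (c * ρ 0) _ ⟨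
  k * (c * ρ 0 + dot cs (ρ ∘ suc))        ∎
  where open ≡-Reasoning

_≤ᶠ_ : Form → Form → Bool
[]       ≤ᶠ es       = true
(c ∷ cs) ≤ᶠ []       = (c ≤ᵇ 0) ∧ (cs ≤ᶠ [])
(c ∷ cs) ≤ᶠ (e ∷ es) = (c ≤ᵇ e) ∧ (cs ≤ᶠ es)

-- One strict coefficient among weak ones suffices, because `D` and all powers are positive. All
-- rows are weak inequalities, so this is the only source of strictness in a contradiction.
_<ᶠ_ : Form → Form → Bool
cs       <ᶠ []       = false
[]       <ᶠ (e ∷ es) = (0 <ᵇ e) ∨ ([] <ᶠ es)
(c ∷ cs) <ᶠ (e ∷ es) = (c ≤ᵇ e) ∧ ((c <ᵇ e) ∧ (cs ≤ᶠ es) ∨ (cs <ᶠ es))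

T-∧⁻ : ∀ {p q} → T (p ∧ q) → T p × T q
T-∧⁻ = Equivalence.to T-∧

≤ᶠ-sound : ∀ cs es ρ → T (cs ≤ᶠ es) → dot cs ρ ≤ dot es ρ
≤ᶠ-sound []       es       ρ _ = z≤n
≤ᶠ-sound (c ∷ cs) []       ρ t with c≤0 , r ← T-∧⁻ {c ≤ᵇ 0} t
  rewrite n≤0⇒n≡0 (≤ᵇ⇒≤ c 0 c≤0) = ≤ᶠ-sound cs [] (ρ ∘ suc) r
≤ᶠ-sound (c ∷ cs) (e ∷ es) ρ t with c≤e , r ← T-∧⁻ {c ≤ᵇ e} t =
  +-mono-≤ (*-monoˡ-≤ (ρ 0) (≤ᵇ⇒≤ c e c≤e)) (≤ᶠ-sound cs es (ρ ∘ suc) r)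

Positive : Env → Set
Positive ρ = ∀ i → 0 < ρ i

<ᶠ-sound : ∀ cs es ρ → Positive ρ → T (cs <ᶠ es) → dot cs ρ < dot es ρ
<ᶠ-sound [] (zero ∷ es)  ρ pos t = <ᶠ-sound [] es (ρ ∘ suc) (pos ∘ suc) t
<ᶠ-sound [] (suc e ∷ es) ρ pos t =
  ≤-trans (*-mono-≤ {1} {suc e} (s≤s z≤n) (pos 0)) (m≤m+n (suc e * ρ 0) _)
<ᶠ-sound (c ∷ cs) (e ∷ es) ρ pos t
  with c≤e , r ← T-∧⁻ {c ≤ᵇ e} t
  with (c <ᵇ e) ∧ (cs ≤ᶠ es) in eq
... | false = +-mono-≤-< (*-monoˡ-≤ (ρ 0) (≤ᵇ⇒≤ c e c≤e)) (<ᶠ-sound cs es (ρ ∘ suc) (pos ∘ suc) r)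
... | true  with c<e , s ← T-∧⁻ {c <ᵇ e} (subst T (sym eq) tt) =
  +-mono-<-≤ (*-monoˡ-< (ρ 0) {{>-nonZero (pos 0)}} (<ᵇ⇒< c e c<e)) (≤ᶠ-sound cs es (ρ ∘ suc) s)

-- Equal to c * x, but a coefficient 1 leaves no x + 0 behind. Together with the singleton clause of
-- `⟦_⟧` this makes the equations of a goal reduce to the plain form in which the lemmas on powers
-- are stated.
coef : ℕ → ℕ → ℕ
coef 1 x = x
coef c x = c * x

⟦_⟧ : Term → Env → ℕ
⟦ [] ⟧              ρ = 0
⟦ (c , i) ∷ [] ⟧    ρ = coef c (ρ i)
⟦ (c , i) ∷ t ∷ ts ⟧ ρ = coef c (ρ i) + ⟦ t ∷ ts ⟧ ρ

Solves : Env → Eqn → Set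
Solves ρ (l , r) = ⟦ l ⟧ ρ ≡ ⟦ r ⟧ ρ

form : Term → Form
form []             = []
form ((c , i) ∷ ts) = unit i c ⊕ form ts

coef≡* : ∀ c x → coef c x ≡ c * x
coef≡* zero          x = refl
coef≡* (suc zero)    x = sym (+-identityʳ x)
coef≡* (suc (suc c)) x = refl

form-sound : ∀ ts ρ → dot (form ts) ρ ≡ ⟦ ts ⟧ ρ
form-sound []                  ρ = refl
form-sound ((c , i) ∷ [])      ρ =
  trans (dot-⊕ (unit i c) [] ρ) (trans (+-identityʳ _) (trans (dot-unit i c ρ) (sym (coef≡* c (ρ i)))))
form-sound ((c , i) ∷ t ∷ ts) ρ =
  trans (dot-⊕ (unit i c) (form (t ∷ ts)) ρ)
        (cong₂ _+_ (trans (dot-unit i c ρ) (sym (coef≡* c (ρ i)))) (form-sound (t ∷ ts) ρ))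

-- A certificate is a numeral whose base-65536 digits m * 64 + i stand for m times row i.
row : List Row → ℕ → Row
row []       _       = [] , []
row (r ∷ rs) zero    = r
row (r ∷ rs) (suc i) = row rs i

combine : ℕ → ℕ → List Row → Row
combine zero    _ _   = [] , []
combine (suc n) 0 _   = [] , []
combine (suc n) code Γ =
  let l , r = row Γ (code % 64); m = code / 64 % 1024; l′ , r′ = combine n (code / 65536) Γ
  in m ⊛ l ⊕ l′ , m ⊛ r ⊕ r′

-- A code of more than 64 digits would be cut off, which stays sound: every partial sum of rows is a
-- valid inequality.
combination : ℕ → List Row → Row
combination = combine 64

-- `inf` carries the code of a contradictory combination, `res` the number of a goal with two codes
-- for each of its equations, one per inequality, and `ask` the two branches after a comparison.
data Tree : Set where
  inf : ℕ → Tree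
  res : ℕ → List ℕ → Tree
  ask : ℕ → Tree → Tree → Tree

Goals : Set
Goals = List (List Eqn)

goal : Goals → ℕ → List Eqn
goal []       _       = []
goal (g ∷ gs) zero    = g
goal (g ∷ gs) (suc k) = goal gs k

-- The lowest base-64 digit of the code is the factor by which the inequality l ≤ r has been scaled.
derivable : List Row → Form → Form → ℕ → Bool
derivable Γ l r code = (0 <ᵇ d) ∧ ((d ⊛ l ⊕ proj₂ c) ≤ᶠ (d ⊛ r ⊕ proj₁ c))
  where d = code % 64
        c = combination (code / 64) Γ

solvable : List Row → List Eqn → List ℕ → Bool
solvable Γ []             _             = true
solvable Γ ((l , r) ∷ es) (c ∷ c′ ∷ cs) =
  derivable Γ (form l) (form r) c ∧ derivable Γ (form r) (form l) c′ ∧ solvable Γ es cs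
solvable Γ (_ ∷ _)        _             = false

module Certificates (gs : Goals) (question : ℕ → Row × Row) where

  isJust : ℕ → Goals → Bool
  isJust _       []       = false
  isJust zero    (_ ∷ _)  = true
  isJust (suc k) (_ ∷ gs) = isJust k gs

  check : List Row → Tree → Bool
  check Γ (inf c)     = let l , r = combination c Γ in r <ᶠ l
  check Γ (res k cs)  = isJust k gs ∧ solvable Γ (goal gs k) cs
  -- The answer becomes row 0, and everything known before moves back by one place. Row numbers in a
  -- code thus count from the latest answer, with the progression at the end.
  check Γ (ask q t u) = let l , r = question q in check (l ∷ Γ) t ∧ check (r ∷ Γ) u

  module Soundness (ρ : Env) (pos : Positive ρ)
    (answer : ∀ q → ρ ⊨ proj₁ (question q) ⊎ ρ ⊨ proj₂ (question q)) where

    row-sound : ∀ Γ i → All (ρ ⊨_) Γ → ρ ⊨ row Γ i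
    row-sound []      i       []       = z≤n
    row-sound (_ ∷ _) zero    (p ∷ ps) = p
    row-sound (_ ∷ Γ) (suc i) (p ∷ ps) = row-sound Γ i ps

    ⊛⊕-sound : ∀ m l l′ → dot (m ⊛ l ⊕ l′) ρ ≡ m * dot l ρ + dot l′ ρ
    ⊛⊕-sound m l l′ = trans (dot-⊕ (m ⊛ l) l′ ρ) (cong (_+ dot l′ ρ) (dot-⊛ m l ρ))

    combine-sound : ∀ n c Γ → All (ρ ⊨_) Γ → ρ ⊨ combine n c Γ
    combine-sound zero    c       Γ ps = z≤n
    combine-sound (suc n) zero    Γ ps = z≤n
    combine-sound (suc n) code@(suc _) Γ ps = subst₂ _≤_ (sym (⊛⊕-sound m l l′)) (sym (⊛⊕-sound m r r′))
      (+-mono-≤ (*-monoʳ-≤ m (row-sound Γ i ps)) (combine-sound n (code / 65536) Γ ps))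
      where
      m = code / 64 % 1024
      i = code % 64
      l = proj₁ (row Γ i)
      r = proj₂ (row Γ i)
      l′ = proj₁ (combine n (code / 65536) Γ)
      r′ = proj₂ (combine n (code / 65536) Γ)

    -- The rows give l′ ≤ r′, hence d l + l′ ≤ d l + r′ ≤ d r + l′; cancelling l′ and then d leaves
    -- l ≤ r.
    derivable-sound : ∀ Γ l r c → All (ρ ⊨_) Γ → T (derivable Γ l r c) → ρ ⊨ (l , r)
    derivable-sound Γ l r code ps t with d>0 , s ← T-∧⁻ {0 <ᵇ code % 64} t =
      *-cancelˡ-≤ d {{>-nonZero (<ᵇ⇒< 0 d d>0)}}
        (+-cancelʳ-≤ (dot l′ ρ) _ _ (≤-trans (+-monoʳ-≤ _ (combine-sound 64 (code / 64) Γ ps))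
          (subst₂ _≤_ (⊛⊕-sound d l r′) (⊛⊕-sound d r l′) (≤ᶠ-sound (d ⊛ l ⊕ r′) (d ⊛ r ⊕ l′) ρ s))))
      where
      d = code % 64
      l′ = proj₁ (combination (code / 64) Γ)
      r′ = proj₂ (combination (code / 64) Γ)

    solvable-sound : ∀ Γ es cs → All (ρ ⊨_) Γ → T (solvable Γ es cs) → All (Solves ρ) es
    solvable-sound Γ []             cs            ps t = []
    solvable-sound Γ ((l , r) ∷ es) (c ∷ c′ ∷ cs) ps t
      with p , t′ ← T-∧⁻ {derivable Γ (form l) (form r) c} t
      with q , t″ ← T-∧⁻ {derivable Γ (form r) (form l) c′} t′ =
      subst₂ _≡_ (form-sound l ρ) (form-sound r ρ)
        (≤-antisym (derivable-sound Γ (form l) (form r) c ps p) (derivable-sound Γ (form r) (form l) c′ ps q))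
      ∷ solvable-sound Γ es cs ps t″
    solvable-sound Γ (_ ∷ _) []      ps ()
    solvable-sound Γ (_ ∷ _) (_ ∷ []) ps ()

    goal-sound : ∀ gs k → T (isJust k gs) → All (Solves ρ) (goal gs k) → Any (All (Solves ρ)) gs
    goal-sound (g ∷ gs) zero    _ es = here es
    goal-sound (g ∷ gs) (suc k) t es = there (goal-sound gs k t es)

    sound : ∀ Γ t → All (ρ ⊨_) Γ → T (check Γ t) → Any (All (Solves ρ)) gs
    sound Γ (inf c)     ps t =
      ⊥-elim (<⇒≱ (<ᶠ-sound (proj₂ (combination c Γ)) (proj₁ (combination c Γ)) ρ pos t) (combine-sound 64 c Γ ps))
    sound Γ (res k cs)  ps t with j , s ← T-∧⁻ {isJust k gs} t =
      goal-sound gs k j (solvable-sound Γ (goal gs k) cs ps s)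
    sound Γ (ask q t u) ps h with h₁ , h₂ ← T-∧⁻ {check (proj₁ (question q) ∷ Γ) t} h | answer q
    ... | inj₁ p = sound _ t (p ∷ ps) h₁
    ... | inj₂ p = sound _ u (p ∷ ps) h₂

-- Powers as variables and the comparisons between them

Pair : Set
Pair = Bool → Fin 5 → ℕ

pattern left  = true
pattern right = false

var : Bool → Fin 5 → ℕ
var left  i = 1 + toℕ i
var right i = 6 + toℕ i

env : ℕ → Pair → Env
env D γ = λ where
  0 → D
  1 → γ left 0F
  2 → γ left 1F
  3 → γ left 2F
  4 → γ left 3F
  5 → γ left 4F
  6 → γ right 0F
  7 → γ right 1F
  8 → γ right 2F
  9 → γ right 3F
  10 → γ right 4F
  -- A positive value at the indices that stand for nothing keeps `Positive` provable.
  _ → 1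

env-var : ∀ D γ s i → env D γ (var s i) ≡ γ s i
env-var D γ left  0F = refl
env-var D γ left  1F = refl
env-var D γ left  2F = refl
env-var D γ left  3F = refl
env-var D γ left  4F = refl
env-var D γ right 0F = refl
env-var D γ right 1F = refl
env-var D γ right 2F = refl
env-var D γ right 3F = refl
env-var D γ right 4F = refl

env-positive : ∀ {D γ} → 0 < D → (∀ s i → 0 < γ s i) → Positive (env D γ)
env-positive D>0 γ>0 0  = D>0
env-positive D>0 γ>0 1  = γ>0 left 0F
env-positive D>0 γ>0 2  = γ>0 left 1F
env-positive D>0 γ>0 3  = γ>0 left 2F
env-positive D>0 γ>0 4  = γ>0 left 3F
env-positive D>0 γ>0 5  = γ>0 left 4F
env-positive D>0 γ>0 6  = γ>0 right 0F
env-positive D>0 γ>0 7  = γ>0 right 1F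
env-positive D>0 γ>0 8  = γ>0 right 2F
env-positive D>0 γ>0 9  = γ>0 right 3F
env-positive D>0 γ>0 10 = γ>0 right 4F
env-positive D>0 γ>0 (suc (suc (suc (suc (suc (suc (suc (suc (suc (suc (suc _))))))))))) = s≤s z≤n

-- Differences of consecutive terms eliminate `N`, so that `D` is the only variable besides the ten
-- powers.
step : ℕ → Eqn
step i = (1 , 0) ∷ term i , term (suc i)
  where
  term : ℕ → Term
  term i = (1 , 1 + i) ∷ (1 , 6 + i) ∷ []

both : Eqn → List Row → List Row
both (l , r) Γ = (form l , form r) ∷ (form r , form l) ∷ Γ

rows : List Eqn → List Row
rows []       = []
rows (e ∷ es) = both e (rows es)

rows-sound : ∀ ρ es → All (Solves ρ) es → All (ρ ⊨_) (rows es)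
rows-sound ρ []             []       = []
rows-sound ρ ((l , r) ∷ es) (p ∷ ps) = ≤-reflexive q ∷ ≤-reflexive (sym q) ∷ rows-sound ρ es ps
  where q = trans (form-sound l ρ) (trans p (sym (form-sound r ρ)))

progression : List Eqn
progression = step 0 ∷ step 1 ∷ step 2 ∷ step 3 ∷ []

fin5 : ℕ → Fin 5
fin5 0 = 0F
fin5 1 = 1F
fin5 2 = 2F
fin5 3 = 3F
fin5 _ = 4F

-- The pair describes a gap in which no ratio of two powers may lie, and the index m tells the gaps
-- apart: for a single base a they reach from a^m to a^(m+1).
Scales : Set
Scales = Bool → Bool → ℕ → ℕ × ℕ

Separates : Scales → Pair → Set
Separates F γ = ∀ s t i j m → γ s i ≤ proj₁ (F s t m) * γ t j ⊎ proj₂ (F s t m) * γ t j ≤ γ s i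

-- The code of a question is i + 5 j + 25 s + 50 t + 100 m with digits s, t equal to 0 for left and 1 for right.
question : Scales → ℕ → Row × Row
question F q = (unit i 1 , unit j (proj₁ f)) , (unit j (proj₂ f) , unit i 1)
  where
  s = q / 25 % 2 ≡ᵇ 0
  t = q / 50 % 2 ≡ᵇ 0
  i = var s (fin5 (q % 5))
  j = var t (fin5 (q / 5 % 5))
  f = F s t (q / 100)

question-sound : ∀ D γ F → Separates F γ → ∀ q →
  env D γ ⊨ proj₁ (question F q) ⊎ env D γ ⊨ proj₂ (question F q)
question-sound D γ F sep q = answer (sep s t i j (q / 100))
  where
  s = q / 25 % 2 ≡ᵇ 0
  t = q / 50 % 2 ≡ᵇ 0
  i = fin5 (q % 5)
  j = fin5 (q / 5 % 5)
  f = F s t (q / 100)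
  ρ = env D γ

  dot-var : ∀ c s i → dot (unit (var s i) c) ρ ≡ c * γ s i
  dot-var c s i = trans (dot-unit (var s i) c ρ) (cong (c *_) (env-var D γ s i))

  dot-var₁ : ∀ s i → dot (unit (var s i) 1) ρ ≡ γ s i
  dot-var₁ s i = trans (dot-var 1 s i) (*-identityˡ _)

  answer : γ s i ≤ proj₁ f * γ t j ⊎ proj₂ f * γ t j ≤ γ s i → _
  answer (inj₁ p) = inj₁ (subst₂ _≤_ (sym (dot-var₁ s i)) (sym (dot-var (proj₁ f) t j)) p)
  answer (inj₂ p) = inj₂ (subst₂ _≤_ (sym (dot-var (proj₂ f) t j)) (sym (dot-var₁ s i)) p)

powers : ℕ → ℕ → (Fin 5 → ℕ) → (Fin 5 → ℕ) → Pair
powers a b x y left  i = a ^ x i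
powers a b x y right i = b ^ y i

exact : ℕ → ℕ → ℕ × ℕ
exact a m = a ^ m , a ^ suc m

-- Only m = 0 is informative: the other questions are answered by 0 ≤ x.
coarse : ℕ → ℕ → ℕ × ℕ
coarse c zero    = 1 , c
coarse c (suc m) = 0 , 0

separate : ∀ a .{{_ : NonZero a}} m x y → a ^ x ≤ a ^ m * a ^ y ⊎ a ^ suc m * a ^ y ≤ a ^ x
separate a m x y with ≤-<-connex x (m + y)
... | inj₁ p = inj₁ (subst (a ^ x ≤_) (^-distribˡ-+-* a m y) (^-monoʳ-≤ a p))
... | inj₂ p = inj₂ (subst (_≤ a ^ x) (^-distribˡ-+-* a (suc m) y) (^-monoʳ-≤ a p))

coarse-separate : ∀ {c} a .{{_ : NonZero a}} m x y → c ≤ a →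
  a ^ x ≤ proj₁ (coarse c m) * a ^ y ⊎ proj₂ (coarse c m) * a ^ y ≤ a ^ x
coarse-separate a (suc m) x y c≤a = inj₂ z≤n
coarse-separate a zero x y c≤a with separate a 0 x y
... | inj₁ p = inj₁ p
... | inj₂ p = inj₂ (≤-trans (*-monoˡ-≤ (a ^ y) (≤-trans c≤a (≤-reflexive (sym (*-identityʳ a))))) p)

-- Ratios between powers of two unspecified bases leave no known gap. The factors 0 turn a mixed
-- question into 0 ≤ u, which carries no information.
unrelated : (ℕ → ℕ × ℕ) → (ℕ → ℕ × ℕ) → Scales
unrelated f g left  left  = f
unrelated f g right right = g
unrelated f g _     _     = λ _ → 0 , 0

-- Differences of powers

prime-2 : Prime 2
prime-2 = from-yes (prime? 2)

prime-3 : Prime 3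
prime-3 = from-yes (prime? 3)

halve : ∀ n → (∃[ k ] n ≡ 2 * k) ⊎ (∃[ k ] n ≡ 1 + 2 * k)
halve zero = inj₁ (0 , refl)
halve (suc n) with halve n
... | inj₁ (k , refl) = inj₂ (k , refl)
... | inj₂ (k , refl) = inj₁ (suc k , solve-eq k)
  where
  solve-eq : ∀ k → 2 + 2 * k ≡ 2 * suc k
  solve-eq = solve-∀

remainder-divisible : ∀ {c} k a b → k * a ≡ k * b + c → k ∣ c
remainder-divisible k a b eq = ∣m+n∣m⇒∣n (subst (k ∣_) eq (m∣m*n a)) (m∣m*n b)

coprime-prime : ∀ {p d} → Prime p → ¬ p ∣ d → Coprime d p
coprime-prime pp p∤d (i∣d , i∣p) with prime⇒irreducible pp i∣p
... | inj₁ i≡1  = i≡1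
... | inj₂ refl = contradiction i∣d p∤d

∣-strip : ∀ {p d} → Prime p → ¬ p ∣ d → ∀ m r → d ∣ m * p ^ r → d ∣ m
∣-strip {p} {d} pp p∤d m zero    d∣ = subst (d ∣_) (*-identityʳ m) d∣
∣-strip {p} {d} pp p∤d m (suc r) d∣ = ∣-strip pp p∤d m r
  (coprime-divisor (coprime-prime pp p∤d) (subst (d ∣_) (swap m p (p ^ r)) d∣))
  where
  swap : ∀ m p x → m * (p * x) ≡ p * (m * x)
  swap = solve-∀

∣-prime-power : ∀ {p d} → Prime p → ∀ r → d ∣ p ^ r → ∃[ i ] d ≡ p ^ i
∣-prime-power pp zero d∣1 = 0 , ∣1⇒≡1 d∣1
∣-prime-power {p} {d} pp (suc r) d∣ with p ∣? d
... | no p∤d = 0 , ∣1⇒≡1 (∣-strip pp p∤d 1 (suc r) (subst (d ∣_) (sym (*-identityˡ _)) d∣))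
... | yes (divides q refl) with i , refl ← ∣-prime-power {d = q} pp r
        (*-cancelˡ-∣ p {{prime⇒nonZero pp}} (subst (_∣ p * p ^ r) (*-comm q p) d∣)) = suc i , *-comm (p ^ i) p

prime-∣-^ : ∀ {p b} → Prime p → ∀ n → p ∣ b ^ n → p ∣ b
prime-∣-^ {p} pp zero p∣1 = contradiction (∣1⇒≡1 p∣1) (λ { refl → from-no (prime? 1) pp })
prime-∣-^ {b = b} pp (suc n) p∣ with euclidsLemma b (b ^ n) pp p∣
... | inj₁ p∣b = p∣b
... | inj₂ p∣bⁿ = prime-∣-^ pp n p∣bⁿ

1≤^ : ∀ b n → 1 ≤ b → 1 ≤ b ^ n
1≤^ b zero    _   = ≤-refl
1≤^ b (suc n) 1≤b = *-mono-≤ 1≤b (1≤^ b n 1≤b)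

base≤^ : ∀ b n → 1 ≤ b → b ≤ b ^ suc n
base≤^ b n 1≤b = subst (_≤ b ^ suc n) (*-identityʳ b) (*-monoʳ-≤ b (1≤^ b n 1≤b))

^-cancelʳ-< : ∀ b m n → 1 ≤ b → b ^ m < b ^ n → m < n
^-cancelʳ-< b m n 1≤b lt with m <? n
... | yes m<n = m<n
... | no m≮n = contradiction lt (≤⇒≯ (^-monoʳ-≤ b {{>-nonZero 1≤b}} (≮⇒≥ m≮n)))

-- The factorisation d = b^y (b^(k+1) - 1), with q for the second factor. Both factors divide d,
-- which in the applications is a small multiple of a prime power and so has few divisors.
difference-of-powers : ∀ {d} b v y → 1 ≤ b → b ^ v ≡ b ^ y + d → 0 < d →
  ∃₂ λ k q → v ≡ y + suc k × b ^ suc k ≡ 1 + q × d ≡ b ^ y * q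
difference-of-powers {d} b v y 1≤b eq d>0
  with k , v≡ ← m≤n⇒∃[o]m+o≡n (^-cancelʳ-< b y v 1≤b (subst (b ^ y <_) (sym eq) (m<m+n (b ^ y) d>0)))
  = k , pred (b ^ suc k) , trans (sym v≡) (sym (+-suc y k)) , sym (suc-pred (b ^ suc k) {{nz}}) , d≡
  where
  nz : NonZero (b ^ suc k)
  nz = >-nonZero (1≤^ b (suc k) 1≤b)
  open ≡-Reasoning
  d≡ : d ≡ b ^ y * pred (b ^ suc k)
  d≡ = +-cancelˡ-≡ (b ^ y) d _ (begin
    b ^ y + d                               ≡⟨ eq ⟨
    b ^ v                                   ≡⟨ cong (b ^_) (trans (sym v≡) (sym (+-suc y k))) ⟩
    b ^ (y + suc k)                         ≡⟨ ^-distribˡ-+-* b y (suc k) ⟩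
    b ^ y * b ^ suc k                       ≡⟨ cong (b ^ y *_) (suc-pred (b ^ suc k) {{nz}}) ⟨
    b ^ y * suc (pred (b ^ suc k))          ≡⟨ *-suc (b ^ y) _ ⟩
    b ^ y + b ^ y * pred (b ^ suc k)        ∎)

∣⇒≤⁺ : ∀ {n d} → 0 < n → d ∣ n → d ≤ n
∣⇒≤⁺ n>0 = ∣⇒≤ {{>-nonZero n>0}}

-- Suppose y > 0 and write m p^r = b^y q, where q + 1 is a positive power of b. If p divides b, then
-- p does not divide q, so q divides m and b ≤ q + 1 ≤ m + 1. If p does not divide b, then b^y
-- divides m and b ≤ m. Either contradicts m + 1 < b.
least-exponent : ∀ {p m b} → Prime p → 0 < m → suc m < b → ∀ v y r → b ^ v ≡ b ^ y + m * p ^ r → y ≡ 0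
least-exponent pp m>0 b>m v zero r eq = refl
least-exponent {p} {m} {b} pp m>0 b>m v (suc y) r eq
  with k , q , _ , b^k≡ , d≡ ← difference-of-powers b v (suc y) (≤-trans (s≤s z≤n) b>m) eq
         (*-mono-≤ m>0 (1≤^ p r (>-nonZero⁻¹ p {{prime⇒nonZero pp}})))
  with p ∣? b
... | yes p∣b = contradiction b>m (≤⇒≯ (≤-trans (base≤^ b k 1≤b) (subst (_≤ suc m) (sym b^k≡) (s≤s q≤m))))
  where
  1≤b = ≤-trans (s≤s z≤n) b>m
  p∤q : ¬ p ∣ q
  p∤q p∣q = contradiction (∣1⇒≡1 (∣m+n∣m⇒∣n (subst (p ∣_) (trans b^k≡ (+-comm 1 q)) (∣m⇒∣m*n (b ^ k) p∣b)) p∣q))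
    λ { refl → from-no (prime? 1) pp }
  q≤m = ∣⇒≤⁺ m>0 (∣-strip pp p∤q m r (subst (q ∣_) (sym d≡) (n∣m*n (b ^ suc y))))
... | no p∤b = contradiction (≤-trans (n≤1+n _) b>m)
  (≤⇒≯ (≤-trans (base≤^ b y 1≤b) (∣⇒≤⁺ m>0 (∣-strip pp (p∤b ∘ prime-∣-^ pp (suc y)) m r
    (subst (b ^ suc y ∣_) (sym d≡) (m∣m*n q))))))
  where 1≤b = ≤-trans (s≤s z≤n) b>m

-- The repunit 1 + b + ... + b^(n-1), that is (b^n - 1) / (b - 1).
rep : ℕ → ℕ → ℕ
rep b zero    = 0
rep b (suc n) = 1 + b * rep b n

geometric : ∀ c n → suc c ^ n ≡ 1 + c * rep (suc c) n
geometric c zero = cong suc (sym (*-zeroʳ c))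
geometric c (suc n) = trans (cong (suc c *_) (geometric c n)) (lemma c (rep (suc c) n))
  where
  lemma : ∀ c x → suc c * (1 + c * x) ≡ 1 + c * (1 + suc c * x)
  lemma = solve-∀

-- The base is 1 modulo c, so each of the n summands counts as 1. This carries divisibility of the
-- repunit over to divisibility of the exponent n.
rep-mod : ∀ c n → ∃[ t ] rep (suc c) n ≡ n + c * t
rep-mod c zero = 0 , sym (*-zeroʳ c)
rep-mod c (suc n) with t , eq ← rep-mod c n =
  t + (n + c * t) , trans (cong (λ x → 1 + suc c * x) eq) (lemma c n t)
  where
  lemma : ∀ c n t → 1 + suc c * (n + c * t) ≡ suc n + c * (t + (n + c * t))
  lemma = solve-∀

rep>base : ∀ b n → 1 ≤ b → b < rep b (2 + n)
rep>base b n 1≤b = s≤s (subst (_≤ b * rep b (suc n)) (*-identityʳ b) (*-monoʳ-≤ b (s≤s z≤n)))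

-- Exclusion of equations by residues modulo a fixed number

all any : (ℕ → Bool) → List ℕ → Bool
all f []       = true
all f (x ∷ xs) = f x ∧ all f xs
any f []       = false
any f (x ∷ xs) = f x ∨ any f xs

elem : ℕ → List ℕ → Bool
elem x = any (x ≡ᵇ_)

all-elem : ∀ f xs x → T (all f xs) → T (elem x xs) → T (f x)
all-elem f (y ∷ ys) x t h with x ≡ᵇ y in eq
... | true  = subst (T ∘ f) (sym (≡ᵇ⇒≡ x y (subst T (sym eq) _))) (proj₁ (T-∧⁻ {f y} t))
... | false = all-elem f ys x (proj₂ (T-∧⁻ {f y} t)) h

-- The tuple (c₀ , c₁ , b , k) stands for n ↦ c₀ + c₁ b^(k+n). The start k cuts off small exponents,
-- at which the powers are not yet periodic modulo m or an actual solution exists; c₁ = 0 gives a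
-- constant.
Sequence : Set
Sequence = ℕ × ℕ × ℕ × ℕ

value : Sequence → ℕ → ℕ
value (c₀ , c₁ , b , k) n = c₀ + coef c₁ (b ^ (k + n))

module Residues (fuel m : ℕ) .{{_ : NonZero m}} where

  orbit : ℕ → ℕ → ℕ → List ℕ
  orbit zero    b x = []
  orbit (suc n) b x = x ∷ orbit n b (b * x % m)

  residues : Sequence → List ℕ
  residues (c₀ , c₁ , b , k) = orbit fuel b (b ^ k % m)

  -- The first residues are all residues once they are stable under multiplication by b.
  closed : Sequence → Bool
  closed s@(c₀ , c₁ , b , k) = elem (b ^ k % m) (residues s) ∧ all (λ x → elem (b * x % m) (residues s)) (residues s)

  disjoint : Sequence → Sequence → Sequence → Bool
  disjoint s@(c₀ , c₁ , _) s′@(d₀ , d₁ , _) s″@(e₀ , e₁ , _) =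
    closed s ∧ closed s′ ∧ closed s″ ∧
    all (λ x → all (λ y → all (λ z →
      not ((c₀ + c₁ * x) % m ≡ᵇ ((d₀ + d₁ * y) % m + (e₀ + e₁ * z) % m) % m))
      (residues s″)) (residues s′)) (residues s)

  %-cong : ∀ c₀ c₁ x → (c₀ + c₁ * (x % m)) % m ≡ (c₀ + c₁ * x) % m
  %-cong c₀ c₁ x = begin
    (c₀ + c₁ * (x % m)) % m                       ≡⟨ %-distribˡ-+ c₀ _ m ⟩
    (c₀ % m + c₁ * (x % m) % m) % m               ≡⟨ cong (λ z → (c₀ % m + z) % m) mul ⟩
    (c₀ % m + c₁ * x % m) % m                     ≡⟨ %-distribˡ-+ c₀ _ m ⟨
    (c₀ + c₁ * x) % m                             ∎
    where
    open ≡-Reasoning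
    mul : c₁ * (x % m) % m ≡ c₁ * x % m
    mul = begin
      c₁ * (x % m) % m               ≡⟨ %-distribˡ-* c₁ (x % m) m ⟩
      (c₁ % m) * (x % m % m) % m     ≡⟨ cong (λ z → (c₁ % m) * z % m) (m%n%n≡m%n x m) ⟩
      (c₁ % m) * (x % m) % m         ≡⟨ %-distribˡ-* c₁ x m ⟨
      c₁ * x % m                     ∎

  closed-sound : ∀ (s : Sequence) n → T (closed s) → let (_ , _ , b , k) = s in T (elem (b ^ (k + n) % m) (residues s))
  closed-sound s@(_ , _ , b , k) zero t =
    subst (λ z → T (elem (b ^ z % m) (residues s))) (sym (+-identityʳ k)) (proj₁ (T-∧⁻ {elem (b ^ k % m) (residues s)} t))
  closed-sound s@(_ , _ , b , k) (suc n) t =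
    subst (λ z → T (elem z (residues s))) (trans (%-cong 0 b (b ^ (k + n))) (cong (λ z → b ^ z % m) (sym (+-suc k n))))
      (all-elem (λ x → elem (b * x % m) (residues s)) (residues s) (b ^ (k + n) % m) (proj₂ (T-∧⁻ {elem (b ^ k % m) (residues s)} t)) (closed-sound s n t))

  value-% : ∀ c₀ c₁ b k n → (c₀ + c₁ * (b ^ (k + n) % m)) % m ≡ value (c₀ , c₁ , b , k) n % m
  value-% c₀ c₁ b k n = trans (%-cong c₀ c₁ _) (cong (λ x → (c₀ + x) % m) (sym (coef≡* c₁ _)))

  disjoint-sound : ∀ s s′ s″ → T (disjoint s s′ s″) → ∀ i j k → value s i ≢ value s′ j + value s″ k
  disjoint-sound s@(c₀ , c₁ , a , n) s′@(d₀ , d₁ , b , n′) s″@(e₀ , e₁ , c , n″) t i j k eq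
    with t₁ , u₁ ← T-∧⁻ {closed s} t
    with t₂ , u₂ ← T-∧⁻ {closed s′} u₁
    with t₃ , u₃ ← T-∧⁻ {closed s″} u₂ =
    T-not _ (all-elem (unequal x y) (residues s″) z
      (all-elem (λ y → all (unequal x y) (residues s″)) (residues s′) y
        (all-elem (λ x → all (λ y → all (unequal x y) (residues s″)) (residues s′)) (residues s) x
          u₃ (closed-sound s i t₁)) (closed-sound s′ j t₂)) (closed-sound s″ k t₃))
      (≡⇒≡ᵇ _ _ same)
    where
    x = a ^ (n + i) % m
    y = b ^ (n′ + j) % m
    z = c ^ (n″ + k) % m
    unequal : ℕ → ℕ → ℕ → Bool
    unequal x y z = not ((c₀ + c₁ * x) % m ≡ᵇ ((d₀ + d₁ * y) % m + (e₀ + e₁ * z) % m) % m)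
    T-not : ∀ p → T (not p) → ¬ T p
    T-not false _ ()
    same : (c₀ + c₁ * x) % m ≡ ((d₀ + d₁ * y) % m + (e₀ + e₁ * z) % m) % m
    same = trans (value-% c₀ c₁ a n i) (trans (cong (_% m) eq) (trans (%-distribˡ-+ (value s′ j) (value s″ k) m)
      (cong₂ (λ x y → (x + y) % m) (sym (value-% d₀ d₁ b n′ j)) (sym (value-% e₀ e₁ c n″ k)))))

open Residues using (disjoint; disjoint-sound)

-- Thirty residues exhaust every orbit that occurs. Exhaustion is itself tested by `closed`, so too
-- small a bound could only make the test fail.
excluded₂ : ∀ m .{{_ : NonZero m}} s s′ s″ → T (disjoint 30 m s s′ s″) →
  ∀ i j k → value s i ≢ value s′ j + value s″ k
excluded₂ m = disjoint-sound 30 m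

excluded : ∀ m .{{_ : NonZero m}} s s′ → T (disjoint 30 m s s′ (0 , 0 , 1 , 0)) →
  ∀ i j → value s i ≢ value s′ j
excluded m s s′ t i j eq = excluded₂ m s s′ (0 , 0 , 1 , 0) t i j 0 (trans eq (sym (+-identityʳ _)))

^-injectiveʳ : ∀ {m n} b → 2 ≤ b → b ^ m ≡ b ^ n → m ≡ n
^-injectiveʳ {m} {n} b 2≤b eq with <-cmp m n
... | tri< m<n _ _ = contradiction eq (<⇒≢ (^-monoʳ-< b 2≤b m<n))
... | tri≈ _ m≡n _ = m≡n
... | tri> _ _ n<m = contradiction (sym eq) (<⇒≢ (^-monoʳ-< b 2≤b n<m))

2+2*≡ : ∀ w → 2 + 2 * w ≡ 2 * suc w
2+2*≡ = solve-∀

3+2*≡ : ∀ w → 3 + 2 * w ≡ 1 + 2 * suc w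
3+2*≡ = solve-∀

odd⇒∤ : ∀ {n k} → n ≡ 1 + 2 * k → ¬ 2 ∣ n
odd⇒∤ {k = k} refl (divides q eq) = from-no (2 ∣? 1)
  (remainder-divisible 2 q k (trans (*-comm 2 q) (trans (sym eq) (+-comm 1 (2 * k)))))

∤⇒odd : ∀ {n} → ¬ 2 ∣ n → ∃[ k ] n ≡ 1 + 2 * k
∤⇒odd {n} ∤n with halve n
... | inj₁ (k , refl) = contradiction (m∣m*n k) ∤n
... | inj₂ odd        = odd

positive-multiple : ∀ k n → suc k * 2 ^ n ≢ 0
positive-multiple k n eq = contradiction (sym eq) (<⇒≢ (*-mono-≤ (s≤s {0} {k} z≤n) (1≤^ 2 n (s≤s z≤n))))

2+2^≡2^ : ∀ i j → 2 + 2 ^ i ≡ 2 ^ j → i ≡ 1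
2+2^≡2^ 1 j eq = refl
2+2^≡2^ 0 j eq = contradiction eq (excluded 6 (3 , 0 , 2 , 0) (0 , 1 , 2 , 0) _ 0 j)
2+2^≡2^ (suc (suc i)) 1 eq = contradiction (suc-injective (suc-injective eq)) (m^n>0⇒≢0 (2 + i))
  where
  m^n>0⇒≢0 : ∀ n → 2 ^ n ≢ 0
  m^n>0⇒≢0 n = m<n⇒n≢0 (1≤^ 2 n (s≤s z≤n))
2+2^≡2^ (suc (suc i)) (suc (suc j)) eq = contradiction eq (excluded 4 (2 , 1 , 2 , 2) (0 , 1 , 2 , 2) _ i j)

2+2^≡3*2^ : ∀ i j → 2 + 2 ^ i ≡ 3 * 2 ^ j → i ≡ 0 ⊎ i ≡ 2
2+2^≡3*2^ 0 j eq = inj₁ refl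
2+2^≡3*2^ 2 j eq = inj₂ refl
2+2^≡3*2^ 1 j eq = contradiction eq (excluded 3 (4 , 0 , 2 , 0) (0 , 3 , 2 , 0) _ 0 j)
2+2^≡3*2^ (suc (suc (suc i))) j eq = contradiction eq (excluded 8 (2 , 1 , 2 , 3) (0 , 3 , 2 , 0) _ i j)

2+3*2^≡2^ : ∀ i j → 2 + 3 * 2 ^ i ≡ 2 ^ j → i ≡ 1
2+3*2^≡2^ 1 j eq = refl
2+3*2^≡2^ 0 j eq = contradiction eq (excluded 15 (5 , 0 , 2 , 0) (0 , 1 , 2 , 0) _ 0 j)
2+3*2^≡2^ (suc (suc i)) 1 eq = contradiction (suc-injective (suc-injective eq)) (positive-multiple 2 (2 + i))
2+3*2^≡2^ (suc (suc i)) (suc (suc j)) eq = contradiction eq (excluded 4 (2 , 3 , 2 , 2) (0 , 1 , 2 , 2) _ i j)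

∣-3*2^ : ∀ d r → d ∣ 3 * 2 ^ r → ∃[ i ] (d ≡ 2 ^ i ⊎ d ≡ 3 * 2 ^ i)
∣-3*2^ d r d∣ with 3 ∣? d
... | no 3∤d with i , eq ← ∣-prime-power prime-2 r
             (∣-strip prime-3 3∤d (2 ^ r) 1 (subst (d ∣_) (*-comm 3 (2 ^ r)) d∣)) = i , inj₁ eq
... | yes (divides q refl) with i , refl ← ∣-prime-power {d = q} prime-2 r
             (*-cancelˡ-∣ 3 (subst (_∣ 3 * 2 ^ r) (*-comm q 3) d∣)) = i , inj₂ (*-comm (2 ^ i) 3)

rep-odd : ∀ c n → 2 ∣ c → ¬ 2 ∣ n → ¬ 2 ∣ rep (suc c) n
rep-odd c n 2∣c 2∤n 2∣rep with t , eq ← rep-mod c n =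
  2∤n (∣m+n∣m⇒∣n (subst (2 ∣_) (trans eq (+-comm n (c * t))) 2∣rep) (∣m⇒∣m*n t 2∣c))

-- The cofactor rep b v of b - 1 in bᵛ - 1 is odd, so it divides m; but it exceeds b.
no-odd-exponent : ∀ b m w r → 3 ≤ b → 0 < m → m ≤ b → b ^ (3 + 2 * w) ≢ 1 + m * 2 ^ r
no-odd-exponent (suc c) m w r b≥3 m>0 m≤b eq =
  contradiction (≤-trans (rep>base (suc c) (1 + 2 * w) (s≤s z≤n)) (∣⇒≤⁺ m>0 S∣m)) (≤⇒≯ m≤b)
  where
  S = rep (suc c) (3 + 2 * w)
  S∣ : S ∣ m * 2 ^ r
  S∣ = subst (S ∣_) (suc-injective (trans (sym (geometric c (3 + 2 * w))) eq)) (n∣m*n c)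
  odd-exponent : ¬ 2 ∣ 3 + 2 * w
  odd-exponent = odd⇒∤ {k = suc w} (3+2*≡ w)
  b-odd : ∀ r → suc c ^ (3 + 2 * w) ≡ 1 + m * 2 ^ suc r → ¬ 2 ∣ suc c
  b-odd r eq 2∣b = odd⇒∤ {k = m * 2 ^ r} (trans eq (cong suc (lemma m (2 ^ r))))
    (∣m⇒∣m*n (suc c ^ (2 + 2 * w)) 2∣b)
    where
    lemma : ∀ m x → m * (2 * x) ≡ 2 * (m * x)
    lemma = solve-∀
  even-base : ∀ d → 2 + 2 * d ≡ suc d * 2
  even-base = solve-∀
  S∣m : S ∣ m
  S∣m = divides-m r eq S∣
    where
    divides-m : ∀ r → suc c ^ (3 + 2 * w) ≡ 1 + m * 2 ^ r → S ∣ m * 2 ^ r → S ∣ m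
    divides-m zero    _  S∣m*1 = subst (S ∣_) (*-identityʳ m) S∣m*1
    divides-m (suc r) eq S∣ with 2 ∣? c
    ... | yes 2∣c = ∣-strip prime-2 (rep-odd c (3 + 2 * w) 2∣c odd-exponent) m (suc r) S∣
    ... | no 2∤c with d , c≡ ← ∤⇒odd 2∤c = contradiction
      (divides (suc d) (trans (cong suc c≡) (even-base d))) (b-odd r eq)

-- The difference of squares: e and e + 2 are the neighbours of the odd or even number b^(w+1), and
-- both divide d. When d has few divisors, a gap of 2 between two of them leaves only small cases.
square-minus-one : ∀ b w d → 3 ≤ b → b ^ (2 + 2 * w) ≡ 1 + d → ∃[ e ] (b ^ suc w ≡ 1 + e × 2 ≤ e × e * (2 + e) ≡ d)
square-minus-one b w d b≥3 eq = e , sym 1+e≡ , ≤-pred (subst (3 ≤_) (sym 1+e≡) (≤-trans b≥3 (base≤^ b w 1≤b))) ,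
  suc-injective (trans (trans (lemma e) (cong (λ x → x * x) 1+e≡)) (trans (sym square) eq))
  where
  1≤b = ≤-trans (s≤s z≤n) b≥3
  e = pred (b ^ suc w)
  1+e≡ : suc e ≡ b ^ suc w
  1+e≡ = suc-pred (b ^ suc w) {{>-nonZero (1≤^ b (suc w) 1≤b)}}
  square : b ^ (2 + 2 * w) ≡ b ^ suc w * b ^ suc w
  square = trans (cong (b ^_) (exponent w)) (^-distribˡ-+-* b (suc w) (suc w))
    where
    exponent : ∀ w → 2 + 2 * w ≡ suc w + suc w
    exponent = solve-∀
  lemma : ∀ e → suc (e * (2 + e)) ≡ suc e * suc e
  lemma = solve-∀

-- From the second power on, a base of at least 3 gives at least 9.
root-unique : ∀ b w c → 3 ≤ b → c < 9 → b ^ suc w ≡ c → w ≡ 0 × b ≡ c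
root-unique b zero    c b≥3 c<9 eq = refl , trans (sym (*-identityʳ b)) eq
root-unique b (suc w) c b≥3 c<9 eq = contradiction c<9
  (≤⇒≯ (subst (9 ≤_) eq (*-mono-≤ b≥3 (≤-trans b≥3 (base≤^ b w (≤-trans (s≤s z≤n) b≥3))))))

-- Both e and e + 2 have the form 2ⁱ or 3 · 2ⁱ. Two multiples of 3 cannot differ by 2, and the
-- powers 2 and 4 have a product without the factor 3. The mixed pairs are 1, 3 and 4, 6 and 6, 8,
-- of which e ≥ 2 excludes the first.
∣-3*2^-gap : ∀ e r → 2 ≤ e → e * (2 + e) ≡ 3 * 2 ^ r → e ≡ 4 ⊎ e ≡ 6
∣-3*2^-gap e r e≥2 eq with ∣-3*2^ e r (subst (e ∣_) eq (m∣m*n (2 + e))) | ∣-3*2^ (2 + e) r (subst (2 + e ∣_) eq (n∣m*n e))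
... | i , inj₁ refl | j , inj₁ h with refl ← 2+2^≡2^ i j h = contradiction eq (excluded 3 (8 , 0 , 2 , 0) (0 , 3 , 2 , 0) _ 0 r)
... | i , inj₂ refl | j , inj₂ h = contradiction (remainder-divisible 3 (2 ^ j) (2 ^ i) (trans (sym h) (+-comm 2 (3 * 2 ^ i)))) (from-no (3 ∣? 2))
... | i , inj₂ refl | j , inj₁ h with refl ← 2+3*2^≡2^ i j h = inj₂ refl
... | i , inj₁ refl | j , inj₂ h with 2+2^≡3*2^ i j h
...   | inj₁ refl = contradiction e≥2 (from-no (2 ≤? 1))
...   | inj₂ refl = inj₁ refl

-- An elementary case of Catalan's equation. Odd v ≥ 3 falls to `no-odd-exponent`; even v > 0 makes
-- b^(v/2) - 1 and b^(v/2) + 1 powers of two, hence 2 and 4, whence 9 = 1 + 8.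
power-minus-power-of-2 : ∀ b v r → 3 ≤ b → b ^ v ≡ 1 + 2 ^ r → v ≡ 1 ⊎ (b ≡ 3 × v ≡ 2 × r ≡ 3)
power-minus-power-of-2 b v r b≥3 eq with halve v
... | inj₁ (zero , refl)  = contradiction (suc-injective (sym eq)) (m<n⇒n≢0 (1≤^ 2 r (s≤s z≤n)))
... | inj₂ (zero , refl)  = inj₁ refl
... | inj₂ (suc w , refl) = contradiction
  (trans (cong (b ^_) (3+2*≡ w)) (trans eq (cong suc (sym (*-identityˡ (2 ^ r))))))
  (no-odd-exponent b 1 w r b≥3 (s≤s z≤n) (≤-trans (s≤s z≤n) b≥3))
... | inj₁ (suc w , refl)
  with e , b^≡ , e≥2 , e*≡ ← square-minus-one b w (2 ^ r) b≥3 (trans (cong (b ^_) (2+2*≡ w)) eq)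
  with i , refl ← ∣-prime-power prime-2 r (subst (e ∣_) e*≡ (m∣m*n (2 + e)))
  with j , h ← ∣-prime-power prime-2 r (subst (2 + e ∣_) e*≡ (n∣m*n e))
  with refl ← 2+2^≡2^ i j h
  with refl , refl ← root-unique b w 3 b≥3 (from-yes (3 <? 9)) b^≡
  = inj₂ (refl , refl , ^-injectiveʳ 2 ≤-refl (sym e*≡))

-- Even v > 0 leaves the factorisations 4 · 6 and 6 · 8, that is 25 = 1 + 24 and 49 = 1 + 48.
power-minus-3*power-of-2 : ∀ b v r → 3 ≤ b → b ^ v ≡ 1 + 3 * 2 ^ r →
  v ≡ 1 ⊎ (b ≡ 5 × v ≡ 2 × r ≡ 3) ⊎ (b ≡ 7 × v ≡ 2 × r ≡ 4)
power-minus-3*power-of-2 b v r b≥3 eq with halve v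
... | inj₁ (zero , refl)  = contradiction (suc-injective (sym eq)) (positive-multiple 2 r)
... | inj₂ (zero , refl)  = inj₁ refl
... | inj₂ (suc w , refl) = contradiction (trans (cong (b ^_) (3+2*≡ w)) eq)
  (no-odd-exponent b 3 w r b≥3 (s≤s z≤n) b≥3)
... | inj₁ (suc w , refl)
  with e , b^≡ , e≥2 , e*≡ ← square-minus-one b w (3 * 2 ^ r) b≥3 (trans (cong (b ^_) (2+2*≡ w)) eq)
  with ∣-3*2^-gap e r e≥2 e*≡
... | inj₁ refl with refl , refl ← root-unique b w 5 b≥3 (from-yes (5 <? 9)) b^≡ =
  inj₂ (inj₁ (refl , refl , ^-injectiveʳ 2 ≤-refl (*-cancelˡ-≡ _ _ 3 (sym e*≡))))
... | inj₂ refl with refl , refl ← root-unique b w 7 b≥3 (from-yes (7 <? 9)) b^≡ =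
  inj₂ (inj₂ (refl , refl , ^-injectiveʳ 2 ≤-refl (*-cancelˡ-≡ _ _ 3 (sym e*≡))))

-- Powers that exceed 1 by a multiple of a power of 3

even-multiple : ∀ m r → 2 ∣ m → ∃[ k ] m * r ≡ 2 * k
even-multiple m r (divides q refl) = q * r , lemma q r
  where
  lemma : ∀ q r → q * 2 * r ≡ 2 * (q * r)
  lemma = solve-∀

odd-predecessor : ∀ c → ¬ 2 ∣ suc c → 2 ∣ c
odd-predecessor c 2∤ with 2 ∣? c
... | yes 2∣c = 2∣c
... | no 2∤c with d , c≡ ← ∤⇒odd 2∤c = contradiction (divides (suc d) (trans (cong suc c≡) (lemma d))) 2∤
  where
  lemma : ∀ d → 2 + 2 * d ≡ suc d * 2
  lemma = solve-∀

-- The base 5 is -1 modulo 3, so an odd number of summands alternates to 1.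
rep-5-mod-3 : ∀ w → ∃[ t ] rep 5 (1 + 2 * w) ≡ 3 * t + 1
rep-5-mod-3 zero    = 0 , refl
rep-5-mod-3 (suc w) with t , eq ← rep-5-mod-3 w = 10 + 25 * t ,
  trans (cong (rep 5) (sym (3+2*≡ w))) (trans (cong (λ x → 1 + 5 * (1 + 5 * x)) eq) (lemma t))
  where
  lemma : ∀ t → 1 + 5 * (1 + 5 * (3 * t + 1)) ≡ 3 * (10 + 25 * t) + 1
  lemma = solve-∀

3∤rep-5 : ∀ w → ¬ 3 ∣ rep 5 (1 + 2 * w)
3∤rep-5 w 3∣ with t , eq ← rep-5-mod-3 w = from-no (3 ∣? 1) (∣m+n∣m⇒∣n (subst (3 ∣_) eq 3∣) (m∣m*n t))

∣4*3^ : ∀ {d m} r → m ∣ 4 → ¬ 2 ∣ d → d ∣ m * 3 ^ r → d ∣ 3 ^ r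
∣4*3^ {d} {m} r m∣4 2∤d d∣ = ∣-strip prime-2 2∤d (3 ^ r) 2
  (∣-trans d∣ (subst (m * 3 ^ r ∣_) (*-comm 4 (3 ^ r)) (*-monoˡ-∣ (3 ^ r) m∣4)))

-- With B = 1 + 3 f the quotient (B³ - 1) / (B - 1) is 3 (1 + 3 f + 3 f²). As B is odd, f is even
-- and this quotient is odd, so it must be a power of 3; but 1 + 3 f + 3 f² exceeds 1 and is not
-- divisible by 3.
no-cube : ∀ B m r → 4 ≤ B → m ∣ 4 → ¬ 2 ∣ B → 3 ∣ pred B → B ^ 3 ≢ 1 + m * 3 ^ r
no-cube (suc e) m r B≥4 m∣4 2∤B (divides f refl) eq = impossible (∣-prime-power prime-3 r (∣4*3^ r m∣4 Q-odd Q∣))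
  where
  Q = 3 * (1 + 3 * f + 3 * (f * f))
  expand : ∀ f → suc (f * 3) * (suc (f * 3) * (suc (f * 3) * 1)) ≡ 1 + f * 3 * (3 * (1 + 3 * f + 3 * (f * f)))
  expand = solve-∀
  even : ∀ g → 3 * (1 + 3 * (2 * g) + 3 * (2 * g * (2 * g))) ≡ 1 + 2 * (1 + 9 * g + 18 * (g * g))
  even = solve-∀
  odd : ∀ g → suc ((1 + 2 * g) * 3) ≡ (2 + 3 * g) * 2
  odd = solve-∀
  regroup : ∀ f → 1 + 3 * f + 3 * (f * f) ≡ 3 * (f + f * f) + 1
  regroup = solve-∀
  Q∣ : Q ∣ m * 3 ^ r
  Q∣ = subst (Q ∣_) (suc-injective (trans (sym (expand f)) eq)) (n∣m*n (f * 3))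
  Q-odd : ¬ 2 ∣ Q
  Q-odd with halve f
  ... | inj₁ (g , refl) = odd⇒∤ {k = 1 + 9 * g + 18 * (g * g)} (even g)
  ... | inj₂ (g , refl) = contradiction (divides (2 + 3 * g) (odd g)) 2∤B
  f>0 : 0 < f
  f>0 = n≢0⇒n>0 λ { refl → contradiction B≥4 (from-no (4 ≤? 1)) }
  no-factor : ∀ f j → 0 < f → 1 + 3 * f + 3 * (f * f) ≢ 3 ^ j
  no-factor (suc f) zero    _ ()
  no-factor f       (suc j) _ eq =
    from-no (3 ∣? 1) (remainder-divisible 3 (3 ^ j) (f + f * f) (trans (sym eq) (regroup f)))
  impossible : ∃[ j ] Q ≡ 3 ^ j → ⊥
  impossible (zero  , Q≡1) = contradiction (divides (1 + 3 * f + 3 * (f * f)) (trans (sym Q≡1) (*-comm 3 _))) (from-no (3 ∣? 1))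
  impossible (suc j , Q≡) = no-factor f j f>0 (*-cancelˡ-≡ _ (3 ^ j) 3 Q≡)

-- The number is 4 f (f + 1), and one of f and f + 1 is even.
double-square : ∀ f → 8 ∣ 2 * f * (2 + 2 * f)
double-square f with halve f
... | inj₁ (g , refl) = divides (g * (1 + 2 * g)) (lemma g)
  where
  lemma : ∀ g → 2 * (2 * g) * (2 + 2 * (2 * g)) ≡ g * (1 + 2 * g) * 8
  lemma = solve-∀
... | inj₂ (g , refl) = divides ((1 + 2 * g) * (1 + g)) (lemma g)
  where
  lemma : ∀ g → 2 * (1 + 2 * g) * (2 + 2 * (1 + 2 * g)) ≡ (1 + 2 * g) * (1 + g) * 8
  lemma = solve-∀

-- The square bʷ⁺¹ bʷ⁺¹ is odd, hence 1 modulo 8, but 8 does not divide m 3ʳ.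
no-even-exponent : ∀ b m w r → 3 ≤ b → 2 ∣ m → m ∣ 4 → b ^ (2 + 2 * w) ≢ 1 + m * 3 ^ r
no-even-exponent b m w r b≥3 2∣m m∣4 eq
  with e , _ , _ , e*≡ ← square-minus-one b w (m * 3 ^ r) b≥3 eq | k , m*≡ ← even-multiple m (3 ^ r) 2∣m | halve e
... | inj₂ (f , refl) = odd⇒∤ {k = 1 + 4 * f + 2 * (f * f)} (trans (sym e*≡) (lemma f)) (subst (2 ∣_) (sym m*≡) (m∣m*n k))
  where
  lemma : ∀ f → (1 + 2 * f) * (2 + (1 + 2 * f)) ≡ 1 + 2 * (1 + 4 * f + 2 * (f * f))
  lemma = solve-∀
... | inj₁ (f , refl) = from-no (8 ∣? 4) (∣-trans 8∣m m∣4)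
  where
  8∣m : 8 ∣ m
  8∣m = ∣-strip prime-3 (from-no (3 ∣? 8)) m r (subst (8 ∣_) e*≡ (double-square f))

∣-^ : ∀ {d b} n → 0 < n → d ∣ b → d ∣ b ^ n
∣-^ {b = b} (suc n) _ d∣b = ∣m⇒∣m*n (b ^ n) d∣b

base≤^′ : ∀ {b} n → 1 ≤ b → 0 < n → b ≤ b ^ n
base≤^′ {b} (suc n) 1≤b _ = base≤^ b n 1≤b

small-base : ∀ c w → 3 ∣ rep (suc c) (1 + 2 * w) → 4 ≤ suc c → 2 ∣ c → ¬ c ∣ 4
small-base 4 w 3∣S _ _ _ = 3∤rep-5 w 3∣S
small-base 0 w _ (s≤s ()) _ _
small-base 1 w _ (s≤s (s≤s ())) _ _
small-base 2 w _ (s≤s (s≤s (s≤s ()))) _ _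
small-base 3 w _ _ 2∣3 _ = from-no (2 ∣? 3) 2∣3
small-base (suc (suc (suc (suc (suc c))))) w _ _ _ c∣4 =
  contradiction (∣⇒≤ c∣4) λ { (s≤s (s≤s (s≤s (s≤s ())))) }

-- The repunit S is odd and exceeds 1, so it is a power of 3 divisible by 3. If 3 does not divide c,
-- then c divides 4, which leaves c = 4, and the repunit of base 5 is 1 modulo 3. If 3 divides c,
-- then S ≡ z modulo 3, so 3 divides z and the power of b is a cube, against `no-cube`.
no-odd-exponent-3 : ∀ c z m r → 4 ≤ suc c → ¬ 2 ∣ z → suc c < rep (suc c) z → 2 ∣ m → m ∣ 4 →
  suc c ^ z ≢ 1 + m * 3 ^ r
no-odd-exponent-3 c z m r b≥4 2∤z S>b 2∣m m∣4 eq = odd-case (3 ∣? c)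
  where
  S = rep (suc c) z
  c*S≡ : c * S ≡ m * 3 ^ r
  c*S≡ = suc-injective (trans (sym (geometric c z)) eq)
  z>0 : 0 < z
  z>0 = n≢0⇒n>0 λ { refl → 2∤z (2 ∣0) }
  2∤b : ¬ 2 ∣ suc c
  2∤b 2∣b with k , m*≡ ← even-multiple m (3 ^ r) 2∣m =
    odd⇒∤ {k = k} (trans eq (cong suc m*≡)) (∣-^ z z>0 2∣b)
  2∣c = odd-predecessor c 2∤b
  3∣power : ∃[ k ] S ≡ 3 ^ k → 3 ∣ S
  3∣power (zero  , S≡1) = contradiction (≤-trans (s≤s (s≤s z≤n)) S>b) (≤⇒≯ (≤-reflexive S≡1))
  3∣power (suc k , S≡)  = divides (3 ^ k) (trans S≡ (*-comm 3 (3 ^ k)))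
  3∣S : 3 ∣ S
  3∣S = 3∣power (∣-prime-power prime-3 r (∣4*3^ r m∣4 (rep-odd c z 2∣c 2∤z) (subst (S ∣_) c*S≡ (n∣m*n c))))
  odd-case : Dec (3 ∣ c) → ⊥
  odd-case (no 3∤c) with w , refl ← ∤⇒odd 2∤z = small-base c w 3∣S b≥4 2∣c
    (∣-trans (∣-strip prime-3 3∤c m r (subst (c ∣_) c*S≡ (m∣m*n S))) m∣4)
  odd-case (yes 3∣c) with t , S≡ ← rep-mod c z
    with ∣m+n∣m⇒∣n (subst (3 ∣_) (trans S≡ (+-comm z (c * t))) 3∣S) (∣m⇒∣m*n t 3∣c)
  ... | divides u z≡ = no-cube (suc c ^ u) m r (≤-trans b≥4 (base≤^′ u (s≤s z≤n) u>0)) m∣4 (2∤b ∘ prime-∣-^ prime-2 u)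
    (subst (3 ∣_) (cong pred (sym (geometric c u))) (∣m⇒∣m*n (rep (suc c) u) 3∣c))
    (trans (^-*-assoc (suc c) u 3) (trans (cong (suc c ^_) (sym z≡)) eq))
    where
    u>0 : 0 < u
    u>0 = n≢0⇒n>0 λ { refl → contradiction z≡ (m<n⇒n≢0 z>0) }

power-minus-multiple-of-power-of-3 : ∀ b v m r → 4 ≤ b → 2 ∣ m → m ∣ 4 → b ^ v ≡ 1 + m * 3 ^ r → v ≡ 1
power-minus-multiple-of-power-of-3 b@(suc c) v m r b≥4 2∣m m∣4 eq with halve v
... | inj₂ (zero , refl)  = refl
... | inj₂ (suc w , refl) = contradiction eq (no-odd-exponent-3 c (1 + 2 * suc w) m r b≥4 (odd⇒∤ {k = suc w} refl)
  (subst (λ z → b < rep b z) (3+2*≡ w) (rep>base b (1 + 2 * w) (s≤s z≤n))) 2∣m m∣4)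
... | inj₁ (suc w , refl) = contradiction (trans (cong (b ^_) (2+2*≡ w)) eq)
  (no-even-exponent b m w r (≤-trans (n≤1+n 3) b≥4) 2∣m m∣4)
... | inj₁ (zero , refl)  = contradiction (suc-injective (sym eq))
  (m<n⇒n≢0 (*-mono-≤ {1} {m} {1} {3 ^ r} (n≢0⇒n>0 λ { refl → from-no (0 ∣? 4) m∣4 }) (1≤^ 3 r (s≤s z≤n))))

-- Congruences modulo 2ˢ + 1

module Congruence (M : ℕ) .{{_ : NonZero M}} where

  infix 4 _≋_
  _≋_ : ℕ → ℕ → Set
  m ≋ n = m % M ≡ n % M

  ≋-+ : ∀ {a a′ b b′} → a ≋ a′ → b ≋ b′ → a + b ≋ a′ + b′
  ≋-+ {a} {a′} {b} {b′} p q = trans (%-distribˡ-+ a b M)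
    (trans (cong₂ (λ x y → (x + y) % M) p q) (sym (%-distribˡ-+ a′ b′ M)))

  ≋-* : ∀ {a a′ b b′} → a ≋ a′ → b ≋ b′ → a * b ≋ a′ * b′
  ≋-* {a} {a′} {b} {b′} p q = trans (%-distribˡ-* a b M)
    (trans (cong₂ (λ x y → x * y % M) p q) (sym (%-distribˡ-* a′ b′ M)))

  ≋-*ˡ : ∀ c a b → a ≋ b → c * a ≋ c * b
  ≋-*ˡ c a b p = ≋-* {c} {c} {a} {b} refl p

  ≋-^ : ∀ n {a b} → a ≋ b → a ^ n ≋ b ^ n
  ≋-^ zero    p = refl
  ≋-^ (suc n) {a} {b} p = ≋-* {a} {b} {a ^ n} {b ^ n} p (≋-^ n p)

  ≋-multiple : ∀ c k → c + k * M ≋ c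
  ≋-multiple c k = [m+kn]%n≡m%n c k M

  ≋0⇒∣ : ∀ {n} → n ≋ 0 → M ∣ n
  ≋0⇒∣ {n} p = m%n≡0⇒n∣m n M (trans p (m<n⇒m%n≡m (>-nonZero⁻¹ M)))

  ≋-small : ∀ m n → m < M → n < M → m ≋ n → m ≡ n
  ≋-small m n m<M n<M p = trans (sym (m<n⇒m%n≡m m<M)) (trans p (m<n⇒m%n≡m n<M))

  ≋-swap : ∀ a b c → a + b ≋ 0 → a ≋ c → c + b ≋ 0
  ≋-swap a b c p q = trans (≋-+ {c} {a} {b} {b} (sym q) refl) p

  -- Negatives are expressed without subtraction: a + b ≋ 0 says that a is -b.
  ≋-opposite : ∀ {a b c} → a + b ≋ 0 → c + b ≋ 0 → a ≋ c
  ≋-opposite {a} {b} {c} p q = begin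
    a % M                  ≡⟨ cong (_% M) (+-identityʳ a) ⟨
    (a + 0) % M            ≡⟨ ≋-+ {a} {a} {0} {c + b} refl (sym q) ⟩
    (a + (c + b)) % M      ≡⟨ cong (_% M) (lemma a b c) ⟩
    ((a + b) + c) % M      ≡⟨ ≋-+ {a + b} {0} {c} {c} p refl ⟩
    (0 + c) % M            ∎
    where
    open ≡-Reasoning
    lemma : ∀ a b c → a + (c + b) ≡ (a + b) + c
    lemma = solve-∀

-- Modulo 2ˢ + 1 every power of two is ± 2ⁱ for some i < s.
module FermatModulus (s : ℕ) (s>0 : 0 < s) where

  modulus : ℕ
  modulus = suc (2 ^ s)

  open Congruence modulus public

  half-turn : 2 ^ s + 1 ≋ 0
  half-turn = trans (cong (_% modulus) (+-comm (2 ^ s) 1)) (≋-multiple′)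
    where
    ≋-multiple′ : modulus ≋ 0
    ≋-multiple′ = trans (cong (_% modulus) (sym (*-identityˡ modulus))) (≋-multiple 0 1)

  full-turn : 2 ^ (s + s) ≋ 1
  full-turn = ≋-opposite {2 ^ (s + s)} {2 ^ s} {1}
    (trans (cong (_% modulus) (factor (2 ^ s) (2 ^ (s + s)) (^-distribˡ-+-* 2 s s)))
      (trans (≋-*ˡ (2 ^ s) (2 ^ s + 1) 0 half-turn) (cong (_% modulus) (*-zeroʳ (2 ^ s)))))
    (trans (cong (_% modulus) (+-comm 1 (2 ^ s))) half-turn)
    where
    factor : ∀ x y → y ≡ x * x → y + x ≡ x * (x + 1)
    factor x y refl = lemma x
      where
      lemma : ∀ x → x * x + x ≡ x * (x + 1)
      lemma = solve-∀

  turns : ∀ j k → 2 ^ (j + k * (s + s)) ≋ 2 ^ j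
  turns j zero    = cong (λ j → 2 ^ j % modulus) (+-identityʳ j)
  turns j (suc k) = begin
    2 ^ (j + (s + s + k * (s + s))) % modulus     ≡⟨ cong (λ j → 2 ^ j % modulus) (lemma j (s + s) (k * (s + s))) ⟩
    2 ^ (s + s + (j + k * (s + s))) % modulus     ≡⟨ cong (_% modulus) (^-distribˡ-+-* 2 (s + s) _) ⟩
    2 ^ (s + s) * 2 ^ (j + k * (s + s)) % modulus ≡⟨ ≋-* {2 ^ (s + s)} {1} {2 ^ (j + k * (s + s))} {2 ^ j} full-turn (turns j k) ⟩
    1 * 2 ^ j % modulus                           ≡⟨ cong (_% modulus) (*-identityˡ (2 ^ j)) ⟩
    2 ^ j % modulus                               ∎
    where
    open ≡-Reasoning
    lemma : ∀ j t u → j + (t + u) ≡ t + (j + u)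
    lemma = solve-∀

  -- `minus` says 2ⁿ ≡ -2ⁱ, as a sum that vanishes. The equation for n is kept besides the
  -- congruence, because it passes the parity of n, or its class modulo 4, on to i when s is
  -- suitable.
  data Residue (n : ℕ) : Set where
    plus  : ∀ i k → i < s → n ≡ i + k * (s + s) → 2 ^ n ≋ 2 ^ i → Residue n
    minus : ∀ i k → i < s → n ≡ s + i + k * (s + s) → 2 ^ n + 2 ^ i ≋ 0 → Residue n

  residue : ∀ n → Residue n
  residue n with n % (s + s) | n / (s + s) | m≡m%n+[m/n]*n n (s + s) | m%n<n n (s + s)
    where instance
      nz : NonZero (s + s)
      nz = >-nonZero (≤-trans s>0 (m≤m+n s s))
  ... | j | k | n≡ | j<2s with j <? s
  ...   | yes j<s = plus j k j<s n≡ (trans (cong (λ n → 2 ^ n % modulus) n≡) (turns j k))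
  ...   | no j≮s with i , refl ← m≤n⇒∃[o]m+o≡n (≮⇒≥ j≮s) =
    minus i k (+-cancelˡ-< s i s j<2s) n≡ (≋-swap (2 ^ (s + i)) (2 ^ i) (2 ^ n)
      (trans (cong (_% modulus) (factor (2 ^ s) (2 ^ i) (2 ^ (s + i)) (^-distribˡ-+-* 2 s i)))
        (trans (≋-*ˡ (2 ^ i) (2 ^ s + 1) 0 half-turn) (cong (_% modulus) (*-zeroʳ (2 ^ i)))))
      (sym (trans (cong (λ n → 2 ^ n % modulus) n≡) (turns (s + i) k))))
    where
    factor : ∀ x y z → z ≡ x * y → z + y ≡ y * (x + 1)
    factor x y z refl = lemma x y
      where
      lemma : ∀ x y → x * y + y ≡ y * (x + 1)
      lemma = solve-∀

  2^<modulus : ∀ {i} → i ≤ s → 2 ^ i < modulus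
  2^<modulus i≤s = s≤s (^-monoʳ-≤ 2 i≤s)

-- Multiplying by 2^(r (2s - 1)), an inverse of 2ʳ, gives 3 ≡ 2^N. Both 3 and 2ⁱ lie below the
-- modulus, so 3 ≡ 2ⁱ is impossible; and 3 ≡ -2ⁱ makes 3 + 2ⁱ a multiple of 2ˢ + 1 below its double,
-- hence 2 + 2ⁱ = 2ˢ and s = 2, where 3 + 2 = 5.
three-is-not-a-power : ∀ s r w → 2 ≤ s → 3 * 2 ^ r % suc (2 ^ s) ≡ 2 ^ w % suc (2 ^ s) → s ≡ 2
three-is-not-a-power s r w s≥2 eq = conclude (residue N)
  where
  s>0 = ≤-trans (s≤s z≤n) s≥2
  open FermatModulus s s>0
  N = w + r * pred (s + s)
  r+≡ : r + r * pred (s + s) ≡ 0 + r * (s + s)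
  r+≡ = trans (sym (*-suc r _)) (cong (r *_) (suc-pred (s + s) {{>-nonZero (≤-trans s>0 (m≤m+n s s))}}))
  three≋ : 3 ≋ 2 ^ N
  three≋ = begin
    3 * 1 % modulus                                ≡⟨ ≋-*ˡ 3 (2 ^ (0 + r * (s + s))) 1 (turns 0 r) ⟨
    3 * 2 ^ (0 + r * (s + s)) % modulus            ≡⟨ cong (λ n → 3 * 2 ^ n % modulus) r+≡ ⟨
    3 * 2 ^ (r + r * pred (s + s)) % modulus       ≡⟨ cong (λ x → 3 * x % modulus) (^-distribˡ-+-* 2 r _) ⟩
    3 * (2 ^ r * 2 ^ (r * pred (s + s))) % modulus ≡⟨ cong (_% modulus) (*-assoc 3 (2 ^ r) _) ⟨
    3 * 2 ^ r * 2 ^ (r * pred (s + s)) % modulus   ≡⟨ ≋-* {3 * 2 ^ r} {2 ^ w} {2 ^ (r * pred (s + s))} eq refl ⟩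
    2 ^ w * 2 ^ (r * pred (s + s)) % modulus       ≡⟨ cong (_% modulus) (^-distribˡ-+-* 2 w _) ⟨
    2 ^ N % modulus                                ∎
    where open ≡-Reasoning
  3<modulus : 3 < modulus
  3<modulus = s≤s (≤-trans (n≤1+n 3) (^-monoʳ-≤ 2 s≥2))
  conclude : Residue N → s ≡ 2
  conclude (plus i k i<s _ p) = contradiction
    (≋-small 3 (2 ^ i) 3<modulus (2^<modulus (<⇒≤ i<s)) (trans three≋ p))
    (excluded 6 (3 , 0 , 2 , 0) (0 , 1 , 2 , 0) _ 0 i)
  conclude (minus i k i<s _ p) with ≋0⇒∣ (≋-swap (2 ^ N) (2 ^ i) 3 p (sym three≋))
  ... | divides 0 ()
  ... | divides (suc (suc q)) 3+2^≡ = contradiction 3+2^≡ (<⇒≢ (begin-strict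
    3 + 2 ^ i                              <⟨ +-mono-<-≤ 3<modulus (≤-trans (^-monoʳ-≤ 2 (<⇒≤ i<s)) (n≤1+n _)) ⟩
    modulus + modulus                      ≤⟨ +-monoʳ-≤ modulus (m≤m+n modulus (q * modulus)) ⟩
    modulus + (modulus + q * modulus)      ∎))
    where open ≤-Reasoning
  ... | divides 1 3+2^≡ with suc-injective (trans 3+2^≡ (+-identityʳ modulus))
  ...   | h with refl ← 2+2^≡2^ i s h = ^-injectiveʳ 2 ≤-refl (sym h)

-- Mixed equations in powers of 2, 3 and 5

3^+1≡2^ : ∀ n e → 1 + 3 ^ n ≡ 2 ^ e → (n ≡ 0 × e ≡ 1) ⊎ (n ≡ 1 × e ≡ 2)
3^+1≡2^ n 0 eq = contradiction (suc-injective eq) (m<n⇒n≢0 (1≤^ 3 n (s≤s z≤n)))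
3^+1≡2^ n 1 eq = inj₁ (^-injectiveʳ 3 (s≤s (s≤s z≤n)) (suc-injective eq) , refl)
3^+1≡2^ n 2 eq = inj₂ (^-injectiveʳ 3 (s≤s (s≤s z≤n)) (suc-injective eq) , refl)
3^+1≡2^ n (suc (suc (suc e))) eq = contradiction eq (excluded 8 (1 , 1 , 3 , 0) (0 , 1 , 2 , 3) _ n e)

-- The solution is 5 + 24 = 4 + 25; below r = 3 the right side is too large. Above it serves the
-- modulus 624 = 5⁴ - 1 = 16 · 3 · 13: there 5 has order 4, the powers of two from 2⁴ on have period
-- 12, and 2ʳ vanishes modulo 16.
5+3*2^≡2^+5^ : ∀ r w z → 5 + 3 * 2 ^ r ≡ 2 ^ w + 5 ^ (2 + z) → r ≡ 3
5+3*2^≡2^+5^ 3 w z eq = refl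
5+3*2^≡2^+5^ 0 w z eq = contradiction eq (<⇒≢ (≤-trans (from-yes (8 <? 25))
  (≤-trans (*-monoʳ-≤ 25 (1≤^ 5 z (s≤s z≤n))) (≤-trans (≤-reflexive (*-assoc 5 5 (5 ^ z))) (m≤n+m _ (2 ^ w))))))
5+3*2^≡2^+5^ 1 w z eq = contradiction eq (<⇒≢ (≤-trans (from-yes (11 <? 25))
  (≤-trans (*-monoʳ-≤ 25 (1≤^ 5 z (s≤s z≤n))) (≤-trans (≤-reflexive (*-assoc 5 5 (5 ^ z))) (m≤n+m _ (2 ^ w))))))
5+3*2^≡2^+5^ 2 w z eq = contradiction eq (<⇒≢ (≤-trans (from-yes (17 <? 25))
  (≤-trans (*-monoʳ-≤ 25 (1≤^ 5 z (s≤s z≤n))) (≤-trans (≤-reflexive (*-assoc 5 5 (5 ^ z))) (m≤n+m _ (2 ^ w))))))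
5+3*2^≡2^+5^ (suc (suc (suc (suc r)))) w z eq =
  contradiction eq (excluded₂ 624 (5 , 3 , 2 , 4) (0 , 1 , 2 , 0) (0 , 1 , 5 , 2) _ r w z)

-- The solution is 5 + 27 = 32. The modulus 1088 = 64 · 17 is chosen because 3 has order 16 modulo
-- both factors: 64 dividing 5 + 3ⁿ forces n ≡ 11 modulo 16, so 5 + 3ⁿ is 12 modulo 17, which is not
-- a power of 2 there.
5+3^≡2^ : ∀ n e → 5 + 3 ^ n ≡ 2 ^ (4 + e) → e ≡ 1
5+3^≡2^ n 1 eq = refl
5+3^≡2^ n 0 eq = contradiction eq (excluded 12 (5 , 1 , 3 , 0) (16 , 0 , 2 , 0) _ n 0)
5+3^≡2^ n (suc (suc e)) eq = contradiction eq (excluded 1088 (5 , 1 , 3 , 0) (0 , 1 , 2 , 6) _ n e)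

-- Modulo g - 1, where g = 3ʳ⁺¹, the base is 3 and g is 1, so that 3ʸ + 4 would be a power of 3.
family-base-3 : ∀ r y u → (1 + 2 * 3 ^ suc r) ^ y + 5 * 3 ^ suc r ≢ 1 + 3 ^ u
family-base-3 zero y u eq = contradiction
  (trans (+-comm 14 (7 ^ y)) (suc-injective (trans (sym (+-suc (7 ^ y) 14)) eq)))
  (excluded 8 (14 , 1 , 7 , 0) (0 , 1 , 3 , 0) _ y u)
family-base-3 (suc r) y u eq = contradiction equation
  (excluded 9 (4 , 1 , 3 , 0) (0 , 1 , 3 , 0) _ (y % R) (u % R))
  where
  R = 2 + r
  g = 3 ^ R
  N = pred g
  1+N≡ : suc N ≡ g
  1+N≡ = suc-pred g {{>-nonZero (1≤^ 3 R (s≤s z≤n))}}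
  8≤N : 8 ≤ N
  8≤N = ≤-pred (subst (9 ≤_) (sym 1+N≡) (≤-trans (*-monoʳ-≤ 9 (1≤^ 3 r (s≤s z≤n))) (≤-reflexive (*-assoc 3 3 (3 ^ r)))))
  instance
    N≢0 : NonZero N
    N≢0 = >-nonZero (≤-trans (s≤s z≤n) 8≤N)
  open Congruence N
  g≋1 : g ≋ 1
  g≋1 = trans (cong (_% N) (trans (sym 1+N≡) (cong suc (sym (*-identityˡ N))))) (≋-multiple 1 1)
  reduce : ∀ n → 3 ^ n ≋ 3 ^ (n % R)
  reduce n = begin
    3 ^ n % N                              ≡⟨ cong (λ n → 3 ^ n % N) (m≡m%n+[m/n]*n n R) ⟩
    3 ^ (n % R + n / R * R) % N            ≡⟨ cong (_% N) (^-distribˡ-+-* 3 (n % R) (n / R * R)) ⟩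
    3 ^ (n % R) * 3 ^ (n / R * R) % N      ≡⟨ ≋-*ˡ (3 ^ (n % R)) (3 ^ (n / R * R)) 1 one ⟩
    3 ^ (n % R) * 1 % N                    ≡⟨ cong (_% N) (*-identityʳ _) ⟩
    3 ^ (n % R) % N                        ∎
    where
    open ≡-Reasoning
    one : 3 ^ (n / R * R) ≋ 1
    one = trans (cong (_% N) (trans (cong (3 ^_) (*-comm (n / R) R)) (sym (^-*-assoc 3 R (n / R)))))
      (trans (≋-^ (n / R) {g} {1} g≋1) (cong (_% N) (^-zeroˡ (n / R))))
  3^<  : ∀ n → 3 * 3 ^ (n % R) ≤ g
  3^< n = ^-monoʳ-≤ 3 (m%n<n n R)
  congruent : 4 + 3 ^ (y % R) ≋ 3 ^ (u % R)
  congruent = +-cancel-1 (begin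
    (1 + (4 + 3 ^ (y % R))) % N          ≡⟨ ≋-+ {5} {5} {3 ^ (y % R)} {(1 + 2 * g) ^ y} refl
                                              (trans (sym (reduce y)) (≋-^ y {3} {1 + 2 * g} (sym b≋3))) ⟩
    (5 + (1 + 2 * g) ^ y) % N            ≡⟨ ≋-+ {5} {5 * g} {(1 + 2 * g) ^ y} {(1 + 2 * g) ^ y} (sym (≋-*ˡ 5 g 1 g≋1)) refl ⟩
    (5 * g + (1 + 2 * g) ^ y) % N        ≡⟨ cong (_% N) (trans (+-comm (5 * g) _) eq) ⟩
    (1 + 3 ^ u) % N                      ≡⟨ ≋-+ {1} {1} {3 ^ u} {3 ^ (u % R)} refl (reduce u) ⟩
    (1 + 3 ^ (u % R)) % N                ∎)
    where
    open ≡-Reasoning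
    b≋3 : 1 + 2 * g ≋ 3
    b≋3 = ≋-+ {1} {1} {2 * g} {2} refl (≋-*ˡ 2 g 1 g≋1)
    +-cancel-1 : ∀ {m n} → 1 + m ≋ 1 + n → m ≋ n
    +-cancel-1 {m} {n} p = begin
      m % N                       ≡⟨ ≋-multiple m 1 ⟨
      (m + 1 * N) % N             ≡⟨ cong (_% N) (shift m) ⟩
      (1 + m + pred N) % N        ≡⟨ ≋-+ {1 + m} {1 + n} {pred N} {pred N} p refl ⟩
      (1 + n + pred N) % N        ≡⟨ cong (_% N) (shift n) ⟨
      (n + 1 * N) % N             ≡⟨ ≋-multiple n 1 ⟩
      n % N                       ∎
      where
      shift : ∀ m → m + 1 * N ≡ 1 + m + pred N
      shift m = trans (cong (m +_) (trans (*-identityˡ N) (sym (suc-pred N)))) (+-suc m (pred N))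
  equation : 4 + 3 ^ (y % R) ≡ 3 ^ (u % R)
  -- Reduced exponents are below `R`, so the powers are at most g / 3, and 4 + g / 3 < g - 1 as soon
  -- as 13 < 2 (g - 1). Hence the congruence modulo g - 1 is an equality.
  equation = ≋-small _ _ (bound (3 ^ (y % R)) (3^< y) 8≤N) (bound′ (3 ^ (u % R)) (3^< u) 8≤N) congruent
    where
    bound : ∀ x → 3 * x ≤ g → 8 ≤ N → 4 + x < N
    bound x 3x≤g 8≤N = *-cancelˡ-< 3 (4 + x) N (begin-strict
      3 * (4 + x)        ≡⟨ *-distribˡ-+ 3 4 x ⟩
      12 + 3 * x         ≤⟨ +-monoʳ-≤ 12 3x≤g ⟩
      12 + g             ≡⟨ cong (12 +_) 1+N≡ ⟨
      13 + N             <⟨ +-monoˡ-≤ N (≤-trans (from-yes (14 ≤? 16)) (*-monoʳ-≤ 2 8≤N)) ⟩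
      2 * N + N          ≡⟨ lemma N ⟩
      3 * N              ∎)
      where
      open ≤-Reasoning
      lemma : ∀ n → 2 * n + n ≡ 3 * n
      lemma = solve-∀
    bound′ : ∀ x → 3 * x ≤ g → 8 ≤ N → x < N
    bound′ x 3x≤g 8≤N = ≤-trans (s≤s (m≤n+m x 4)) (bound x 3x≤g 8≤N)

-- The equation (1 + 3 · 2ʳ)ʸ = 1 + 2ʳ + 2ˣ

even-part : ∀ i a b → 2 * a ≡ i + 2 * b → ∃[ h ] i ≡ 2 * h
even-part i a b eq with halve i
... | inj₁ even = even
... | inj₂ (h , refl) = contradiction (divides a (trans (sym (shift h b)) (trans (sym eq) (*-comm 2 a)))) (odd⇒∤ {k = h + b} refl)
  where
  shift : ∀ h b → 1 + 2 * h + 2 * b ≡ 1 + 2 * (h + b)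
  shift = solve-∀

odd-part : ∀ i a b → 1 + 2 * a ≡ i + 2 * b → ∃[ h ] i ≡ 1 + 2 * h
odd-part i a b eq with halve i
... | inj₂ odd = odd
... | inj₁ (h , refl) = contradiction (divides (h + b) (trans eq (shift h b))) (odd⇒∤ {k = a} refl)
  where
  shift : ∀ h b → 2 * h + 2 * b ≡ (h + b) * 2
  shift = solve-∀

^-distribʳ-* : ∀ n a b → (a * b) ^ n ≡ a ^ n * b ^ n
^-distribʳ-* zero    a b = refl
^-distribʳ-* (suc n) a b = trans (cong (a * b *_) (^-distribʳ-* n a b)) (lemma a b (a ^ n) (b ^ n))
  where
  lemma : ∀ a b x y → a * b * (x * y) ≡ a * x * (b * y)
  lemma = solve-∀

2^-even : ∀ n → 2 ^ (2 * n) ≡ 4 ^ n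
2^-even n = sym (^-*-assoc 2 2 n)

2*2^≤2^ : ∀ {i j} → i < j → 2 * 2 ^ i ≤ 2 ^ j
2*2^≤2^ i<j = ^-monoʳ-≤ 2 i<j

sum-bound′ : ∀ {i j K} → i < j → j < K → 4 * (2 ^ i + 2 ^ j) ≤ 3 * 2 ^ K
sum-bound′ {i} {j} {K} i<j j<K = begin
  4 * (2 ^ i + 2 ^ j)              ≡⟨ lemma (2 ^ i) (2 ^ j) ⟩
  2 * (2 * 2 ^ i) + 4 * 2 ^ j      ≤⟨ +-monoˡ-≤ (4 * 2 ^ j) (*-monoʳ-≤ 2 (2*2^≤2^ i<j)) ⟩
  2 * 2 ^ j + 4 * 2 ^ j            ≡⟨ lemma′ (2 ^ j) ⟩
  3 * (2 * 2 ^ j)                  ≤⟨ *-monoʳ-≤ 3 (2*2^≤2^ j<K) ⟩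
  3 * 2 ^ K                        ∎
  where
  open ≤-Reasoning
  lemma : ∀ x y → 4 * (x + y) ≡ 2 * (2 * x) + 4 * y
  lemma = solve-∀
  lemma′ : ∀ y → 2 * y + 4 * y ≡ 3 * (2 * y)
  lemma′ = solve-∀

-- The worst case is 2^(K-1) + 2^(K-2). The missing quarter of 2^K leaves room for the constants
-- that are added to such a sum modulo 2^K + 1.
sum-bound : ∀ {i j K} → i ≢ j → i < K → j < K → 4 * (2 ^ i + 2 ^ j) ≤ 3 * 2 ^ K
sum-bound {i} {j} {K} i≢j i<K j<K with <-cmp i j
... | tri< i<j _ _ = sum-bound′ i<j j<K
... | tri≈ _ i≡j _ = contradiction i≡j i≢j
... | tri> _ _ j<i = subst (λ x → 4 * x ≤ 3 * 2 ^ K) (+-comm (2 ^ j) (2 ^ i)) (sum-bound′ j<i i<K)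

module Pillai (r X Y q : ℕ) (Y≡ : Y ≡ 3 + 4 * q)
  (eq : (1 + 3 * 2 ^ r) ^ Y ≡ 1 + 2 ^ r + 2 ^ X) where

  u b : ℕ
  u = 2 ^ r
  b = 1 + 3 * u

  -- Modulo 2ʳ⁺¹ + 1 the base is - 1/2.
  r-odd : ∀ h m → 1 + r ≡ 2 * h → 2 ≤ h → X ≡ 2 * m → ⊥
  r-odd h m K≡ h≥2 X≡ = cases (residue Y) (residue E)
    where
    K = 1 + r
    open FermatModulus K (s≤s z≤n)
    E = 1 + Y + X
    P = 2 ^ Y
    Q = 2 ^ E
    -- As 2^K is -1 and `Y` is odd, this is (-1)^Y = -1.
    turn : 2 ^ (K * Y) ≋ 2 ^ K
    turn = trans (cong (λ Y → 2 ^ (K * Y) % modulus) Y≡) (trans (cong (λ n → 2 ^ n % modulus) (lemma K q)) (turns K (1 + 2 * q)))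
      where
      lemma : ∀ K q → K * (3 + 4 * q) ≡ K + (1 + 2 * q) * (K + K)
      lemma = solve-∀
    doubled : 2 * (2 * b) ^ Y ≡ P + Q + 2 ^ Y * modulus
    doubled = begin
      2 * (2 * b) ^ Y                     ≡⟨ cong (2 *_) (^-distribʳ-* Y 2 b) ⟩
      2 * (P * b ^ Y)                     ≡⟨ cong (λ z → 2 * (P * z)) eq ⟩
      2 * (P * (1 + u + 2 ^ X))           ≡⟨ lemma P u (2 ^ X) ⟩
      P + 2 * P * 2 ^ X + P * (1 + 2 * u) ≡⟨ cong (λ z → P + z + P * modulus) (^-distribˡ-+-* 2 (1 + Y) X) ⟨
      P + Q + P * modulus                 ∎
      where
      open ≡-Reasoning
      lemma : ∀ p u x → 2 * (p * (1 + u + x)) ≡ p + 2 * p * x + p * (1 + 2 * u)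
      lemma = solve-∀
    base : 2 * b ≋ 2 ^ K
    base = trans (cong (_% modulus) (lemma u)) (≋-multiple (2 ^ K) 2)
      where
      lemma : ∀ u → 2 * (1 + 3 * u) ≡ 2 * u + 2 * (1 + 2 * u)
      lemma = solve-∀
    -- The equation times 2^(Y+1) reads 2 (2 b)^Y ≡ 2^Y + 2^(1+Y+X), and its left side is -2.
    sum : P + Q + 2 ≋ 0
    sum = begin
      (P + Q + 2) % modulus                   ≡⟨ ≋-+ {P + Q} {2 * 2 ^ K} {2} {2} P+Q refl ⟩
      (2 * 2 ^ K + 2) % modulus               ≡⟨ cong (_% modulus) (lemma (2 ^ K)) ⟩
      2 * (2 ^ K + 1) % modulus               ≡⟨ ≋-*ˡ 2 (2 ^ K + 1) 0 half-turn ⟩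
      0 % modulus                             ∎
      where
      open ≡-Reasoning
      lemma : ∀ x → 2 * x + 2 ≡ 2 * (x + 1)
      lemma = solve-∀
      P+Q : P + Q ≋ 2 * 2 ^ K
      P+Q = begin
        (P + Q) % modulus                     ≡⟨ ≋-multiple (P + Q) P ⟨
        (P + Q + P * modulus) % modulus       ≡⟨ cong (_% modulus) doubled ⟨
        2 * (2 * b) ^ Y % modulus             ≡⟨ ≋-*ˡ 2 ((2 * b) ^ Y) ((2 ^ K) ^ Y) (≋-^ Y {2 * b} {2 ^ K} base) ⟩
        2 * (2 ^ K) ^ Y % modulus             ≡⟨ cong (λ z → 2 * z % modulus) (^-*-assoc 2 K Y) ⟩
        2 * 2 ^ (K * Y) % modulus             ≡⟨ ≋-*ˡ 2 (2 ^ (K * Y)) (2 ^ K) turn ⟩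
        2 * 2 ^ K % modulus                   ∎
    K+K≡ : ∀ k → k * (K + K) ≡ 4 * (h * k)
    K+K≡ k = trans (cong (λ K → k * (K + K)) K≡) (lemma h k)
      where
      lemma : ∀ h k → k * (2 * h + 2 * h) ≡ 4 * (h * k)
      lemma = solve-∀
    8≤2^K : 8 ≤ 2 ^ K
    8≤2^K = ^-monoʳ-≤ 2 {3} (≤-trans (n≤1+n 3) (subst (4 ≤_) (sym K≡) (*-monoʳ-≤ 2 h≥2)))
    2+2^< : ∀ {i} → i < K → 2 + 2 ^ i < modulus
    2+2^< {i} i<K = s≤s (*-cancelˡ-≤ 2 (begin
      2 * (2 + 2 ^ i)       ≡⟨ *-distribˡ-+ 2 2 (2 ^ i) ⟩
      4 + 2 * 2 ^ i         ≤⟨ +-mono-≤ (≤-trans (m≤m+n 4 4) 8≤2^K) (2*2^≤2^ i<K) ⟩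
      2 ^ K + 2 ^ K         ≡⟨ cong (2 ^ K +_) (+-identityʳ (2 ^ K)) ⟨
      2 * 2 ^ K             ∎))
      where open ≤-Reasoning
    2*[h*k] : ∀ h k → 4 * (h * k) ≡ 2 * (2 * (h * k))
    2*[h*k] = solve-∀
    Y-odd : Y ≡ 1 + 2 * (1 + 2 * q)
    Y-odd = trans Y≡ (lemma q)
      where
      lemma : ∀ q → 3 + 4 * q ≡ 1 + 2 * (1 + 2 * q)
      lemma = solve-∀
    E-even : E ≡ 2 * (2 + 2 * q + m)
    E-even = trans (cong₂ (λ Y X → 1 + Y + X) Y≡ X≡) (lemma q m)
      where
      lemma : ∀ q m → 1 + (3 + 4 * q) + 2 * m ≡ 2 * (2 + 2 * q + m)
      lemma = solve-∀
    odd-plus : ∀ i k → Y ≡ i + k * (K + K) → ∃[ a ] i ≡ 1 + 2 * a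
    odd-plus i k Y≡′ = odd-part i (1 + 2 * q) (2 * (h * k))
      (trans (sym Y-odd) (trans Y≡′ (cong (i +_) (trans (K+K≡ k) (2*[h*k] h k)))))
    odd-minus : ∀ i k → Y ≡ K + i + k * (K + K) → ∃[ a ] i ≡ 1 + 2 * a
    odd-minus i k Y≡′ = odd-part i (1 + 2 * q) (h + 2 * (h * k))
      (trans (sym Y-odd) (trans Y≡′ (trans (cong₂ (λ t z → t + i + z) K≡ (K+K≡ k)) (lemma h i k))))
      where
      lemma : ∀ h i k → 2 * h + i + 4 * (h * k) ≡ i + 2 * (h + 2 * (h * k))
      lemma = solve-∀
    even-plus : ∀ i k → E ≡ i + k * (K + K) → ∃[ a ] i ≡ 2 * a
    even-plus i k E≡ = even-part i (2 + 2 * q + m) (2 * (h * k))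
      (trans (sym E-even) (trans E≡ (cong (i +_) (trans (K+K≡ k) (2*[h*k] h k)))))
    even-minus : ∀ i k → E ≡ K + i + k * (K + K) → ∃[ a ] i ≡ 2 * a
    even-minus i k E≡ = even-part i (2 + 2 * q + m) (h + 2 * (h * k))
      (trans (sym E-even) (trans E≡ (trans (cong₂ (λ t z → t + i + z) K≡ (K+K≡ k)) (lemma h i k))))
      where
      lemma : ∀ h i k → 2 * h + i + 4 * (h * k) ≡ i + 2 * (h + 2 * (h * k))
      lemma = solve-∀
    odd≢even : ∀ {i j} → ∃[ a ] i ≡ 1 + 2 * a → ∃[ a ] j ≡ 2 * a → i ≢ j
    odd≢even (a , i≡) (a′ , refl) i≡j = odd⇒∤ {k = a} (trans (sym i≡j) i≡) (m∣m*n a′)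
    small-sum : ∀ {i j} → i ≢ j → i < K → j < K → 2 ^ i + 2 ^ j + 2 < modulus
    small-sum {i} {j} i≢j i<K j<K = s≤s (*-cancelˡ-≤ 4 (begin
      4 * (2 ^ i + 2 ^ j + 2)         ≡⟨ *-distribˡ-+ 4 (2 ^ i + 2 ^ j) 2 ⟩
      4 * (2 ^ i + 2 ^ j) + 8         ≤⟨ +-mono-≤ (sum-bound i≢j i<K j<K) 8≤2^K ⟩
      3 * 2 ^ K + 2 ^ K               ≡⟨ +-comm (3 * 2 ^ K) (2 ^ K) ⟩
      4 * 2 ^ K                       ∎))
      where open ≤-Reasoning
    -- `K` is even, so the reduced exponents inherit their parities, odd for `Y` and even for `E`,
    -- and differ. Then 2 ± 2ⁱ ± 2ʲ ≡ 0 leaves only 2 + 2 - 4 with i = 1; since 2 `K` is a multiple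
    -- of 4, this contradicts Y ≡ 3 modulo 4.
    cases : Residue Y → Residue E → ⊥
    cases (plus i k i<K Y≡′ p) (plus j k′ j<K E≡ p′) = contradiction
      (≋0⇒∣ (trans (≋-+ {2 ^ i + 2 ^ j} {P + Q} {2} {2} (≋-+ {2 ^ i} {P} {2 ^ j} {Q} (sym p) (sym p′)) refl) sum))
      (>⇒∤ {{>-nonZero (≤-trans (s≤s z≤n) (m≤n+m 2 (2 ^ i + 2 ^ j)))}}
        (small-sum (odd≢even (odd-plus i k Y≡′) (even-plus j k′ E≡)) i<K j<K))
    cases (plus i k i<K Y≡′ p) (minus j k′ j<K E≡ p′) = contradiction
      (remainder-divisible 4 (h * k) q (trans (sym (K+K≡ k)) (suc-injective (trans (sym (cong (_+ k * (K + K)) i≡1)) (trans (sym Y≡′) (trans Y≡ (lemma q)))))))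
      (from-no (4 ∣? 2))
      where
      lemma : ∀ q → 3 + 4 * q ≡ 1 + (4 * q + 2)
      lemma = solve-∀
      i≡1 : i ≡ 1
      i≡1 = 2+2^≡2^ i j (≋-small (2 + 2 ^ i) (2 ^ j) (2+2^< i<K) (2^<modulus (<⇒≤ j<K))
        (≋-opposite {2 + 2 ^ i} {Q} {2 ^ j} (trans (≋-+ {2 + 2 ^ i} {2 + P} {Q} {Q} (≋-+ {2} {2} {2 ^ i} {P} refl (sym p)) refl)
          (trans (cong (_% modulus) (lemma′ P Q)) sum)) (trans (cong (_% modulus) (+-comm (2 ^ j) Q)) p′)))
        where
        lemma′ : ∀ p q → 2 + p + q ≡ p + q + 2
        lemma′ = solve-∀
    cases (minus i k i<K Y≡′ p) (plus j k′ j<K E≡ p′) = contradiction j≡1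
      λ { refl → odd≢even {1} (0 , refl) (even-plus j k′ E≡) refl }
      where
      j≡1 : j ≡ 1
      j≡1 = 2+2^≡2^ j i (≋-small (2 + 2 ^ j) (2 ^ i) (2+2^< j<K) (2^<modulus (<⇒≤ i<K))
        (≋-opposite {2 + 2 ^ j} {P} {2 ^ i} (trans (≋-+ {2 + 2 ^ j} {2 + Q} {P} {P} (≋-+ {2} {2} {2 ^ j} {Q} refl (sym p′)) refl)
          (trans (cong (_% modulus) (lemma′ P Q)) sum)) (trans (cong (_% modulus) (+-comm (2 ^ i) P)) p)))
        where
        lemma′ : ∀ p q → 2 + q + p ≡ p + q + 2
        lemma′ = solve-∀
    cases (minus i k i<K Y≡′ p) (minus j k′ j<K E≡ p′) with odd-minus i k Y≡′
    ... | a , i≡ = contradiction two (<⇒≢ (≤-trans (+-mono-≤ {2} {2 ^ i} {1} {2 ^ j}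
            (subst (λ i → 2 ≤ 2 ^ i) (sym i≡) (*-monoʳ-≤ 2 (1≤^ 2 (2 * a) (s≤s z≤n)))) (1≤^ 2 j (s≤s z≤n))) ≤-refl))
      where
      two : 2 ≡ 2 ^ i + 2 ^ j
      two = ≋-small 2 (2 ^ i + 2 ^ j) (≤-trans (s≤s (s≤s (s≤s z≤n))) (≤-trans 8≤2^K (n≤1+n _)))
        (≤-trans (s≤s (m≤m+n (2 ^ i + 2 ^ j) 2)) (small-sum (odd≢even (a , i≡) (even-minus j k′ E≡)) i<K j<K))
        (≋-opposite {2} {P + Q} {2 ^ i + 2 ^ j} (trans (cong (_% modulus) (+-comm 2 (P + Q))) sum)
          (trans (cong (_% modulus) (lemma (2 ^ i) (2 ^ j) P Q)) (≋-+ {P + 2 ^ i} {0} {Q + 2 ^ j} {0} p p′)))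
        where
        lemma : ∀ i j p q → i + j + (p + q) ≡ p + i + (q + j)
        lemma = solve-∀

module Pillai-even (r X Y q : ℕ) (Y≡ : Y ≡ 3 + 4 * q)
  (eq : (1 + 3 * 2 ^ r) ^ Y ≡ 1 + 2 ^ r + 2 ^ X) where

  u b : ℕ
  u = 2 ^ r
  b = 1 + 3 * u

  4^< : ∀ {i j} → i < j → 4 * 4 ^ i ≤ 4 ^ j
  4^< i<j = ^-monoʳ-≤ 4 i<j

  halve-< : ∀ i j → 2 * i < 2 * j → i < j
  halve-< i j = *-cancelˡ-< 2 i j

  halve-<′ : ∀ i j → 1 + 2 * i < 2 * j → i < j
  halve-<′ i j lt = *-cancelˡ-< 2 i j (≤-trans (n≤1+n _) lt)

  -- Modulo 2ʳ⁺² + 1 the base is 1/4.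
  r≡2-mod-4 : ∀ g m → 2 + r ≡ 4 * g → 0 < g → X ≡ 1 + 2 * m → ⊥
  r≡2-mod-4 g m R≡ g>0 X≡ = cases (residue (2 * Y)) (residue E)
    where
    R = 2 + r
    open FermatModulus R (s≤s z≤n)
    E = 2 * Y + (2 + X)
    P = 2 ^ (2 * Y)
    Q = 2 ^ E
    W = 4 ^ (2 * g)
    2^R≡W : 2 ^ R ≡ W
    2^R≡W = trans (cong (2 ^_) (trans R≡ (lemma g))) (2^-even (2 * g))
      where
      lemma : ∀ g → 4 * g ≡ 2 * (2 * g)
      lemma = solve-∀
    quadrupled : 4 * (4 * b) ^ Y ≡ 3 * P + Q + P * modulus
    quadrupled = begin
      4 * (4 * b) ^ Y                              ≡⟨ cong (4 *_) (^-distribʳ-* Y 4 b) ⟩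
      4 * (4 ^ Y * b ^ Y)                          ≡⟨ cong₂ (λ x z → 4 * (x * z)) (sym (2^-even Y)) eq ⟩
      4 * (P * (1 + u + 2 ^ X))                    ≡⟨ lemma P u (2 ^ X) ⟩
      3 * P + P * (2 * (2 * 2 ^ X)) + P * (1 + 2 * (2 * u)) ≡⟨ cong (λ z → 3 * P + z + P * modulus) (^-distribˡ-+-* 2 (2 * Y) (2 + X)) ⟨
      3 * P + Q + P * modulus                      ∎
      where
      open ≡-Reasoning
      lemma : ∀ p u x → 4 * (p * (1 + u + x)) ≡ 3 * p + p * (2 * (2 * x)) + p * (1 + 2 * (2 * u))
      lemma = solve-∀
    base : 4 * b ≋ 1
    base = trans (cong (_% modulus) (lemma u)) (≋-multiple 1 3)
      where
      lemma : ∀ u → 4 * (1 + 3 * u) ≡ 1 + 3 * (1 + 2 * (2 * u))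
      lemma = solve-∀
    -- The equation times 4^(Y+1), with (4 b)^Y ≡ 1 on the left and 4 · 2ʳ ≡ -1 on the right.
    sum : 3 * P + Q ≋ 4
    sum = begin
      (3 * P + Q) % modulus                  ≡⟨ ≋-multiple (3 * P + Q) P ⟨
      (3 * P + Q + P * modulus) % modulus    ≡⟨ cong (_% modulus) quadrupled ⟨
      4 * (4 * b) ^ Y % modulus              ≡⟨ ≋-*ˡ 4 ((4 * b) ^ Y) (1 ^ Y) (≋-^ Y {4 * b} {1} base) ⟩
      4 * 1 ^ Y % modulus                    ≡⟨ cong (λ z → 4 * z % modulus) (^-zeroˡ Y) ⟩
      4 % modulus                            ∎
      where open ≡-Reasoning
    R+R≡ : ∀ k → k * (R + R) ≡ 8 * (g * k)
    R+R≡ k = trans (cong (λ R → k * (R + R)) R≡) (lemma g k)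
      where
      lemma : ∀ g k → k * (4 * g + 4 * g) ≡ 8 * (g * k)
      lemma = solve-∀
    2Y≡ : 2 * Y ≡ 2 * (3 + 4 * q)
    2Y≡ = cong (2 *_) Y≡
    E≡ : E ≡ 1 + 2 * (Y + 1 + m)
    E≡ = trans (cong (λ X → 2 * Y + (2 + X)) X≡) (lemma Y m)
      where
      lemma : ∀ Y m → 2 * Y + (2 + (1 + 2 * m)) ≡ 1 + 2 * (Y + 1 + m)
      lemma = solve-∀
    plus-shift : ∀ i k → i + k * (R + R) ≡ i + 2 * (4 * (g * k))
    plus-shift i k = cong (i +_) (trans (R+R≡ k) (*-assoc 2 4 (g * k)))
    minus-shift : ∀ i k → R + i + k * (R + R) ≡ i + 2 * (2 * g + 4 * (g * k))
    minus-shift i k = trans (cong₂ (λ R z → R + i + z) R≡ (R+R≡ k)) (lemma g i k)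
      where
      lemma : ∀ g i k → 4 * g + i + 8 * (g * k) ≡ i + 2 * (2 * g + 4 * (g * k))
      lemma = solve-∀
    16≤W : 16 ≤ W
    16≤W = ^-monoʳ-≤ 4 {2} (*-monoʳ-≤ 2 g>0)
    modulus≡ : modulus ≡ 1 + W
    modulus≡ = cong suc 2^R≡W
    bound-i : ∀ i → 2 * i < R → 4 * 4 ^ i ≤ W
    bound-i i i<R = 4^< (halve-< i (2 * g) (subst (2 * i <_) (trans R≡ (*-assoc 2 2 g)) i<R))
    bound-j : ∀ j → 1 + 2 * j < R → 4 * 4 ^ j ≤ W
    bound-j j j<R = 4^< (halve-<′ j (2 * g) (subst (1 + 2 * j <_) (trans R≡ (*-assoc 2 2 g)) j<R))
    below : ∀ {x} → 4 * x ≤ 4 * W → x < modulus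
    below {x} h = s≤s (subst (x ≤_) (sym 2^R≡W) (*-cancelˡ-≤ 4 h))

    -- The reduced exponent of `P` is even and that of `Q` odd, so the two powers are 4ⁱ and 2 · 4ʲ.
    -- Each of 4ⁱ and 4ʲ is at most a quarter of `W`, which keeps all combinations below the modulus
    -- or below its double.
    module Bounds (i j : ℕ) (p≤ : 4 * 4 ^ i ≤ W) (s≤ : 4 * 4 ^ j ≤ W) where
      p s : ℕ
      p = 4 ^ i
      s = 4 ^ j
      open ≤-Reasoning
      3p< : 3 * p < modulus
      3p< = below (begin
        4 * (3 * p)     ≡⟨ lemma p ⟩
        3 * (4 * p)     ≤⟨ *-monoʳ-≤ 3 p≤ ⟩
        3 * W           ≤⟨ m≤n+m (3 * W) W ⟩
        4 * W           ∎)
        where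
        lemma : ∀ p → 4 * (3 * p) ≡ 3 * (4 * p)
        lemma = solve-∀
      2s< : 2 * s < modulus
      2s< = below (begin
        4 * (2 * s)     ≡⟨ lemma s ⟩
        2 * (4 * s)     ≤⟨ *-monoʳ-≤ 2 s≤ ⟩
        2 * W           ≤⟨ *-monoˡ-≤ W {2} {4} (s≤s (s≤s z≤n)) ⟩
        4 * W           ∎)
        where
        lemma : ∀ p → 4 * (2 * p) ≡ 2 * (4 * p)
        lemma = solve-∀
      4+3p< : 4 + 3 * p < modulus
      4+3p< = below (begin
        4 * (4 + 3 * p)     ≡⟨ lemma p ⟩
        16 + 3 * (4 * p)    ≤⟨ +-mono-≤ 16≤W (*-monoʳ-≤ 3 p≤) ⟩
        W + 3 * W           ∎)
        where
        lemma : ∀ p → 4 * (4 + 3 * p) ≡ 16 + 3 * (4 * p)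
        lemma = solve-∀
      4+2s< : 4 + 2 * s < modulus
      4+2s< = below (begin
        4 * (4 + 2 * s)     ≡⟨ lemma s ⟩
        16 + 2 * (4 * s)    ≤⟨ +-mono-≤ 16≤W (*-monoʳ-≤ 2 s≤) ⟩
        W + 2 * W           ≤⟨ +-monoʳ-≤ W (*-monoˡ-≤ W {2} {3} (s≤s (s≤s z≤n))) ⟩
        W + 3 * W           ∎)
        where
        lemma : ∀ p → 4 * (4 + 2 * p) ≡ 16 + 2 * (4 * p)
        lemma = solve-∀
      sum< : 4 + 3 * p + 2 * s < modulus + modulus
      sum< = *-cancelˡ-< 4 _ _ (begin-strict
        4 * (4 + 3 * p + 2 * s)            ≡⟨ lemma p s ⟩
        16 + 3 * (4 * p) + 2 * (4 * s)     ≤⟨ +-mono-≤ (+-mono-≤ 16≤W (*-monoʳ-≤ 3 p≤)) (*-monoʳ-≤ 2 s≤) ⟩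
        W + 3 * W + 2 * W                  ≤⟨ m≤m+n (W + 3 * W + 2 * W) (2 * W) ⟩
        W + 3 * W + 2 * W + 2 * W          <⟨ m<n+m (W + 3 * W + 2 * W + 2 * W) (s≤s (z≤n {7})) ⟩
        8 + (W + 3 * W + 2 * W + 2 * W)    ≡⟨ lemma′ W ⟩
        4 * ((1 + W) + (1 + W))            ≡⟨ cong (λ M → 4 * (M + M)) modulus≡ ⟨
        4 * (modulus + modulus)            ∎)
        where
        lemma : ∀ p s → 4 * (4 + 3 * p + 2 * s) ≡ 16 + 3 * (4 * p) + 2 * (4 * s)
        lemma = solve-∀
        lemma′ : ∀ w → 8 + (w + 3 * w + 2 * w + 2 * w) ≡ 4 * ((1 + w) + (1 + w))
        lemma′ = solve-∀

    quotient≤1 : ∀ c k {x} → x ≡ c + k * modulus → x < modulus + modulus → k ≡ 0 ⊎ k ≡ 1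
    quotient≤1 c 0 _ _ = inj₁ refl
    quotient≤1 c 1 _ _ = inj₂ refl
    quotient≤1 c (suc (suc k)) refl lt = contradiction lt (≤⇒≯ (≤-trans
      (+-monoʳ-≤ modulus (m≤m+n modulus (k * modulus))) (m≤n+m _ c)))

    -- Being below twice the modulus, the sum is 4 or 4 plus the modulus. Modulo 3 all powers of 4
    -- are 1, so the sum is 2, while the two candidates are 1 and 0.
    plus-plus : ∀ i j → 4 * 4 ^ i ≤ W → 4 * 4 ^ j ≤ W → 3 * 4 ^ i + 2 * 4 ^ j ≋ 4 → ⊥
    plus-plus i j p≤ s≤ h = impossible (κ) x≡ (quotient≤1 4 κ x≡ (≤-trans (s≤s (+-monoˡ-≤ (2 * s) (m≤n+m (3 * p) 4))) sum<))
      where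
      open Bounds i j p≤ s≤
      κ = (3 * p + 2 * s) / modulus
      x≡ : 3 * p + 2 * s ≡ 4 + κ * modulus
      x≡ = trans (m≡m%n+[m/n]*n (3 * p + 2 * s) modulus) (cong (_+ κ * modulus)
        (trans h (m<n⇒m%n≡m (≤-trans (s≤s (m≤m+n 4 (2 * s))) 4+2s<))))
      impossible : ∀ κ → 3 * p + 2 * s ≡ 4 + κ * modulus → κ ≡ 0 ⊎ κ ≡ 1 → ⊥
      impossible _ eq (inj₁ refl) = excluded₂ 3 (4 , 0 , 4 , 0) (0 , 3 , 4 , 0) (0 , 2 , 4 , 0) _ 0 i j (sym eq)
      impossible _ eq (inj₂ refl) = excluded₂ 3 (5 , 1 , 4 , 0) (0 , 3 , 4 , 0) (0 , 2 , 4 , 0) _ (2 * g) i j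
        (sym (trans eq (cong (λ M → 4 + M) (trans (+-identityʳ modulus) modulus≡))))

    minus-minus : ∀ i j → 4 * 4 ^ i ≤ W → 4 * 4 ^ j ≤ W → 4 + 3 * 4 ^ i + 2 * 4 ^ j ≋ 0 → ⊥
    minus-minus i j p≤ s≤ h with ≋0⇒∣ h
    ... | divides κ x≡ = impossible κ x≡ (quotient≤1 0 κ x≡ sum<)
      where
      open Bounds i j p≤ s≤
      impossible : ∀ κ → 4 + 3 * p + 2 * s ≡ κ * modulus → κ ≡ 0 ⊎ κ ≡ 1 → ⊥
      impossible _ () (inj₁ refl)
      impossible _ eq (inj₂ refl) = excluded₂ 3 (0 , 1 , 4 , 0) (3 , 3 , 4 , 0) (0 , 2 , 4 , 0) _ (2 * g) i j
        (sym (suc-injective (trans eq (trans (+-identityʳ modulus) modulus≡))))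

    minus-plus : ∀ i j → 4 * 4 ^ i ≤ W → 4 * 4 ^ j ≤ W → 4 + 3 * 4 ^ i ≋ 2 * 4 ^ j → ⊥
    minus-plus i j p≤ s≤ h = excluded 3 (4 , 3 , 4 , 0) (0 , 2 , 4 , 0) _ i j (≋-small _ _ 4+3p< 2s< h)
      where open Bounds i j p≤ s≤

    plus-minus : ∀ i j → 4 * 4 ^ i ≤ W → 4 * 4 ^ j ≤ W → 3 * 4 ^ i ≋ 4 + 2 * 4 ^ j → i ≡ 1
    plus-minus i j p≤ s≤ h = solution i (≋-small _ _ 3p< 4+2s< h)
      where
      open Bounds i j p≤ s≤
      solution : ∀ i → 3 * 4 ^ i ≡ 4 + 2 * 4 ^ j → i ≡ 1
      solution 0 eq = contradiction eq (excluded 2 (3 , 0 , 4 , 0) (4 , 2 , 4 , 0) _ 0 j)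
      solution 1 eq = refl
      solution (suc (suc i)) eq = contradiction eq (excluded 16 (0 , 3 , 4 , 2) (4 , 2 , 4 , 0) _ i j)

    2^-odd : ∀ j → 2 ^ (1 + 2 * j) ≡ 2 * 4 ^ j
    2^-odd j = cong (2 *_) (2^-even j)

    Even Odd : ℕ → Set
    Even i = ∃[ h ] i ≡ 2 * h
    Odd j  = ∃[ h ] j ≡ 1 + 2 * h

    case-plus-plus : ∀ {i j} → Even i → Odd j → i < R → j < R → P ≋ 2 ^ i → Q ≋ 2 ^ j → ⊥
    case-plus-plus (i , refl) (j , refl) i<R j<R p p′ = plus-plus i j (bound-i i i<R) (bound-j j j<R)
      (subst₂ (λ x y → 3 * x + y ≋ 4) (2^-even i) (2^-odd j)
        (trans (≋-+ {3 * 2 ^ (2 * i)} {3 * P} {2 ^ (1 + 2 * j)} {Q} (≋-*ˡ 3 (2 ^ (2 * i)) P (sym p)) (sym p′)) sum))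

    case-plus-minus : ∀ {i j} → Even i → Odd j → i < R → j < R → P ≋ 2 ^ i → Q + 2 ^ j ≋ 0 → i ≡ 2
    case-plus-minus (i , refl) (j , refl) i<R j<R p p′ = cong (2 *_)
      (plus-minus i j (bound-i i i<R) (bound-j j j<R) (subst₂ (λ x y → 3 * x ≋ 4 + y) (2^-even i) (2^-odd j) (begin
        3 * x % modulus                  ≡⟨ ≋-*ˡ 3 x P (sym p) ⟩
        3 * P % modulus                  ≡⟨ cong (_% modulus) (+-identityʳ (3 * P)) ⟨
        (3 * P + 0) % modulus            ≡⟨ ≋-+ {3 * P} {3 * P} {Q + y} {0} refl p′ ⟨
        (3 * P + (Q + y)) % modulus      ≡⟨ cong (_% modulus) (+-assoc (3 * P) Q y) ⟨
        (3 * P + Q + y) % modulus        ≡⟨ ≋-+ {3 * P + Q} {4} {y} {y} sum refl ⟩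
        (4 + y) % modulus                ∎)))
      where
      open ≡-Reasoning
      x = 2 ^ (2 * i)
      y = 2 ^ (1 + 2 * j)

    case-minus-plus : ∀ {i j} → Even i → Odd j → i < R → j < R → P + 2 ^ i ≋ 0 → Q ≋ 2 ^ j → ⊥
    case-minus-plus (i , refl) (j , refl) i<R j<R p p′ = minus-plus i j (bound-i i i<R) (bound-j j j<R)
      (subst₂ (λ x y → 4 + 3 * x ≋ y) (2^-even i) (2^-odd j) (begin
        (4 + 3 * x) % modulus              ≡⟨ ≋-+ {3 * P + Q} {4} {3 * x} {3 * x} sum refl ⟨
        (3 * P + Q + 3 * x) % modulus      ≡⟨ cong (_% modulus) (lemma P Q x) ⟩
        (3 * (P + x) + Q) % modulus        ≡⟨ ≋-+ {3 * (P + x)} {0} {Q} {y} (≋-*ˡ 3 (P + x) 0 p) p′ ⟩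
        y % modulus                        ∎))
      where
      open ≡-Reasoning
      x = 2 ^ (2 * i)
      y = 2 ^ (1 + 2 * j)
      lemma : ∀ P Q x → 3 * P + Q + 3 * x ≡ 3 * (P + x) + Q
      lemma = solve-∀

    case-minus-minus : ∀ {i j} → Even i → Odd j → i < R → j < R → P + 2 ^ i ≋ 0 → Q + 2 ^ j ≋ 0 → ⊥
    case-minus-minus (i , refl) (j , refl) i<R j<R p p′ = minus-minus i j (bound-i i i<R) (bound-j j j<R)
      (subst₂ (λ x y → 4 + 3 * x + y ≋ 0) (2^-even i) (2^-odd j) (begin
        (4 + 3 * x + y) % modulus              ≡⟨ cong (_% modulus) (+-assoc 4 (3 * x) y) ⟩
        (4 + (3 * x + y)) % modulus            ≡⟨ ≋-+ {3 * P + Q} {4} {3 * x + y} {3 * x + y} sum refl ⟨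
        (3 * P + Q + (3 * x + y)) % modulus    ≡⟨ cong (_% modulus) (lemma P Q x y) ⟩
        (3 * (P + x) + (Q + y)) % modulus      ≡⟨ ≋-+ {3 * (P + x)} {0} {Q + y} {0} (≋-*ˡ 3 (P + x) 0 p) p′ ⟩
        0 % modulus                            ∎))
      where
      open ≡-Reasoning
      x = 2 ^ (2 * i)
      y = 2 ^ (1 + 2 * j)
      lemma : ∀ P Q x y → 3 * P + Q + (3 * x + y) ≡ 3 * (P + x) + (Q + y)
      lemma = solve-∀

    i-plus : ∀ i k → 2 * Y ≡ i + k * (R + R) → Even i
    i-plus i k n≡ = even-part i (3 + 4 * q) (4 * (g * k)) (trans (sym 2Y≡) (trans n≡ (plus-shift i k)))
    i-minus : ∀ i k → 2 * Y ≡ R + i + k * (R + R) → Even i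
    i-minus i k n≡ = even-part i (3 + 4 * q) (2 * g + 4 * (g * k)) (trans (sym 2Y≡) (trans n≡ (minus-shift i k)))
    j-plus : ∀ j k → E ≡ j + k * (R + R) → Odd j
    j-plus j k e≡ = odd-part j (Y + 1 + m) (4 * (g * k)) (trans (sym E≡) (trans e≡ (plus-shift j k)))
    j-minus : ∀ j k → E ≡ R + j + k * (R + R) → Odd j
    j-minus j k e≡ = odd-part j (Y + 1 + m) (2 * g + 4 * (g * k)) (trans (sym E≡) (trans e≡ (minus-shift j k)))

    -- Among the sign patterns only 3 · 4 = 4 + 2 · 4 survives, and there the reduced exponent of
    -- `P` is 2. But 2 Y ≡ 6 modulo 8, and the period 2 `R` is a multiple of 8.
    i≢2 : ∀ i k → 2 * Y ≡ i + k * (R + R) → i ≢ 2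
    i≢2 i k n≡ refl = from-no (8 ∣? 4) (remainder-divisible 8 (g * k) q
      (+-cancelˡ-≡ 2 _ _ (trans (cong (2 +_) (sym (R+R≡ k))) (trans (sym n≡) (trans 2Y≡ (lemma q))))))
      where
      lemma : ∀ q → 2 * (3 + 4 * q) ≡ 2 + (8 * q + 4)
      lemma = solve-∀

    cases : Residue (2 * Y) → Residue E → ⊥
    cases (plus i k i<R n≡ p)  (plus j k′ j<R e≡ p′)  = case-plus-plus (i-plus i k n≡) (j-plus j k′ e≡) i<R j<R p p′
    cases (plus i k i<R n≡ p)  (minus j k′ j<R e≡ p′) =
      i≢2 i k n≡ (case-plus-minus (i-plus i k n≡) (j-minus j k′ e≡) i<R j<R p p′)
    cases (minus i k i<R n≡ p) (plus j k′ j<R e≡ p′)  = case-minus-plus (i-minus i k n≡) (j-plus j k′ e≡) i<R j<R p p′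
    cases (minus i k i<R n≡ p) (minus j k′ j<R e≡ p′) = case-minus-minus (i-minus i k n≡) (j-minus j k′ e≡) i<R j<R p p′

  -- Modulo 2ʳ + 1 the base is - 2.
  r≡0-mod-4 : ∀ g m → r ≡ 4 * g → 0 < g → X ≡ 1 + 4 * m → ⊥
  r≡0-mod-4 g m r≡ g>0 X≡ = cases (residue X) (residue E)
    where
    open FermatModulus r (subst (0 <_) (sym r≡) (≤-trans g>0 (m≤n*m g 4)))
    E = (1 + r) * Y
    base : b ≋ 2 ^ (1 + r)
    base = trans (cong (_% modulus) (lemma u)) (≋-multiple (2 * u) 1)
      where
      lemma : ∀ u → 1 + 3 * u ≡ 2 * u + 1 * (1 + u)
      lemma = solve-∀
    -- The summand 1 + 2ʳ is the modulus itself and drops out, so a power of two is congruent to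
    -- another one.
    same : 2 ^ X ≋ 2 ^ E
    same = begin
      2 ^ X % modulus                      ≡⟨ ≋-multiple (2 ^ X) 1 ⟨
      (2 ^ X + 1 * modulus) % modulus      ≡⟨ cong (_% modulus) (lemma (2 ^ X) u) ⟩
      (1 + u + 2 ^ X) % modulus            ≡⟨ cong (_% modulus) eq ⟨
      b ^ Y % modulus                      ≡⟨ ≋-^ Y {b} {2 ^ (1 + r)} base ⟩
      (2 ^ (1 + r)) ^ Y % modulus          ≡⟨ cong (_% modulus) (^-*-assoc 2 (1 + r) Y) ⟩
      2 ^ E % modulus                      ∎
      where
      open ≡-Reasoning
      lemma : ∀ x u → x + 1 * (1 + u) ≡ 1 + u + x
      lemma = solve-∀
    turns≡ : ∀ k → k * (r + r) ≡ 4 * (2 * (g * k))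
    turns≡ k = trans (cong (λ r → k * (r + r)) r≡) (lemma g k)
      where
      lemma : ∀ g k → k * (4 * g + 4 * g) ≡ 4 * (2 * (g * k))
      lemma = solve-∀
    E≡ : E ≡ 3 + 4 * (q + g * Y)
    E≡ = trans (cong (λ r → (1 + r) * Y) r≡) (trans (cong (λ z → z + 4 * g * Y) Y≡) (trans (lemma g q Y) refl))
      where
      lemma : ∀ g q Y → 3 + 4 * q + 4 * g * Y ≡ 3 + 4 * (q + g * Y)
      lemma = solve-∀
    class : ∀ i a c s → c + 4 * a ≡ i + s → 4 ∣ s → ∃[ z ] c + 4 * a ≡ i + 4 * z
    class i a c s h (divides z refl) = z , trans h (cong (i +_) (*-comm z 4))
    4∣plus : ∀ k → 4 ∣ k * (r + r)
    4∣plus k = subst (4 ∣_) (sym (turns≡ k)) (m∣m*n (2 * (g * k)))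
    4∣minus : ∀ k → 4 ∣ r + k * (r + r)
    4∣minus k = ∣m∣n⇒∣m+n (subst (4 ∣_) (sym r≡) (m∣m*n g)) (4∣plus k)
    plus-class : ∀ {n} c a i k → n ≡ c + 4 * a → n ≡ i + k * (r + r) → ∃[ z ] c + 4 * a ≡ i + 4 * z
    plus-class c a i k h n≡ = class i a c _ (trans (sym h) n≡) (4∣plus k)
    minus-class : ∀ {n} c a i k → n ≡ c + 4 * a → n ≡ r + i + k * (r + r) → ∃[ z ] c + 4 * a ≡ i + 4 * z
    minus-class c a i k h n≡ = class i a c _ (trans (sym h) (trans n≡ (lemma r i (k * (r + r))))) (4∣minus k)
      where
      lemma : ∀ r i k → r + i + k ≡ i + (r + k)
      lemma = solve-∀
    a a′ : ℕ
    a  = m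
    a′ = q + g * Y
    different : ∀ {i j} → ∃[ z ] 1 + 4 * a ≡ i + 4 * z → ∃[ z ] 3 + 4 * a′ ≡ j + 4 * z → i ≢ j
    different {i} (z , h) (z′ , h′) refl = from-no (4 ∣? 2)
      (remainder-divisible 4 (z′ + a) (z + a′) (+-cancelˡ-≡ (1 + i) _ _ (begin
        1 + i + 4 * (z′ + a)            ≡⟨ lemma i z′ a ⟩
        (1 + 4 * a) + (i + 4 * z′)      ≡⟨ cong₂ _+_ h (sym h′) ⟩
        (i + 4 * z) + (3 + 4 * a′)      ≡⟨ lemma′ i z a′ ⟩
        1 + i + (4 * (z + a′) + 2)      ∎)))
      where
      open ≡-Reasoning
      lemma : ∀ i z a → 1 + i + 4 * (z + a) ≡ (1 + 4 * a) + (i + 4 * z)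
      lemma = solve-∀
      lemma′ : ∀ i z a → (i + 4 * z) + (3 + 4 * a) ≡ 1 + i + (4 * (z + a) + 2)
      lemma′ = solve-∀
    unequal : ∀ {i j} → i ≢ j → i < r → j < r → 2 ^ i ≋ 2 ^ j → ⊥
    unequal {i} {j} i≢j i<r j<r h = i≢j (^-injectiveʳ 2 ≤-refl (≋-small (2 ^ i) (2 ^ j) (2^<modulus (<⇒≤ i<r)) (2^<modulus (<⇒≤ j<r)) h))
    opposite : ∀ {i j} → i ≢ j → i < r → j < r → 2 ^ i + 2 ^ j ≋ 0 → ⊥
    opposite {i} {j} i≢j i<r j<r h = >⇒∤ {{>-nonZero (≤-trans (1≤^ 2 i (s≤s z≤n)) (m≤m+n (2 ^ i) (2 ^ j)))}}
      (s≤s (*-cancelˡ-≤ 4 (≤-trans (sum-bound i≢j i<r j<r) (*-monoˡ-≤ (2 ^ r) (n≤1+n 3))))) (≋0⇒∣ h)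
    -- Both the half turn r and the full turn 2 r are multiples of 4, so the reduced exponents are 1
    -- and 3 modulo 4. Two different powers of two below 2ʳ are neither congruent nor opposite
    -- modulo 2ʳ + 1.
    cases : Residue X → Residue E → ⊥
    cases (plus i k i<r n≡ p)  (plus j k′ j<r e≡ p′)  = unequal
      (different (plus-class 1 m i k X≡ n≡) (plus-class 3 (q + g * Y) j k′ E≡ e≡)) i<r j<r (trans (sym p) (trans same p′))
    cases (plus i k i<r n≡ p)  (minus j k′ j<r e≡ p′) = opposite
      (different (plus-class 1 m i k X≡ n≡) (minus-class 3 (q + g * Y) j k′ E≡ e≡)) i<r j<r
      (≋-swap (2 ^ E) (2 ^ j) (2 ^ i) p′ (trans (sym same) p))
    cases (minus i k i<r n≡ p) (plus j k′ j<r e≡ p′)  = opposite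
      (different (minus-class 1 m i k X≡ n≡) (plus-class 3 (q + g * Y) j k′ E≡ e≡)) i<r j<r
      (trans (cong (_% modulus) (+-comm (2 ^ i) (2 ^ j))) (≋-swap (2 ^ X) (2 ^ i) (2 ^ j) p (trans same p′)))
    cases (minus i k i<r n≡ p) (minus j k′ j<r e≡ p′) = unequal
      (different (minus-class 1 m i k X≡ n≡) (minus-class 3 (q + g * Y) j k′ E≡ e≡)) i<r j<r
      (≋-opposite {2 ^ i} {2 ^ X} {2 ^ j} (trans (cong (_% modulus) (+-comm (2 ^ i) (2 ^ X))) p)
        (trans (≋-+ {2 ^ j} {2 ^ j} {2 ^ X} {2 ^ E} refl same) (trans (cong (_% modulus) (+-comm (2 ^ j) (2 ^ E))) p′)))

-- The equation says 3 Y ≡ 1 modulo 4, and 3 is its own inverse.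
exponent-class : ∀ Y v w → 3 * (Y + 4 * v) ≡ 1 + 4 * w → ∃[ q ] Y ≡ 3 + 4 * q
exponent-class Y v w eq with halve Y
... | inj₁ (k , refl) = contradiction (divides (3 * (k + 2 * v)) (trans (sym eq) (lemma k v))) (odd⇒∤ {k = 2 * w} (lemma′ w))
  where
  lemma : ∀ k v → 3 * (2 * k + 4 * v) ≡ 3 * (k + 2 * v) * 2
  lemma = solve-∀
  lemma′ : ∀ w → 1 + 4 * w ≡ 1 + 2 * (2 * w)
  lemma′ = solve-∀
... | inj₂ (k , refl) with halve k
...   | inj₁ (q , refl) = contradiction (remainder-divisible 4 w (3 * (q + v)) (suc-injective (trans (sym eq) (lemma q v)))) (from-no (4 ∣? 2))
  where
  lemma : ∀ q v → 3 * (1 + 2 * (2 * q) + 4 * v) ≡ 1 + (4 * (3 * (q + v)) + 2)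
  lemma = solve-∀
...   | inj₂ (q , refl) = q , lemma q
  where
  lemma : ∀ q → 1 + 2 * (1 + 2 * q) ≡ 3 + 4 * q
  lemma = solve-∀

-- Modulo 3 the equation says that 2ˣ is -1.
odd-exponent : ∀ S x → 3 * S ≡ 1 + 4 * 2 ^ x → ∃[ k ] x ≡ 1 + 2 * k
odd-exponent S x eq with halve x
... | inj₂ odd = odd
... | inj₁ (k , refl) = contradiction (remainder-divisible 3 S (rep 4 (suc k)) (begin
  3 * S                       ≡⟨ eq ⟩
  1 + 4 * 2 ^ (2 * k)         ≡⟨ cong (λ z → 1 + 4 * z) (2^-even k) ⟩
  1 + 4 ^ suc k               ≡⟨ cong suc (geometric 3 (suc k)) ⟩
  2 + 3 * rep 4 (suc k)       ≡⟨ +-comm 2 (3 * rep 4 (suc k)) ⟩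
  3 * rep 4 (suc k) + 2       ∎)) (from-no (3 ∣? 2))
  where open ≡-Reasoning

-- Modulo 15 the base is 4, and so is its third power, while 1 + 2ʳ is 2; so 2ˣ is 2.
exponent-mod-4 : ∀ g q k → (1 + 3 * 2 ^ (4 * g)) ^ (3 + 4 * q) ≡ 1 + 2 ^ (4 * g) + 2 ^ (3 + 2 * k + 4 * g) →
  ∃[ m ] 3 + 2 * k + 4 * g ≡ 1 + 4 * m
exponent-mod-4 g q k eq with halve k
... | inj₂ (h , refl) = 1 + h + g , lemma h g
  where
  lemma : ∀ h g → 3 + 2 * (1 + 2 * h) + 4 * g ≡ 1 + 4 * (1 + h + g)
  lemma = solve-∀
... | inj₁ (h , refl) = contradiction ten λ ()
  where
  open Congruence 15
  open ≡-Reasoning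
  one : ∀ n → 2 ^ (4 * n) ≋ 1
  one n = trans (cong (_% 15) (sym (^-*-assoc 2 4 n))) (trans (≋-^ n {16} {1} refl) (cong (_% 15) (^-zeroˡ n)))
  lhs : (1 + 3 * 2 ^ (4 * g)) ^ (3 + 4 * q) ≋ 4
  lhs = begin
    (1 + 3 * 2 ^ (4 * g)) ^ (3 + 4 * q) % 15       ≡⟨ ≋-^ (3 + 4 * q) {1 + 3 * 2 ^ (4 * g)} {4}
                                                        (≋-+ {1} {1} {3 * 2 ^ (4 * g)} {3} refl (≋-*ˡ 3 (2 ^ (4 * g)) 1 (one g))) ⟩
    4 ^ (3 + 4 * q) % 15                           ≡⟨ cong (_% 15) (trans (sym (2^-even (3 + 4 * q))) (cong (2 ^_) (lemma q))) ⟩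
    2 ^ (6 + 4 * (2 * q)) % 15                     ≡⟨ cong (_% 15) (^-distribˡ-+-* 2 6 (4 * (2 * q))) ⟩
    64 * 2 ^ (4 * (2 * q)) % 15                    ≡⟨ ≋-*ˡ 64 (2 ^ (4 * (2 * q))) 1 (one (2 * q)) ⟩
    4                                              ∎
    where
    lemma : ∀ q → 2 * (3 + 4 * q) ≡ 6 + 4 * (2 * q)
    lemma = solve-∀
  ten : 4 ≡ 10
  ten = begin
    4                                              ≡⟨ lhs ⟨
    (1 + 3 * 2 ^ (4 * g)) ^ (3 + 4 * q) % 15       ≡⟨ cong (_% 15) eq ⟩
    (1 + 2 ^ (4 * g) + 2 ^ (3 + 2 * (2 * h) + 4 * g)) % 15 ≡⟨ ≋-+ {1 + 2 ^ (4 * g)} {2} {2 ^ (3 + 2 * (2 * h) + 4 * g)} {8}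
                                                        (≋-+ {1} {1} {2 ^ (4 * g)} {1} refl (one g)) eight ⟩
    10                                             ∎
    where
    lemma : ∀ h g → 3 + 2 * (2 * h) + 4 * g ≡ 3 + 4 * (h + g)
    lemma = solve-∀
    eight : 2 ^ (3 + 2 * (2 * h) + 4 * g) ≋ 8
    eight = trans (cong (_% 15) (trans (cong (2 ^_) (lemma h g)) (^-distribˡ-+-* 2 3 (4 * (h + g)))))
      (≋-*ˡ 8 (2 ^ (4 * (h + g))) 1 (one (h + g)))

-- Dividing b^Y - 1 by 2ʳ gives Y ≡ 3 modulo 4 and x odd. The residue of r modulo 4 then selects
-- a modulus 2ʳ⁺¹ + 1, 2ʳ⁺² + 1 or 2ʳ + 1 for which b is up to sign a power of two.
pillai : ∀ r x Y → (1 + 3 * 2 ^ r) ^ Y ≢ 1 + 2 ^ r + 2 ^ (2 + r + x)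
pillai 0 x Y eq = excluded 4 (0 , 1 , 4 , 0) (2 , 1 , 2 , 2) _ Y x eq
pillai 1 x Y eq = excluded 8 (0 , 1 , 7 , 0) (3 , 1 , 2 , 3) _ Y x eq
pillai r@(suc (suc r′)) x Y eq = conclude (exponent-class Y v (2 ^ x) 3Y≡) (odd-exponent S x 3S≡)
  where
  u = 2 ^ r
  S = rep (1 + 3 * u) Y
  t = proj₁ (rep-mod (3 * u) Y)
  -- Since r ≥ 2, the modulus 3 · 2ʳ of `rep-mod` is a multiple of 4, so S = Y + 4 v.
  v = 3 * 2 ^ r′ * t
  -- Here the size of the last exponent enters: the true solution with exponent r + 1 would leave 1
  -- + 2 instead of 1 + 4 · 2ˣ.
  3S≡ : 3 * S ≡ 1 + 4 * 2 ^ x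
  3S≡ = *-cancelˡ-≡ (3 * S) (1 + 4 * 2 ^ x) u {{m^n≢0 2 r}} (begin
    u * (3 * S)                     ≡⟨ lemma u S ⟩
    3 * u * S                       ≡⟨ suc-injective (trans (sym (geometric (3 * u) Y)) eq) ⟩
    u + 2 ^ (2 + r + x)             ≡⟨ cong (λ z → u + 2 * (2 * z)) (^-distribˡ-+-* 2 r x) ⟩
    u + 2 * (2 * (u * 2 ^ x))       ≡⟨ lemma′ u (2 ^ x) ⟩
    u * (1 + 4 * 2 ^ x)             ∎)
    where
    open ≡-Reasoning
    lemma : ∀ u s → u * (3 * s) ≡ 3 * u * s
    lemma = solve-∀
    lemma′ : ∀ u x → u + 2 * (2 * (u * x)) ≡ u * (1 + 4 * x)
    lemma′ = solve-∀
  3Y≡ : 3 * (Y + 4 * v) ≡ 1 + 4 * 2 ^ x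
  3Y≡ = trans (cong (λ z → 3 * (Y + z)) (lemma (2 ^ r′) t)) (trans (cong (3 *_) (sym (proj₂ (rep-mod (3 * u) Y)))) 3S≡)
    where
    lemma : ∀ w t → 4 * (3 * w * t) ≡ 3 * (2 * (2 * w)) * t
    lemma = solve-∀
  conclude : ∃[ q ] Y ≡ 3 + 4 * q → ∃[ k ] x ≡ 1 + 2 * k → ⊥
  conclude (q , Y≡) (k , x≡) = by-parity (halve r)
    where
    X = 2 + r + x
    by-parity : (∃[ h ] r ≡ 2 * h) ⊎ (∃[ h ] r ≡ 1 + 2 * h) → ⊥
    by-parity (inj₂ (zero , ()))
    by-parity (inj₂ (suc h , r≡)) = Pillai.r-odd r X Y q Y≡ eq (2 + h) (3 + h + k)
      (trans (cong suc r≡) (lemma h)) (s≤s (s≤s z≤n)) (trans (cong₂ (λ r x → 2 + r + x) r≡ x≡) (lemma′ h k))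
      where
      lemma : ∀ h → 2 + 2 * suc h ≡ 2 * (2 + h)
      lemma = solve-∀
      lemma′ : ∀ h k → 2 + (1 + 2 * suc h) + (1 + 2 * k) ≡ 2 * (3 + h + k)
      lemma′ = solve-∀
    by-parity (inj₁ (h , r≡)) with halve h
    ... | inj₂ (g , h≡) = Pillai-even.r≡2-mod-4 r X Y q Y≡ eq (1 + g) (1 + h + k)
        (trans (cong (2 +_) r≡) (trans (cong (λ h → 2 + 2 * h) h≡) (lemma g))) (s≤s z≤n)
        (trans (cong₂ (λ r x → 2 + r + x) r≡ x≡) (lemma′ h k))
      where
      lemma : ∀ g → 2 + 2 * (1 + 2 * g) ≡ 4 * (1 + g)
      lemma = solve-∀
      lemma′ : ∀ h k → 2 + 2 * h + (1 + 2 * k) ≡ 1 + 2 * (1 + h + k)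
      lemma′ = solve-∀
    ... | inj₁ (g , h≡) = Pillai-even.r≡0-mod-4 r X Y q Y≡ eq g (proj₁ m) r≡4g
        (n≢0⇒n>0 λ { refl → contradiction r≡4g λ () }) (trans X≡ (proj₂ m))
      where
      r≡4g : r ≡ 4 * g
      r≡4g = trans r≡ (trans (cong (2 *_) h≡) (sym (*-assoc 2 2 g)))
      X≡ : X ≡ 3 + 2 * k + 4 * g
      X≡ = trans (cong₂ (λ r x → 2 + r + x) r≡4g x≡) (lemma k g)
        where
        lemma : ∀ k g → 2 + 4 * g + (1 + 2 * k) ≡ 3 + 2 * k + 4 * g
        lemma = solve-∀
      m = exponent-mod-4 g q k (subst₂ (λ r X → (1 + 3 * 2 ^ r) ^ (3 + 4 * q) ≡ 1 + 2 ^ r + 2 ^ X) r≡4g X≡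
        (subst (λ Y → (1 + 3 * 2 ^ r) ^ Y ≡ 1 + 2 ^ r + 2 ^ X) Y≡ eq))

-- The remaining configurations

Conclusion : ℕ → ℕ → ℕ → ℕ → Set
Conclusion a b N D = Family1 a b N D ⊎ Family2 a b N D ⊎ Sporadic a b N D

pattern family-1 j p = inj₁ (j , p)
pattern family-2 j p = inj₂ (inj₁ (j , p))
pattern 2-3-5-2   p = inj₂ (inj₂ (inj₁ p))
pattern 2-3-7-6   p = inj₂ (inj₂ (inj₂ (inj₁ p)))
pattern 2-3-9-8   p = inj₂ (inj₂ (inj₂ (inj₂ (inj₁ p))))
pattern 2-3-17-24 p = inj₂ (inj₂ (inj₂ (inj₂ (inj₂ (inj₁ p)))))
pattern 2-3-41-24 p = inj₂ (inj₂ (inj₂ (inj₂ (inj₂ (inj₂ (inj₁ p))))))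
pattern 2-5-5-8   p = inj₂ (inj₂ (inj₂ (inj₂ (inj₂ (inj₂ (inj₂ (inj₁ p)))))))
pattern 2-9-17-24 p = inj₂ (inj₂ (inj₂ (inj₂ (inj₂ (inj₂ (inj₂ (inj₂ (inj₁ p))))))))
pattern 2-9-41-24 p = inj₂ (inj₂ (inj₂ (inj₂ (inj₂ (inj₂ (inj₂ (inj₂ (inj₂ (inj₁ p)))))))))
pattern 3-4-7-6   p = inj₂ (inj₂ (inj₂ (inj₂ (inj₂ (inj₂ (inj₂ (inj₂ (inj₂ (inj₂ p)))))))))

difference-2^ : ∀ {b v y r} → 3 ≤ b → b ^ v ≡ b ^ y + 2 ^ r → y ≡ 0
difference-2^ {b} {v} {y} {r} b≥3 eq = least-exponent prime-2 (s≤s z≤n) b≥3 v y r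
  (trans eq (cong (b ^ y +_) (sym (*-identityˡ (2 ^ r)))))

family-1-conclusion : ∀ {b N D} r → 3 ≤ b → b ≡ 1 + 2 ^ r → N ≡ 1 + 2 ^ r → D ≡ 2 ^ r → Conclusion 2 b N D
family-1-conclusion zero b≥3 refl _ _ = contradiction b≥3 (from-no (3 ≤? 2))
family-1-conclusion (suc j) _ b≡ N≡ D≡ =
  family-1 j (refl , trans b≡ (+-comm 1 (2 ^ suc j)) , trans N≡ (+-comm 1 (2 ^ suc j)) , D≡)

1≤2^ : ∀ n → 1 ≤ 2 ^ n
1≤2^ n = 1≤^ 2 n (s≤s z≤n)

not-a-sum : ∀ b x y → 1 ≤ b → 1 ≢ 2 ^ x + b ^ y
not-a-sum b x y b≥1 eq = contradiction eq (<⇒≢ (+-mono-≤ (1≤2^ x) (1≤^ b y b≥1)))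

exponent-gap : ∀ e r {d} → 2 ^ e ≡ d + 2 ^ r → 0 < d → ∃[ k ] e ≡ r + suc k
exponent-gap e r {d} eq d>0 with k , e≡ ← m≤n⇒∃[o]m+o≡n (^-cancelʳ-< 2 r e (s≤s z≤n) (subst (2 ^ r <_) (sym eq) (m<n+m (2 ^ r) d>0)))
  = k , trans (sym e≡) (sym (+-suc r k))

odd-factor : ∀ k s r → 2 ^ r * (1 + 2 * k) ≡ 2 ^ s → k ≡ 0
odd-factor k s r eq with ∣-prime-power prime-2 s (subst (1 + 2 * k ∣_) eq (n∣m*n (2 ^ r)))
... | zero  , h = *-cancelˡ-≡ k 0 2 (suc-injective h)
... | suc i , h = contradiction (divides (2 ^ i) (trans h (*-comm 2 (2 ^ i)))) (odd⇒∤ {k = k} refl)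

-- If s and r differ, dividing by the smaller of the two powers leaves an odd number above 1, which
-- cannot divide a power of two.
sum-of-two-and-three : ∀ s r w → 2 ^ s + 3 * 2 ^ r ≡ 2 ^ w → s ≡ r
sum-of-two-and-three s r w eq with <-cmp s r
... | tri≈ _ s≡r _ = s≡r
... | tri< s<r _ _ with k , refl ← m≤n⇒∃[o]m+o≡n s<r =
  contradiction (odd-factor (3 * 2 ^ k) w s (trans (sym factor) eq)) (positive-multiple 2 k)
  where
  factor : 2 ^ s + 3 * 2 ^ (suc s + k) ≡ 2 ^ s * (1 + 2 * (3 * 2 ^ k))
  factor = trans (cong (λ z → 2 ^ s + 3 * (2 * z)) (^-distribˡ-+-* 2 s k)) (lemma (2 ^ s) (2 ^ k))
    where
    lemma : ∀ x y → x + 3 * (2 * (x * y)) ≡ x * (1 + 2 * (3 * y))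
    lemma = solve-∀
... | tri> _ _ r<s with k , refl ← m≤n⇒∃[o]m+o≡n r<s =
  contradiction (odd-factor (1 + 2 ^ k) w r (trans (sym factor) eq)) λ ()
  where
  factor : 2 ^ (suc r + k) + 3 * 2 ^ r ≡ 2 ^ r * (1 + 2 * (1 + 2 ^ k))
  factor = trans (cong (λ z → 2 * z + 3 * 2 ^ r) (^-distribˡ-+-* 2 r k)) (lemma (2 ^ r) (2 ^ k))
    where
    lemma : ∀ x y → 2 * (x * y) + 3 * x ≡ x * (1 + 2 * (1 + y))
    lemma = solve-∀

-- The second equation forces y₁ = 0, and then 1 would be a sum of two positive numbers.
no-chain-2^ : ∀ {b x₀ y₀ y₁ y₃} x → 3 ≤ b → b ^ y₁ ≡ 2 ^ x₀ + b ^ y₀ → b ^ y₃ ≡ b ^ y₁ + 2 ^ x → ⊥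
no-chain-2^ {b} {x₀} {y₀} {y₁} {y₃} x b≥3 e₁ e₂ with refl ← difference-2^ {b} {y₃} {y₁} {x} b≥3 e₂ =
  not-a-sum b x₀ y₀ (≤-trans (s≤s z≤n) b≥3) e₁

-- Apart from 9 = 1 + 8, which is refuted modulo 16, the first equation gives b = 1 + 2ʳ. Then b^Y -
-- 1 is a multiple of 2ʳ, and the second equation divided by 2ʳ equates an even number with an odd
-- one.
base-2-case₇ : ∀ {b D} x₁ x₂ y₁ y₂ y₄ → 3 ≤ b → 0 < D → b ^ y₂ ≡ b ^ y₄ + 2 ^ x₁ →
  2 * b ^ y₁ ≡ 2 * b ^ y₄ + (2 ^ x₂ + 2 ^ x₁) → 2 ^ x₂ ≡ 2 * D + 2 ^ x₁ → ⊥
base-2-case₇ {b} {D} r e Y v y b≥3 D>0 e₁ e₂ e₃ with refl ← difference-2^ {b} {v} {y} {r} b≥3 e₁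
  with exponent-gap e r e₃ (*-mono-≤ {1} {2} (s≤s z≤n) D>0)
... | k , refl with power-minus-power-of-2 b v r b≥3 e₁
... | inj₂ (refl , refl , refl) = excluded 16 (0 , 2 , 3 , 0) (10 , 1 , 2 , 4) _ Y k (trans e₂ (lemma (2 ^ k)))
  where
  lemma : ∀ x → 2 + (2 * (2 * (2 * (2 * x))) + 8) ≡ 10 + 2 * (2 * (2 * (2 * x)))
  lemma = solve-∀
... | inj₁ refl = odd⇒∤ {k = 2 ^ k} refl (subst (2 ∣_) (*-cancelˡ-≡ _ _ (2 ^ r) {{m^n≢0 2 r}} (begin
    2 ^ r * (2 * S)                        ≡⟨ lemma (2 ^ r) S ⟩
    2 * (2 ^ r * S)                        ≡⟨ +-cancelˡ-≡ 2 _ _ (trans (lemma″ (2 ^ r * S)) (trans (cong (2 *_) (sym power)) e₂)) ⟩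
    2 ^ (r + suc k) + 2 ^ r                ≡⟨ cong (_+ 2 ^ r) (^-distribˡ-+-* 2 r (suc k)) ⟩
    2 ^ r * (2 * 2 ^ k) + 2 ^ r            ≡⟨ lemma′ (2 ^ r) (2 ^ k) ⟩
    2 ^ r * (1 + 2 * 2 ^ k)                ∎)) (m∣m*n S))
  where
  open ≡-Reasoning
  S = rep (1 + 2 ^ r) Y
  power : b ^ Y ≡ 1 + 2 ^ r * S
  power = trans (cong (_^ Y) (trans (sym (*-identityʳ b)) e₁)) (geometric (2 ^ r) Y)
  lemma : ∀ r s → r * (2 * s) ≡ 2 * (r * s)
  lemma = solve-∀
  lemma′ : ∀ r s → r * (2 * s) + r ≡ r * (1 + 2 * s)
  lemma′ = solve-∀
  lemma″ : ∀ s → 2 + 2 * s ≡ 2 * (1 + s)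
  lemma″ = solve-∀

power-of-nine : ∀ b n → 3 ≤ b → b ^ n ≡ 9 → b ≡ 9 ⊎ b ≡ 3
power-of-nine b 0 b≥3 ()
power-of-nine b 1 b≥3 eq = inj₁ (trans (sym (*-identityʳ b)) eq)
power-of-nine b 2 b≥3 eq with b ≤? 3
... | yes b≤3 = inj₂ (≤-antisym b≤3 b≥3)
... | no b≰3  = contradiction eq (>⇒≢ (≤-trans (from-yes (10 ≤? 16))
  (subst (16 ≤_) (cong (b *_) (sym (*-identityʳ b))) (*-mono-≤ (≰⇒> b≰3) (≰⇒> b≰3)))))
power-of-nine b (suc (suc (suc n))) b≥3 eq = contradiction eq (>⇒≢ (≤-trans (from-yes (10 ≤? 27))
  (*-mono-≤ {3} b≥3 (*-mono-≤ {3} b≥3 (≤-trans b≥3 (base≤^ b n (≤-trans (s≤s z≤n) b≥3)))))))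

power-of-three : ∀ b n → 3 ≤ b → b ^ n ≡ 3 → b ≡ 3
power-of-three b (suc w) b≥3 eq = proj₂ (root-unique b w 3 b≥3 (from-yes (3 <? 9)) eq)

-- With g = 2ʳ, the number 1 + g = b^y₀ divides b^y₂ = 1 + 10 g = 10 (1 + g) - 9, so it divides 9.
-- The value g = 2 would make 21 a power of 3, and g = 8 gives b = 9 or b = 3 with N = 32 + 9.
base-2-case₈ : ∀ {b N D} x₀ x₂ y₀ y₁ y₂ → 3 ≤ b → N ≡ 2 ^ x₀ + b ^ y₀ → D ≡ 3 * 2 ^ x₂ → 2 ^ x₀ ≡ 4 * 2 ^ x₂ →
  b ^ y₀ ≡ b ^ y₁ + 2 ^ x₂ → b ^ y₂ ≡ b ^ y₁ + 10 * 2 ^ x₂ → Conclusion 2 b N D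
base-2-case₈ {b} {N} {D} x₀ r y₀ y₁ y₂ b≥3 N≡ D≡ a≡ e₁ e₂ with refl ← difference-2^ {b} {y₀} {y₁} {r} b≥3 e₁ =
  cases r N≡′ D≡ e₁ e₂ 1+g∣9
  where
  N≡′ : N ≡ 4 * 2 ^ r + b ^ y₀
  N≡′ = trans N≡ (cong (_+ b ^ y₀) a≡)
  y₀≤y₂ : y₀ ≤ y₂
  y₀≤y₂ with y₀ ≤? y₂
  ... | yes h = h
  ... | no h  = contradiction (^-monoʳ-≤ b {{>-nonZero (≤-trans (s≤s z≤n) b≥3)}} (<⇒≤ (≰⇒> h)))
    (<⇒≱ (subst₂ _<_ (sym e₁) (sym e₂) (s≤s (subst (_< 10 * 2 ^ r) (*-identityˡ (2 ^ r))
        (*-monoˡ-< (2 ^ r) {{m^n≢0 2 r}} (from-yes (1 <? 10)))))))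
  1+g∣9 : 1 + 2 ^ r ∣ 9
  1+g∣9 with k , refl ← m≤n⇒∃[o]m+o≡n y₀≤y₂ = ∣m+n∣m⇒∣n
    (subst (1 + 2 ^ r ∣_) (lemma (2 ^ r)) (n∣m*n 10))
    (subst₂ _∣_ e₁ e₂ (subst (b ^ y₀ ∣_) (sym (^-distribˡ-+-* b y₀ k)) (m∣m*n (b ^ k))))
    where
    lemma : ∀ g → 10 * (1 + g) ≡ 1 + 10 * g + 9
    lemma = solve-∀
  cases : ∀ r → N ≡ 4 * 2 ^ r + b ^ y₀ → D ≡ 3 * 2 ^ r → b ^ y₀ ≡ 1 + 2 ^ r → b ^ y₂ ≡ 1 + 10 * 2 ^ r →
    1 + 2 ^ r ∣ 9 → Conclusion 2 b N D
  cases 0 _ _ _ _ h = contradiction h (from-no (2 ∣? 9))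
  cases 2 _ _ _ _ h = contradiction h (from-no (5 ∣? 9))
  cases (suc (suc (suc (suc r)))) _ _ _ _ h = contradiction (∣⇒≤ h) (<⇒≱ (s≤s (≤-trans (from-yes (9 ≤? 16))
    (≤-trans (*-monoʳ-≤ 16 (1≤2^ r)) (≤-reflexive (lemma (2 ^ r)))))))
    where
    lemma : ∀ x → 16 * x ≡ 2 * (2 * (2 * (2 * x)))
    lemma = solve-∀
  cases 1 _ _ p q _ with refl ← power-of-three b y₀ b≥3 p =
    contradiction (sym q) (excluded 8 (21 , 0 , 3 , 0) (0 , 1 , 3 , 0) _ 0 y₂)
  cases 3 n≡ d≡ p _ _ with power-of-nine b y₀ b≥3 p
  ... | inj₁ refl = 2-9-41-24 (refl , refl , trans n≡ (cong (32 +_) p) , d≡)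
  ... | inj₂ refl = 2-3-41-24 (refl , refl , trans n≡ (cong (32 +_) p) , d≡)

-- The solution is 81 + 15 = 3 · 32. It is the source of D = 32 - 8 = 24.
3^+15≡3*2^ : ∀ n e → 3 ^ n + 15 ≡ 3 * 2 ^ (4 + e) → e ≡ 1
3^+15≡3*2^ zero e eq = contradiction eq (excluded 3 (16 , 0 , 2 , 0) (0 , 3 , 2 , 4) _ 0 e)
3^+15≡3*2^ (suc n) e eq = 5+3^≡2^ n e (*-cancelˡ-≡ (5 + 3 ^ n) _ 3 (trans (lemma (3 ^ n)) eq))
  where
  lemma : ∀ x → 3 * (5 + x) ≡ 3 * x + 15
  lemma = solve-∀

module _ {b D : ℕ} (r Y : ℕ) (b≥3 : 3 ≤ b) (D>0 : 0 < D) (power : b ^ Y ≡ 1 + 2 ^ r + 3 * D) where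

  power-equation : ∀ e → 2 ^ e ≡ D + 2 ^ r → b ^ Y + 2 * 2 ^ r ≡ 1 + 3 * 2 ^ e
  power-equation e e≡ = trans (cong (_+ 2 * 2 ^ r) power) (trans (lemma (2 ^ r) D) (cong (λ z → 1 + 3 * z) (sym e≡)))
    where
    lemma : ∀ q D → 1 + q + 3 * D + 2 * q ≡ 1 + 3 * (D + q)
    lemma = solve-∀

  difference-24 : ∀ n e → r ≡ 3 → b ^ Y ≡ 3 ^ n → 2 ^ e ≡ D + 2 ^ r → D ≡ 24
  difference-24 n e r≡3 b≡ e≡ = finish (exponent-gap e r e≡ D>0)
    where
    finish : ∃[ k ] e ≡ r + suc k → D ≡ 24
    finish (k , e≡r+) = +-cancelʳ-≡ 8 D 24 (begin
      D + 8              ≡⟨ cong (λ r → D + 2 ^ r) r≡3 ⟨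
      D + 2 ^ r          ≡⟨ e≡ ⟨
      2 ^ e              ≡⟨ cong (2 ^_) e≡4+k ⟩
      2 ^ (4 + k)        ≡⟨ cong (λ k → 2 ^ (4 + k)) (3^+15≡3*2^ n k equation) ⟩
      32                 ∎)
      where
      open ≡-Reasoning
      e≡4+k : e ≡ 4 + k
      e≡4+k = trans e≡r+ (cong (_+ suc k) r≡3)
      equation : 3 ^ n + 15 ≡ 3 * 2 ^ (4 + k)
      equation = suc-injective (begin
        suc (3 ^ n + 15)      ≡⟨ +-suc (3 ^ n) 15 ⟨
        3 ^ n + 16            ≡⟨ cong₂ (λ x r → x + 2 * 2 ^ r) b≡ r≡3 ⟨
        b ^ Y + 2 * 2 ^ r     ≡⟨ power-equation e e≡ ⟩
        1 + 3 * 2 ^ e         ≡⟨ cong (λ e → 1 + 3 * 2 ^ e) e≡4+k ⟩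
        1 + 3 * 2 ^ (4 + k)   ∎)

  -- The base divides b^Y = 1 + 4 · 2ʳ = 4 b - 3, so it divides 3.
  exponent-1 : b ≡ 1 + 2 ^ r → D ≡ 2 ^ r → r ≡ 1
  exponent-1 b≡ D≡ = small r b≡ 1+q∣3
    where
    b∣ : ∀ Y → b ^ Y ≡ 1 + 2 ^ r + 3 * 2 ^ r → b ∣ 1 + 2 ^ r + 3 * 2 ^ r
    b∣ zero    h = contradiction (suc-injective h) (<⇒≢ (≤-trans (1≤2^ r) (m≤m+n (2 ^ r) (3 * 2 ^ r))))
    b∣ (suc Y) h = subst (b ∣_) h (m∣m*n (b ^ Y))
    1+q∣3 : 1 + 2 ^ r ∣ 3
    1+q∣3 = ∣m+n∣m⇒∣n (subst (1 + 2 ^ r ∣_) (lemma (2 ^ r)) (n∣m*n 4))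
      (subst (_∣ 1 + 2 ^ r + 3 * 2 ^ r) b≡ (b∣ Y (trans power (cong (λ D → 1 + 2 ^ r + 3 * D) D≡))))
      where
      lemma : ∀ q → 4 * (1 + q) ≡ 1 + q + 3 * q + 3
      lemma = solve-∀
    small : ∀ r → b ≡ 1 + 2 ^ r → 1 + 2 ^ r ∣ 3 → r ≡ 1
    small 0 refl _ = contradiction b≥3 (from-no (3 ≤? 2))
    small 1 _ _ = refl
    small (suc (suc r)) _ h = contradiction (∣⇒≤ h) (<⇒≱ (s≤s (≤-trans (n≤1+n 3)
      (*-monoʳ-≤ 2 {2} {2 * 2 ^ r} (*-monoʳ-≤ 2 {1} {2 ^ r} (1≤2^ r))))))

  -- The exponent Y is even, so b + 1 divides (bʸ - 1)/(b - 1), which makes 3 a power of two modulo 2ʳ⁻¹ + 1.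
  exponent-3 : ∀ k → b ≡ 1 + 2 ^ r → 2 ^ (r + (2 + k)) ≡ D + 2 ^ r → r ≡ 3
  exponent-3 k b≡ e≡ = half r refl
    where
    q = 2 ^ r
    w = 2 ^ k
    S = rep (1 + q) Y
    S+2≡ : S + 2 ≡ 12 * w
    S+2≡ = *-cancelˡ-≡ _ _ q {{m^n≢0 2 r}} (suc-injective (begin
      1 + q * (S + 2)              ≡⟨ lemma q S ⟩
      1 + q * S + 2 * q            ≡⟨ cong (_+ 2 * q) (trans (sym (geometric q Y)) (cong (_^ Y) (sym b≡))) ⟩
      b ^ Y + 2 * q                ≡⟨ power-equation (r + (2 + k)) e≡ ⟩
      1 + 3 * 2 ^ (r + (2 + k))    ≡⟨ cong (λ z → 1 + 3 * z) (^-distribˡ-+-* 2 r (2 + k)) ⟩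
      1 + 3 * (q * (2 * (2 * w)))  ≡⟨ lemma′ q w ⟩
      1 + q * (12 * w)             ∎))
      where
      open ≡-Reasoning
      lemma : ∀ q S → 1 + q * (S + 2) ≡ 1 + q * S + 2 * q
      lemma = solve-∀
      lemma′ : ∀ q w → 1 + 3 * (q * (2 * (2 * w))) ≡ 1 + q * (12 * w)
      lemma′ = solve-∀
    2∣S : 2 ∣ S
    2∣S = ∣m+n∣m⇒∣n (subst (2 ∣_) (trans (sym S+2≡) (+-comm S 2)) (∣m⇒∣m*n w (divides 6 refl))) ∣-refl
    half : ∀ r′ → r ≡ r′ → r ≡ 3
    half zero refl = contradiction b≥3 (subst (λ b → ¬ 3 ≤ b) (sym b≡) (from-no (3 ≤? 2)))
    half (suc s) r≡ with halve Y
    ... | inj₂ (z , Y≡) = contradiction 2∣S (rep-odd q Y (subst (λ r → 2 ∣ 2 ^ r) (sym r≡) (m∣m*n (2 ^ s))) (odd⇒∤ {k = z} Y≡))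
    ... | inj₁ (Z , Y≡) = cong-suc (exceptional s refl)
      where
      h = 2 ^ s
      S′ = rep (1 + q * (q + 2)) Z
      S≡ : S ≡ (q + 2) * S′
      S≡ = *-cancelˡ-≡ S _ q {{m^n≢0 2 r}} (suc-injective (begin
        1 + q * S                          ≡⟨ geometric q Y ⟨
        (1 + q) ^ Y                        ≡⟨ cong ((1 + q) ^_) Y≡ ⟩
        (1 + q) ^ (2 * Z)                  ≡⟨ ^-*-assoc (1 + q) 2 Z ⟨
        ((1 + q) ^ 2) ^ Z                  ≡⟨ cong (_^ Z) (square q) ⟩
        (1 + q * (q + 2)) ^ Z              ≡⟨ geometric (q * (q + 2)) Z ⟩
        1 + q * (q + 2) * S′               ≡⟨ cong suc (*-assoc q (q + 2) S′) ⟩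
        1 + q * ((q + 2) * S′)             ∎))
        where
        open ≡-Reasoning
        square : ∀ q → (1 + q) * ((1 + q) * 1) ≡ 1 + q * (q + 2)
        square = solve-∀
      S′≡ : 6 * w ≡ 1 + S′ * (1 + h)
      S′≡ = *-cancelˡ-≡ (6 * w) _ 2 (begin
        2 * (6 * w)                        ≡⟨ lemma w ⟩
        12 * w                             ≡⟨ S+2≡ ⟨
        S + 2                              ≡⟨ cong (_+ 2) S≡ ⟩
        (q + 2) * S′ + 2                   ≡⟨ cong (λ r → (2 ^ r + 2) * S′ + 2) r≡ ⟩
        (2 * h + 2) * S′ + 2               ≡⟨ lemma′ h S′ ⟩
        2 * (1 + S′ * (1 + h))             ∎)
        where
        open ≡-Reasoning
        lemma : ∀ w → 2 * (6 * w) ≡ 12 * w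
        lemma = solve-∀
        lemma′ : ∀ h s → (2 * h + 2) * s + 2 ≡ 2 * (1 + s * (1 + h))
        lemma′ = solve-∀
      cong-suc : s ≡ 2 → r ≡ 3
      cong-suc refl = r≡
      -- The modulus is 2ˢ + 1, and `three-is-not-a-power` asks for s ≥ 2. The moduli 2 and 3 fail
      -- directly, since both divide 6 w but not 1 plus a multiple of the modulus.
      exceptional : ∀ t → s ≡ t → s ≡ 2
      exceptional 0 refl = contradiction (subst (2 ∣_) (trans (6*≡ w) S′≡) (m∣m*n (3 * w))) (odd⇒∤ {k = S′} (cong suc (*-comm S′ 2)))
        where
        6*≡ : ∀ w → 2 * (3 * w) ≡ 6 * w
        6*≡ = solve-∀
      exceptional 1 refl = contradiction (remainder-divisible 3 (2 * w) S′ (trans (6*≡ w) (trans S′≡ (swap S′)))) (from-no (3 ∣? 1))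
        where
        6*≡ : ∀ w → 3 * (2 * w) ≡ 6 * w
        6*≡ = solve-∀
        swap : ∀ s → 1 + s * 3 ≡ 3 * s + 1
        swap = solve-∀
      exceptional (suc (suc _)) s≡ = three-is-not-a-power s (1 + k) 0 (subst (2 ≤_) (sym s≡) (s≤s (s≤s z≤n)))
        (trans (cong (_% suc h) (trans (6*≡ w) S′≡)) ([m+kn]%n≡m%n 1 S′ (suc h)))
        where
        6*≡ : ∀ w → 3 * (2 * w) ≡ 6 * w
        6*≡ = solve-∀

-- If 1 + 2ʳ is the square of 3, then D = 24. Otherwise b = 1 + 2ʳ and the gap e - r decides: a gap
-- of 1 means D = 2ʳ and leads to b = 3, a larger one leads to b = 9.
base-2-case₃ : ∀ {b N D} r e y₁ y₂ Y → 3 ≤ b → 0 < D → b ^ y₁ ≡ b ^ y₂ + 2 ^ r → 2 ^ e ≡ D + 2 ^ r →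
  b ^ Y ≡ b ^ y₁ + 3 * D → N ≡ b ^ y₂ + 2 * 2 ^ r → Conclusion 2 b N D
base-2-case₃ {b} {N} {D} r e y₁ y₂ Y b≥3 D>0 e₁ e≡ e₃ N≡ with refl ← difference-2^ {b} {y₁} {y₂} {r} b≥3 e₁
  with power-minus-power-of-2 b y₁ r b≥3 e₁
... | inj₂ (refl , refl , refl) = 2-3-17-24 (refl , refl , N≡ ,
  difference-24 3 Y b≥3 D>0 e₃ Y e refl refl e≡)
... | inj₁ refl with exponent-gap e r e≡ D>0
...   | zero , refl = small (exponent-1 r Y b≥3 D>0 power b≡ D≡)
  where
  b≡ = trans (sym (*-identityʳ b)) e₁
  power = trans e₃ (cong (_+ 3 * D) e₁)
  D≡ : D ≡ 2 ^ r
  D≡ = sym (+-cancelʳ-≡ (2 ^ r) (2 ^ r) D (trans (trans (cong (2 ^ r +_) (sym (+-identityʳ (2 ^ r))))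
    (cong (2 ^_) (sym (+-comm r 1)))) e≡))
  small : r ≡ 1 → Conclusion 2 b N D
  small refl = 2-3-5-2 (refl , b≡ , N≡ , D≡)
...   | suc k , refl = nine (exponent-3 r Y b≥3 D>0 power k b≡ e≡)
  where
  b≡ = trans (sym (*-identityʳ b)) e₁
  power = trans e₃ (cong (_+ 3 * D) e₁)
  nine : r ≡ 3 → Conclusion 2 b N D
  nine r≡@refl = 2-9-17-24 (refl , b≡ , N≡ , difference-24 3 Y b≥3 D>0 power (2 * Y) (3 + (2 + k)) refl
    (trans (cong (_^ Y) b≡) (^-*-assoc 3 2 Y)) e≡)

-- The origin of `pillai`: y₄ = 0 and, apart from 25 and 49, b = 1 + 3 · 2ʳ, while e > r puts the
-- exponent of the largest power of two at r + 2 or more.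
base-2-case₅ : ∀ {b D} r e y₁ y₄ Y → 5 ≤ b → 0 < D → b ^ y₁ ≡ b ^ y₄ + 3 * 2 ^ r → 2 ^ e ≡ D + 2 ^ r →
  b ^ Y ≡ b ^ y₄ + (2 * 2 ^ e + 2 ^ r) → ⊥
base-2-case₅ {b} {D} r e y₁ y₄ Y b≥5 D>0 e₁ e₂ e₃
  with refl ← least-exponent prime-2 (s≤s (z≤n {2})) b≥5 y₁ y₄ r e₁
  with k , refl ← exponent-gap e r e₂ D>0
  with power-minus-3*power-of-2 b y₁ r (≤-trans (s≤s (s≤s (s≤s z≤n))) b≥5) e₁
... | inj₁ refl = pillai r k Y (trans (cong (_^ Y) (trans (sym e₁) (*-identityʳ b))) (trans e₃ (cong suc
  (trans (+-comm (2 * 2 ^ (r + suc k)) (2 ^ r)) (cong (λ x → 2 ^ r + 2 * 2 ^ x) (+-suc r k))))))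
-- Just below the range of k lies the true equation 25 = 9 + 16, and for base 7 it is 49 = 17 + 32.
-- The moduli 544 = 32 · 17 and 5440 = 64 · 5 · 17 contain the first power of two that is in range.
... | inj₂ (inj₁ (refl , refl , refl)) = excluded 544 (0 , 1 , 5 , 0) (9 , 1 , 2 , 5) _ Y k (trans e₃ (lemma (2 ^ k)))
  where
  lemma : ∀ x → 1 + (2 * (2 * (2 * (2 * (2 * x)))) + 8) ≡ 9 + 2 * (2 * (2 * (2 * (2 * x))))
  lemma = solve-∀
... | inj₂ (inj₂ (refl , refl , refl)) = excluded 5440 (0 , 1 , 7 , 0) (17 , 1 , 2 , 6) _ Y k (trans e₃ (lemma (2 ^ k)))
  where
  lemma : ∀ x → 1 + (2 * (2 * (2 * (2 * (2 * (2 * x))))) + 16) ≡ 17 + 2 * (2 * (2 * (2 * (2 * (2 * x)))))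
  lemma = solve-∀

-- The base 3 is too small for `least-exponent` with m = 3, so the power of 3 is split off by hand:
-- 3 · 2ʳ contains 3 exactly once, which forces y₄ = 1. What remains is 3^w = 1 + 2ʳ, with the
-- solutions 3 = 1 + 2 and 9 = 1 + 8.
base-2-case₅-for-3 : ∀ {D} r e y₁ y₄ Y → 0 < D → 3 ^ y₁ ≡ 3 ^ y₄ + 3 * 2 ^ r → 2 ^ e ≡ D + 2 ^ r →
  3 ^ Y ≡ 3 ^ y₄ + (2 * 2 ^ e + 2 ^ r) → ⊥
base-2-case₅-for-3 r e y₁ 0 Y D>0 e₁ e₂ e₃ = impossible y₁ e₁
  where
  impossible : ∀ y → 3 ^ y ≡ 1 + 3 * 2 ^ r → ⊥
  impossible zero    h = positive-multiple 2 r (suc-injective (sym h))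
  impossible (suc y) h = from-no (3 ∣? 1) (remainder-divisible 3 (3 ^ y) (2 ^ r) (trans h (+-comm 1 (3 * 2 ^ r))))
base-2-case₅-for-3 r e y₁ (suc (suc y)) Y D>0 e₁ e₂ e₃ = 3∤2^ r (∣m+n∣m⇒∣n (subst (3 ∣_) power (three y₁ power)) (m∣m*n (3 ^ y)))
  where
  3∤2^ : ∀ r → ¬ 3 ∣ 2 ^ r
  3∤2^ r h = from-no (3 ∣? 2) (prime-∣-^ prime-3 r h)
  power : 3 ^ pred y₁ ≡ 3 * 3 ^ y + 2 ^ r
  power = lower y₁ e₁
    where
    lower : ∀ y₁ → 3 ^ y₁ ≡ 3 * (3 * 3 ^ y) + 3 * 2 ^ r → 3 ^ pred y₁ ≡ 3 * 3 ^ y + 2 ^ r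
    lower zero    h = contradiction h (<⇒≢ (≤-trans (s≤s (s≤s z≤n)) (≤-trans (*-monoʳ-≤ 3 (*-monoʳ-≤ 3 (1≤^ 3 y (s≤s z≤n)))) (m≤m+n _ _))))
    lower (suc w) h = *-cancelˡ-≡ _ _ 3 (trans h (sym (*-distribˡ-+ 3 (3 * 3 ^ y) (2 ^ r))))
  three : ∀ y₁ → 3 ^ pred y₁ ≡ 3 * 3 ^ y + 2 ^ r → 3 ∣ 3 ^ pred y₁
  three (suc (suc w)) _ = m∣m*n (3 ^ w)
  three zero    h = contradiction h (<⇒≢ (+-mono-≤ {1} (≤-trans (1≤^ 3 y (s≤s z≤n)) (m≤n*m (3 ^ y) 3)) (1≤2^ r)))
  three (suc zero) h = contradiction h (<⇒≢ (+-mono-≤ {1} (≤-trans (1≤^ 3 y (s≤s z≤n)) (m≤n*m (3 ^ y) 3)) (1≤2^ r)))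
base-2-case₅-for-3 r e y₁ 1 Y D>0 e₁ e₂ e₃ with k , refl ← exponent-gap e r e₂ D>0 = lower y₁ e₁
  where
  lower : ∀ y₁ → 3 ^ y₁ ≡ 3 + 3 * 2 ^ r → ⊥
  lower zero    ()
  lower (suc w) h with power-minus-power-of-2 3 w r ≤-refl (*-cancelˡ-≡ _ _ 3 (trans h (sym (*-distribˡ-+ 3 1 (2 ^ r)))))
  ... | inj₁ refl with refl ← ^-injectiveʳ {r} {1} 2 ≤-refl (suc-injective (*-cancelˡ-≡ _ _ 3 (trans (sym (trans h (sym (*-distribˡ-+ 3 1 (2 ^ r))))) refl))) =
    excluded 8 (0 , 1 , 3 , 0) (5 , 1 , 2 , 3) _ Y k (trans e₃ (lemma (2 ^ k)))
    where
    lemma : ∀ x → 3 + (2 * (2 * (2 * x)) + 2) ≡ 5 + 2 * (2 * (2 * x))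
    lemma = solve-∀
  ... | inj₂ (_ , _ , refl) = excluded 544 (0 , 1 , 3 , 0) (11 , 1 , 2 , 5) _ Y k (trans e₃ (lemma (2 ^ k)))
    where
    lemma : ∀ x → 3 + (2 * (2 * (2 * (2 * (2 * x)))) + 8) ≡ 11 + 2 * (2 * (2 * (2 * (2 * x))))
    lemma = solve-∀

right-013-case₁ : ∀ {b N D} r y₀ y₂ → 3 ≤ b → b ^ y₂ ≡ b ^ y₀ + 2 ^ r → 2 ^ r ≡ D → N ≡ 2 ^ r + b ^ y₀ → Conclusion 2 b N D
right-013-case₁ {b} r y₀ y₂ b≥3 e D≡ N≡ with refl ← difference-2^ {b} {y₂} {y₀} {r} b≥3 e with power-minus-power-of-2 b y₂ r b≥3 e
... | inj₁ refl = family-1-conclusion r b≥3 (trans (sym (*-identityʳ b)) e) (trans N≡ (+-comm (2 ^ r) 1)) (sym D≡)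
... | inj₂ (refl , refl , refl) = 2-3-9-8 (refl , refl , N≡ , sym D≡)

right-013-case₂ : ∀ {b} r u y₀ y₂ y₄ → 3 ≤ b → b ^ y₄ ≡ b ^ y₂ + 2 * 2 ^ r → b ^ y₀ + 3 * 2 ^ r ≡ 2 ^ u + b ^ y₂ → ⊥
right-013-case₂ {b} r u y₀ y₂ y₄ b≥3 e₁ e₂ with refl ← difference-2^ {b} {y₄} {y₂} {suc r} b≥3 e₁
  with power-minus-power-of-2 b y₄ (suc r) b≥3 e₁
... | inj₂ (refl , refl , refl) = excluded 24 (11 , 1 , 3 , 0) (0 , 1 , 2 , 0) _ y₀ u
  (suc-injective (trans (+-comm 12 (3 ^ y₀)) (trans e₂ (+-comm (2 ^ u) 1))))
... | inj₁ refl = contradiction (odd-factor (1 + S) u r (suc-injective (begin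
    1 + g * (1 + 2 * (1 + S))        ≡⟨ lemma g S ⟩
    1 + 2 * g * S + 3 * g            ≡⟨ cong (_+ 3 * g) (trans (sym (geometric (2 * g) y₀)) (cong (_^ y₀) (sym b≡))) ⟩
    b ^ y₀ + 3 * g                   ≡⟨ trans e₂ (+-comm (2 ^ u) 1) ⟩
    1 + 2 ^ u                        ∎))) λ ()
  where
  open ≡-Reasoning
  g = 2 ^ r
  b≡ : b ≡ 1 + 2 * g
  b≡ = trans (sym (*-identityʳ b)) e₁
  S = rep (1 + 2 * g) y₀
  lemma : ∀ g S → 1 + g * (1 + 2 * (1 + S)) ≡ 1 + 2 * g * S + 3 * g
  lemma = solve-∀

right-013-case₃ : ∀ {b N D} r w y₀ y₂ z → 3 ≤ b → b ^ y₀ ≡ b ^ y₂ + 2 ^ r → b ^ y₀ + 5 * 2 ^ r ≡ 2 ^ w + b ^ z → 2 ^ r ≡ D →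
  N ≡ 2 ^ r + b ^ y₀ → Conclusion 2 b N D
right-013-case₃ {b} {N} {D} r w y₀ y₂ z b≥3 e₁ e₂ D≡ N≡ with refl ← difference-2^ {b} {y₀} {y₂} {r} b≥3 e₁
  with power-minus-power-of-2 b y₀ r b≥3 e₁
... | inj₂ (refl , refl , refl) = ⊥-elim (excluded₂ 56 (49 , 0 , 3 , 0) (0 , 1 , 2 , 0) (0 , 1 , 3 , 0) _ 0 w z e₂)
... | inj₁ refl = cases r z b≡ (trans (cong (_+ 5 * 2 ^ r) (sym e₁)) e₂) D≡ (trans N≡ (cong (2 ^ r +_) e₁))
  where
  b≡ : b ≡ 1 + 2 ^ r
  b≡ = trans (sym (*-identityʳ b)) e₁
  cases : ∀ r z → b ≡ 1 + 2 ^ r → 1 + 2 ^ r + 5 * 2 ^ r ≡ 2 ^ w + b ^ z → 2 ^ r ≡ D → N ≡ 2 ^ r + (1 + 2 ^ r) → Conclusion 2 b N D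
  cases 0 z refl _ _ _ = contradiction b≥3 (from-no (3 ≤? 2))
  cases r 0 _ h _ _ = ⊥-elim (excluded 3 (0 , 6 , 2 , 0) (0 , 1 , 2 , 0) _ r w
    (suc-injective (trans (lemma (2 ^ r)) (trans h (+-comm (2 ^ w) 1)))))
    where
    lemma : ∀ g → 1 + 6 * g ≡ 1 + g + 5 * g
    lemma = solve-∀
  cases r 1 b≡ h _ _ = ⊥-elim (excluded 5 (0 , 5 , 2 , 0) (0 , 1 , 2 , 0) _ r w
    (+-cancelˡ-≡ (1 + 2 ^ r) _ _ (trans h (trans (cong (2 ^ w +_) (trans (*-identityʳ b) b≡)) (+-comm (2 ^ w) (1 + 2 ^ r))))))
  -- This is 13 = 4 + 9, the one place where a square fits.
  cases 1 2 b≡ h D≡ N≡ = 2-3-5-2 (refl , b≡ , N≡ , sym D≡)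
  -- For b = 1 + 4 q the square exceeds the left side 1 + 24 q by 16 q (q - 1), so nothing is left
  -- for 2^w.
  cases (suc (suc r)) 2 b≡ h _ _ = contradiction large (<⇒≢ (≤-trans (1≤2^ w) (≤-trans (m≤m+n (2 ^ w) _) (≤-reflexive refl))))
    where
    q = 2 ^ r
    large : 0 ≡ 2 ^ w + 16 * (q * pred q)
    large = +-cancelˡ-≡ (1 + 24 * q) _ _ (begin
      1 + 24 * q + 0                                   ≡⟨ lemma q ⟩
      1 + 2 * (2 * q) + 5 * (2 * (2 * q))              ≡⟨ trans h (cong (λ b → 2 ^ w + b ^ 2) b≡) ⟩
      2 ^ w + (1 + 2 * (2 * q)) * ((1 + 2 * (2 * q)) * 1) ≡⟨ cong (λ q → 2 ^ w + (1 + 2 * (2 * q)) * ((1 + 2 * (2 * q)) * 1)) (sym (suc-pred q {{m^n≢0 2 r}})) ⟩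
      2 ^ w + (1 + 2 * (2 * suc p)) * ((1 + 2 * (2 * suc p)) * 1) ≡⟨ lemma′ (2 ^ w) p ⟩
      1 + 24 * suc p + (2 ^ w + 16 * (suc p * p))      ≡⟨ cong (λ q → 1 + 24 * q + (2 ^ w + 16 * (q * p))) (suc-pred q {{m^n≢0 2 r}}) ⟩
      1 + 24 * q + (2 ^ w + 16 * (q * p))              ∎)
      where
      open ≡-Reasoning
      p = pred q
      lemma : ∀ q → 1 + 24 * q + 0 ≡ 1 + 2 * (2 * q) + 5 * (2 * (2 * q))
      lemma = solve-∀
      lemma′ : ∀ w p → w + (1 + 2 * (2 * suc p)) * ((1 + 2 * (2 * suc p)) * 1) ≡ 1 + 24 * suc p + (w + 16 * (suc p * p))
      lemma′ = solve-∀
  cases (suc r) (suc (suc (suc z))) b≡ h _ _ = contradiction h (<⇒≢ (begin-strict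
    1 + 2 * q + 5 * (2 * q)                     ≡⟨ lemma q ⟩
    1 + 12 * q                                  ≤⟨ +-monoʳ-≤ 1 (*-monoʳ-≤ 12 (m≤m*n q q {{m^n≢0 2 r}})) ⟩
    1 + 12 * (q * q)                            <⟨ m<m+n (1 + 12 * (q * q)) (≤-trans (1≤2^ r) (m≤n*m q 6)) ⟩
    1 + 12 * (q * q) + 6 * q                    ≤⟨ m≤m+n _ (8 * (q * q * q)) ⟩
    1 + 12 * (q * q) + 6 * q + 8 * (q * q * q)  ≡⟨ lemma′ q ⟩
    (1 + 2 * q) * ((1 + 2 * q) * ((1 + 2 * q) * 1)) ≡⟨ cong (λ b → b * (b * (b * 1))) b≡ ⟨
    b * (b * (b * 1))                           ≤⟨ *-monoʳ-≤ b (*-monoʳ-≤ b (*-monoʳ-≤ b (1≤^ b z (≤-trans (s≤s z≤n) b≥3)))) ⟩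
    b ^ (3 + z)                                 ≤⟨ m≤n+m _ (2 ^ w) ⟩
    2 ^ w + b ^ (3 + z)                         ∎))
    where
    open ≤-Reasoning
    q = 2 ^ r
    lemma : ∀ q → 1 + 2 * q + 5 * (2 * q) ≡ 1 + 12 * q
    lemma = solve-∀
    lemma′ : ∀ q → 1 + 12 * (q * q) + 6 * q + 8 * (q * q * q) ≡ (1 + 2 * q) * ((1 + 2 * q) * ((1 + 2 * q) * 1))
    lemma′ = solve-∀

3-divides-power-of-2 : ∀ w {m} → 3 ∣ m → m ≡ 2 ^ w → ⊥
3-divides-power-of-2 w 3∣m refl = from-no (3 ∣? 2) (prime-∣-^ prime-3 w 3∣m)

-- Apart from 9 = 1 + 8, b = 1 + 2ˢ. For z = 0 the equation is 2ˢ + 3 · 2ʳ = 2^w, which is the first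
-- family. For z ≥ 1 reduce modulo b: 3 · 2ʳ becomes a power of two modulo 2ˢ + 1, so b = 5 once s ≥
-- 2, and b = 3 fails by divisibility by 3.
right-124-case₁ : ∀ {b N D} r s w y₀ y₁ z → 3 ≤ b → 2 ^ r ≡ D → b ^ y₁ ≡ 2 ^ s + b ^ y₀ → b ^ y₁ + 3 * 2 ^ r ≡ 2 ^ w + b ^ z →
  N ≡ 2 ^ s + b ^ y₀ → Conclusion 2 b N D
right-124-case₁ {b} {N} {D} r s w y₀ y₁ z b≥3 D≡ e₁ e₂ N≡
  with refl ← difference-2^ {b} {y₁} {y₀} {s} b≥3 (trans e₁ (+-comm (2 ^ s) (b ^ y₀)))
  with power-minus-power-of-2 b y₁ s b≥3 (trans e₁ (+-comm (2 ^ s) 1))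
... | inj₂ (refl , refl , refl) = exceptional z e₂
  where
  exceptional : ∀ z → 9 + 3 * 2 ^ r ≡ 2 ^ w + 3 ^ z → Conclusion 2 b N D
  exceptional zero h with refl ← sum-of-two-and-three 3 r w (suc-injective (trans h (+-comm (2 ^ w) 1))) =
    2-3-9-8 (refl , refl , N≡ , sym D≡)
  exceptional (suc z) h = ⊥-elim (3-divides-power-of-2 w (∣m+n∣m⇒∣n
    (subst (3 ∣_) (trans h (+-comm (2 ^ w) (3 * 3 ^ z))) (∣m∣n⇒∣m+n (divides 3 refl) (m∣m*n (2 ^ r)))) (m∣m*n (3 ^ z))) refl)
... | inj₁ refl = cases s z b≡ (trans (cong (_+ 3 * 2 ^ r) (sym (*-identityʳ b))) e₂) (trans N≡ (+-comm (2 ^ s) 1))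
  where
  b≡ : b ≡ 1 + 2 ^ s
  b≡ = trans (sym (*-identityʳ b)) (trans e₁ (+-comm (2 ^ s) 1))
  cases : ∀ s z → b ≡ 1 + 2 ^ s → b + 3 * 2 ^ r ≡ 2 ^ w + b ^ z → N ≡ 1 + 2 ^ s → Conclusion 2 b N D
  cases 0 z refl _ _ = contradiction b≥3 (from-no (3 ≤? 2))
  cases s 0 b≡ h N≡ with refl ← sum-of-two-and-three s r w (suc-injective (trans (cong (_+ 3 * 2 ^ r) (sym b≡)) (trans h (+-comm (2 ^ w) 1)))) =
    family-1-conclusion s b≥3 b≡ N≡ (sym D≡)
  cases s 1 b≡ h _ = ⊥-elim (excluded 3 (0 , 3 , 2 , 0) (0 , 1 , 2 , 0) _ r w
    (+-cancelˡ-≡ b _ _ (trans h (trans (cong (2 ^ w +_) (*-identityʳ b)) (+-comm (2 ^ w) b)))))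
  cases 1 (suc z) refl h _ = ⊥-elim (3-divides-power-of-2 w (∣m+n∣m⇒∣n
    (subst (3 ∣_) (trans h (+-comm (2 ^ w) (3 * 3 ^ z))) (∣m∣n⇒∣m+n (divides 1 refl) (m∣m*n (2 ^ r)))) (m∣m*n (3 ^ z))) refl)
  cases s@(suc (suc _)) (suc (suc z)) b≡ h N≡ = five (three-is-not-a-power s r w (s≤s (s≤s z≤n)) congruent)
    where
    M = suc (2 ^ s)
    congruent : 3 * 2 ^ r % M ≡ 2 ^ w % M
    congruent = begin
      3 * 2 ^ r % M                    ≡⟨ [m+kn]%n≡m%n (3 * 2 ^ r) 1 M ⟨
      (3 * 2 ^ r + 1 * M) % M          ≡⟨ cong (_% M) (trans (cong (3 * 2 ^ r +_) (trans (*-identityˡ M) (sym b≡))) (trans (+-comm _ b) h)) ⟩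
      (2 ^ w + b * b ^ suc z) % M      ≡⟨ cong (λ x → (2 ^ w + x) % M) (trans (*-comm b _) (cong (b ^ suc z *_) b≡)) ⟩
      (2 ^ w + b ^ suc z * M) % M      ≡⟨ [m+kn]%n≡m%n (2 ^ w) (b ^ suc z) M ⟩
      2 ^ w % M                        ∎
      where open ≡-Reasoning
    five : s ≡ 2 → Conclusion 2 b N D
    five s≡2 = conclusion (trans b≡ (cong (λ s → 1 + 2 ^ s) s≡2)) (trans N≡ (cong (λ s → 1 + 2 ^ s) s≡2))
      where
      conclusion : b ≡ 5 → N ≡ 5 → Conclusion 2 b N D
      conclusion b≡5 N≡5 = 2-5-5-8 (refl , b≡5 , N≡5 , trans (sym D≡) (cong (2 ^_)
        (5+3*2^≡2^+5^ r w z (subst (λ b → b + 3 * 2 ^ r ≡ 2 ^ w + b ^ (2 + z)) b≡5 h))))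

-- Systems for the bases 2 and 3

1≤3^ : ∀ n → 1 ≤ 3 ^ n
1≤3^ n = 1≤^ 3 n (s≤s z≤n)

twice-3^ : ∀ x y → 2 ^ x ≡ 2 * 3 ^ y → y ≡ 0
twice-3^ x zero    _  = refl
twice-3^ x (suc y) eq = contradiction eq (excluded 3 (0 , 1 , 2 , 0) (0 , 2 , 3 , 1) _ x y)

left-014-case₁ : ∀ {N D} x₀ y₀ → 2 ^ x₀ ≡ 2 * 3 ^ y₀ → D ≡ 2 * 3 ^ y₀ → N ≡ 2 ^ x₀ + 3 ^ y₀ → Conclusion 2 3 N D
left-014-case₁ x₀ y₀ e₁ D≡ N≡ with refl ← twice-3^ x₀ y₀ e₁ =
  family-1-conclusion 1 ≤-refl refl (trans N≡ (cong (_+ 1) e₁)) D≡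

left-014-case₂ : ∀ {N D} x₀ x₂ y₀ → 2 ^ x₂ ≡ 2 ^ x₀ + 4 * 3 ^ y₀ → D ≡ 2 * 3 ^ y₀ → N ≡ 2 ^ x₀ + 3 ^ y₀ → Conclusion 2 3 N D
left-014-case₂ 0 0 y e _ _ = contradiction (suc-injective e) (<⇒≢ (≤-trans (s≤s z≤n) (*-monoʳ-≤ 4 (1≤3^ y))))
left-014-case₂ 0 (suc x) y e _ _ = ⊥-elim (excluded 2 (0 , 1 , 2 , 1) (1 , 4 , 3 , 0) _ x y e)
left-014-case₂ 1 0 y () _ _
left-014-case₂ 1 1 y e _ _ =
  contradiction (suc-injective (suc-injective e)) (<⇒≢ (≤-trans (s≤s z≤n) (*-monoʳ-≤ 4 (1≤3^ y))))
left-014-case₂ 1 (suc (suc x)) y e _ _ = ⊥-elim (excluded 4 (0 , 1 , 2 , 2) (2 , 4 , 3 , 0) _ x y e)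
left-014-case₂ 2 0 y () _ _
left-014-case₂ 2 1 y () _ _
left-014-case₂ {N} {D} 2 (suc (suc x)) y e D≡ N≡ = small (3^+1≡2^ y x
  (*-cancelˡ-≡ _ _ 4 (trans (*-distribˡ-+ 4 1 (3 ^ y)) (trans (sym e) (sym (*-assoc 2 2 (2 ^ x)))))))
  where
  small : (y ≡ 0 × x ≡ 1) ⊎ (y ≡ 1 × x ≡ 2) → Conclusion 2 3 N D
  small (inj₁ (refl , _)) = 2-3-5-2 (refl , refl , N≡ , D≡)
  small (inj₂ (refl , _)) = 2-3-7-6 (refl , refl , N≡ , D≡)
-- Modulo 8 only x₂ = 2 survives, and the modulus 240 = 16 · 3 · 5 disposes of it without an
-- argument on size.
left-014-case₂ (suc (suc (suc x₀))) x₂ y e _ _ =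
  ⊥-elim (excluded₂ 240 (0 , 1 , 2 , 0) (0 , 1 , 2 , 3) (0 , 4 , 3 , 0) _ x₂ x₀ y e)

left-014-case₃ : ∀ x₀ x₂ x₃ y₀ y₂ → 2 ^ x₃ ≡ 2 ^ x₂ + 2 * 3 ^ y₀ → 2 ^ x₀ + 5 * 3 ^ y₀ ≡ 2 ^ x₂ + 3 ^ y₂ → ⊥
left-014-case₃ x₀ 0 0 y y₂ e _ = contradiction (suc-injective e) (<⇒≢ (≤-trans (s≤s z≤n) (*-monoʳ-≤ 2 (1≤3^ y))))
left-014-case₃ x₀ 0 (suc x) y y₂ e _ = excluded 2 (0 , 1 , 2 , 1) (1 , 2 , 3 , 0) _ x y e
left-014-case₃ x₀ (suc (suc x₂)) x₃ y y₂ e _ = excluded₂ 120 (0 , 1 , 2 , 0) (0 , 1 , 2 , 2) (0 , 2 , 3 , 0) _ x₃ x₂ y e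
left-014-case₃ x₀ 1 0 y y₂ () _
left-014-case₃ x₀ 1 (suc x) y y₂ e e′ with 3^+1≡2^ y x (*-cancelˡ-≡ _ _ 2 (trans (*-distribˡ-+ 2 1 (3 ^ y)) (sym e)))
... | inj₁ (refl , _) = excluded 12 (3 , 1 , 2 , 0) (0 , 1 , 3 , 0) _ x₀ y₂
  (suc-injective (suc-injective (trans (+-comm 5 (2 ^ x₀)) e′)))
... | inj₂ (refl , _) = excluded 24 (13 , 1 , 2 , 0) (0 , 1 , 3 , 0) _ x₀ y₂
  (suc-injective (suc-injective (trans (+-comm 15 (2 ^ x₀)) e′)))

two-three-case₂ : ∀ x₀ e f y₀ i → 2 ^ f ≡ 2 ^ e + 3 ^ i → 2 ^ e ≡ 2 ^ x₀ + 3 ^ y₀ → ⊥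
two-three-case₂ x₀ 0 f y₀ i _ h = not-a-sum 3 x₀ y₀ (s≤s z≤n) h
two-three-case₂ x₀ e 0 y₀ i h _ = not-a-sum 3 e i (s≤s z≤n) h
two-three-case₂ x₀ (suc e) (suc f) y₀ i h _ = excluded₂ 2 (0 , 1 , 2 , 1) (0 , 1 , 2 , 1) (0 , 1 , 3 , 0) _ f e i h

sum-of-3^ : ∀ {N D} e i j → 0 < D → 2 ^ e ≡ 3 ^ i + 3 ^ j → 3 ^ j ≡ 3 ^ i + D → N ≡ 5 * 3 ^ i → Conclusion 2 3 N D
sum-of-3^ e i 0 D>0 _ h _ = contradiction h (<⇒≢ (+-mono-≤ (1≤3^ i) D>0))
sum-of-3^ e (suc i) (suc j) D>0 h _ _ = ⊥-elim (excluded₂ 3 (0 , 1 , 2 , 0) (0 , 1 , 3 , 1) (0 , 1 , 3 , 1) _ e i j h)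
sum-of-3^ e 0 (suc j) D>0 h h′ N≡ with 3^+1≡2^ (suc j) e (sym h)
... | inj₂ (refl , _) = 2-3-5-2 (refl , refl , N≡ , sym (suc-injective h′))

no-twice-3^ : ∀ {D} x i j → 0 < D → 2 ^ x ≡ 2 * 3 ^ j → 3 ^ j ≡ 3 ^ i + D → ⊥
no-twice-3^ x i j D>0 h h′ with refl ← twice-3^ x j h = contradiction h′ (<⇒≢ (+-mono-≤ (1≤3^ i) D>0))

two-three-case₁₂ : ∀ {D} x h j → 0 < D → 2 ^ x ≡ 2 * 3 ^ j → 2 * 3 ^ j ≡ 2 ^ h + 2 * D → ⊥
two-three-case₁₂ x h j D>0 e e′ with refl ← twice-3^ x j e = contradiction e′ (<⇒≢ (+-mono-≤ (1≤2^ h) (*-monoʳ-≤ 2 D>0)))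

-- The left side 2 · 3^p contains 2 exactly once, which excludes h = 0 and h ≥ 2. For h = 1 it
-- becomes 3^p = 1 + 2^g, and its two solutions fail in the other equations.
two-three-case₁₁ : ∀ {D} h g p q → 0 < D → 2 * 3 ^ p ≡ 2 ^ h + 2 * 2 ^ g → 2 ^ g ≡ 2 ^ h + D →
  3 ^ q + 3 * 2 ^ g ≡ 2 * 2 ^ h + 3 * 3 ^ p → ⊥
two-three-case₁₁ 0 g p q _ e _ _ = excluded 2 (0 , 2 , 3 , 0) (1 , 2 , 2 , 0) _ p g e
two-three-case₁₁ 1 g p q D>0 e e′ e″ with power-minus-power-of-2 3 p g ≤-refl (*-cancelˡ-≡ _ _ 2 (trans e (sym (*-distribˡ-+ 2 1 (2 ^ g)))))
... | inj₂ (_ , refl , refl) = excluded 8 (24 , 1 , 3 , 0) (31 , 0 , 3 , 0) _ q 0 (trans (+-comm 24 (3 ^ q)) e″)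
... | inj₁ refl = contradiction (trans (sym e′) 2^g≡2) (>⇒≢ (m<m+n 2 D>0))
  where
  2^g≡2 : 2 ^ g ≡ 2
  2^g≡2 = *-cancelˡ-≡ _ _ 2 (+-cancelˡ-≡ 2 _ _ (sym e))
two-three-case₁₁ {D} (suc (suc h)) g p q D>0 e e′ _ with exponent-gap g (2 + h) (trans e′ (+-comm (2 ^ (2 + h)) D)) D>0
... | k , refl = excluded₂ 4 (0 , 2 , 3 , 0) (0 , 1 , 2 , 2) (0 , 2 , 2 , 2) _ p h (h + suc k) e

two-three-case₄ : ∀ {N D} g e p → D ≡ 2 * 3 ^ p → 4 * 2 ^ g ≡ 2 ^ e + 4 * 3 ^ p → N ≡ 2 ^ e + 3 ^ p → Conclusion 2 3 N D
two-three-case₄ g 0 p _ h _ = ⊥-elim (excluded 4 (0 , 4 , 2 , 0) (1 , 4 , 3 , 0) _ g p h)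
two-three-case₄ g 1 p _ h _ = ⊥-elim (excluded 4 (0 , 4 , 2 , 0) (2 , 4 , 3 , 0) _ g p h)
two-three-case₄ {N} {D} g (suc (suc e)) p D≡ h N≡ = cases g e N≡ (*-cancelˡ-≡ _ _ 4 (trans h
  (trans (cong (_+ 4 * 3 ^ p) (sym (*-assoc 2 2 (2 ^ e)))) (sym (*-distribˡ-+ 4 (2 ^ e) (3 ^ p))))))
  where
  cases : ∀ g e → N ≡ 2 ^ (2 + e) + 3 ^ p → 2 ^ g ≡ 2 ^ e + 3 ^ p → Conclusion 2 3 N D
  cases 0 e _ h = contradiction h (not-a-sum 3 e p (s≤s z≤n))
  cases (suc g) (suc e) _ h = ⊥-elim (excluded₂ 2 (0 , 1 , 2 , 1) (0 , 1 , 2 , 1) (0 , 1 , 3 , 0) _ g e p h)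
  cases (suc g) 0 N≡ h with 3^+1≡2^ p (suc g) (sym h)
  ... | inj₁ (refl , _) = 2-3-5-2 (refl , refl , N≡ , D≡)
  ... | inj₂ (refl , _) = 2-3-7-6 (refl , refl , N≡ , D≡)

20≤ : ∀ g p → 20 ≤ 5 * 2 ^ (2 + g) + 2 * 3 ^ p
20≤ g p = ≤-trans (*-monoʳ-≤ 5 (*-monoʳ-≤ 2 (*-monoʳ-≤ 2 (1≤2^ g)))) (m≤m+n (5 * 2 ^ (2 + g)) (2 * 3 ^ p))

-- Since 2 · 3^p contains 2 exactly once, g = 1. Then 5 + 3^p is 3 times a power of two, so p = 0 by
-- divisibility by 3.
two-three-case₆ : ∀ {N D} g e h p q → 0 < D → 5 * 2 ^ g + 2 * 3 ^ p ≡ 3 * 2 ^ e → 3 ^ q + 2 ^ e ≡ 2 ^ h + (2 ^ g + 3 ^ p) →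
  2 ^ h ≡ 2 ^ g + D → N ≡ 2 * 2 ^ g + 3 ^ p → Conclusion 2 3 N D
two-three-case₆ 0 0 h p q _ () _ _ _
two-three-case₆ 0 (suc e) h p q _ eq _ _ _ = ⊥-elim (excluded 2 (5 , 2 , 3 , 0) (0 , 3 , 2 , 1) _ p e eq)
two-three-case₆ 1 0 h p q _ () _ _ _
two-three-case₆ {N} {D} 1 (suc e) h p q D>0 eq eq′ eq″ N≡ = cases p (*-cancelˡ-≡ _ _ 2 (trans (*-distribˡ-+ 2 5 (3 ^ p)) (trans eq (lemma (2 ^ e))))) eq′ N≡
  where
  lemma : ∀ x → 3 * (2 * x) ≡ 2 * (3 * x)
  lemma = solve-∀
  cases : ∀ p → 5 + 3 ^ p ≡ 3 * 2 ^ e → 3 ^ q + 2 * 2 ^ e ≡ 2 ^ h + (2 + 3 ^ p) → N ≡ 4 + 3 ^ p → Conclusion 2 3 N D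
  cases (suc p) h₁ _ _ = ⊥-elim (excluded 3 (5 , 1 , 3 , 1) (0 , 3 , 2 , 0) _ p e h₁)
  cases zero h₁ h₂ N≡ = small (3^+1≡2^ q h (+-cancelʳ-≡ 3 (1 + 3 ^ q) (2 ^ h) (begin
    1 + 3 ^ q + 3         ≡⟨ +-comm (1 + 3 ^ q) 3 ⟩
    4 + 3 ^ q             ≡⟨ +-comm 4 (3 ^ q) ⟩
    3 ^ q + 2 * 2         ≡⟨ cong (λ x → 3 ^ q + 2 * x) (*-cancelˡ-≡ 2 (2 ^ e) 3 h₁) ⟩
    3 ^ q + 2 * 2 ^ e     ≡⟨ h₂ ⟩
    2 ^ h + 3             ∎)))
    where
    open ≡-Reasoning
    small : (q ≡ 0 × h ≡ 1) ⊎ (q ≡ 1 × h ≡ 2) → Conclusion 2 3 N D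
    small (inj₁ (_ , refl)) = contradiction (+-cancelˡ-≡ 2 0 D eq″) (<⇒≢ D>0)
    small (inj₂ (_ , refl)) = 2-3-5-2 (refl , refl , N≡ , sym (+-cancelˡ-≡ 2 2 D eq″))
two-three-case₆ (suc (suc g)) 0 h p q _ eq _ _ _ = contradiction eq (>⇒≢ (≤-trans (from-yes (4 ≤? 20)) (20≤ g p)))
two-three-case₆ (suc (suc g)) 1 h p q _ eq _ _ _ = contradiction eq (>⇒≢ (≤-trans (from-yes (7 ≤? 20)) (20≤ g p)))
two-three-case₆ (suc (suc g)) (suc (suc e)) h p q _ eq _ _ _ =
  ⊥-elim (excluded₂ 4 (0 , 3 , 2 , 2) (0 , 5 , 2 , 2) (0 , 2 , 3 , 0) _ e g p (sym eq))

-- Systems for the base 3 and a larger base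

family-2-conclusion : ∀ {b N D} r y₂ → 4 ≤ b → b ^ y₂ ≡ 1 + 4 * 3 ^ r → D ≡ 2 * 3 ^ r → N ≡ 3 ^ r + 1 → Conclusion 3 b N D
family-2-conclusion {b} r y₂ b≥4 e D≡ N≡
  with refl ← power-minus-multiple-of-power-of-3 b y₂ 4 r b≥4 (divides 2 refl) ∣-refl e =
  family-2 r (refl , trans (sym (*-identityʳ b)) (trans e (+-comm 1 (4 * 3 ^ r))) , N≡ , D≡)

-- `least-exponent` with m = 4 needs b ≥ 6. For b = 5 divisibility by 5 replaces it; for b = 4 there
-- is the exception 16 = 4 + 12, which is the solution with N = 7 and D = 6.
right-014-case₁ : ∀ {b N D} r y₀ y₂ → 4 ≤ b → b ^ y₂ ≡ b ^ y₀ + 4 * 3 ^ r → D ≡ 2 * 3 ^ r → N ≡ 3 ^ r + b ^ y₀ → Conclusion 3 b N D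
right-014-case₁ {b} {N} {D} r y₀ y₂ b≥4 e D≡ N≡ = by-base (5 <? b)
  where
  large : b ^ y₂ ≡ b ^ 0 + 4 * 3 ^ r → N ≡ 3 ^ r + b ^ 0 → Conclusion 3 b N D
  large e N≡ = family-2-conclusion r y₂ b≥4 e D≡ N≡
  five : ∀ y₀ y₂ → 5 ^ y₂ ≡ 5 ^ y₀ + 4 * 3 ^ r → y₀ ≡ 0
  five zero y₂ e = refl
  five (suc y₀) zero e = contradiction e (<⇒≢ (+-mono-≤ {1} (1≤^ 5 (suc y₀) (s≤s z≤n)) (≤-trans (s≤s z≤n) (*-monoʳ-≤ 4 (1≤3^ r)))))
  five (suc y₀) (suc y₂) e = ⊥-elim (excluded₂ 5 (0 , 1 , 5 , 1) (0 , 1 , 5 , 1) (0 , 4 , 3 , 0) _ y₂ y₀ r e)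
  four : ∀ y₀ y₂ → 4 ^ y₂ ≡ 4 ^ y₀ + 4 * 3 ^ r → y₀ ≡ 0 ⊎ (y₀ ≡ 1 × r ≡ 1)
  four zero y₂ e = inj₁ refl
  four (suc zero) zero ()
  four (suc zero) (suc v) e with 3^+1≡2^ r (2 * v) (trans (sym (*-cancelˡ-≡ _ _ 4 (trans e (sym (*-distribˡ-+ 4 1 (3 ^ r)))))) (^-*-assoc 2 2 v))
  ... | inj₁ (_ , h) = contradiction (divides v (trans (sym h) (*-comm 2 v))) (from-no (2 ∣? 1))
  ... | inj₂ (h , _) = inj₂ (refl , h)
  four (suc (suc y₀)) zero e = contradiction e (<⇒≢ (+-mono-≤ {1} (1≤^ 4 (2 + y₀) (s≤s z≤n)) (≤-trans (s≤s z≤n) (*-monoʳ-≤ 4 (1≤3^ r)))))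
  four (suc (suc y₀)) (suc zero) e = contradiction e (<⇒≢ (≤-trans (≤-trans (from-yes (5 ≤? 16)) (*-monoʳ-≤ 4 (*-monoʳ-≤ 4 (1≤^ 4 y₀ (s≤s z≤n))))) (m≤m+n (4 ^ (2 + y₀)) (4 * 3 ^ r))))
  four (suc (suc y₀)) (suc (suc y₂)) e = ⊥-elim (excluded₂ 16 (0 , 1 , 4 , 2) (0 , 1 , 4 , 2) (0 , 4 , 3 , 0) _ y₂ y₀ r e)
  zero-case : y₀ ≡ 0 → Conclusion 3 b N D
  zero-case y₀≡0 = large (trans e (cong (λ y → b ^ y + 4 * 3 ^ r) y₀≡0)) (trans N≡ (cong (λ y → 3 ^ r + b ^ y) y₀≡0))
  small : b ≡ 4 ⊎ b ≡ 5 → Conclusion 3 b N D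
  small (inj₂ b≡5) = zero-case (five y₀ y₂ (subst (λ b → b ^ y₂ ≡ b ^ y₀ + 4 * 3 ^ r) b≡5 e))
  small (inj₁ b≡4) with four y₀ y₂ (subst (λ b → b ^ y₂ ≡ b ^ y₀ + 4 * 3 ^ r) b≡4 e)
  ... | inj₁ y₀≡0 = zero-case y₀≡0
  ... | inj₂ (y₀≡1 , r≡1) = 3-4-7-6 (refl , b≡4 ,
    trans N≡ (trans (cong₂ (λ b y → 3 ^ r + b ^ y) b≡4 y₀≡1) (cong (λ r → 3 ^ r + 4) r≡1)) ,
    trans D≡ (cong (λ r → 2 * 3 ^ r) r≡1))
  four-or-five : ∀ {b} → 4 ≤ b → ¬ 5 < b → b ≡ 4 ⊎ b ≡ 5
  four-or-five {4} _ _ = inj₁ refl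
  four-or-five {5} _ _ = inj₂ refl
  four-or-five {0} () _
  four-or-five {1} (s≤s ()) _
  four-or-five {2} (s≤s (s≤s ())) _
  four-or-five {3} (s≤s (s≤s (s≤s ()))) _
  four-or-five {suc (suc (suc (suc (suc (suc b)))))} _ ¬lt = contradiction (s≤s (s≤s (s≤s (s≤s (s≤s (s≤s z≤n)))))) ¬lt
  by-base : Dec (5 < b) → Conclusion 3 b N D
  by-base (yes b>5) = zero-case (least-exponent prime-3 (s≤s z≤n) b>5 y₂ y₀ r e)
  by-base (no b≯5)  = small (four-or-five b≥4 b≯5)

difference-2*3^ : ∀ {b} y y′ r → 4 ≤ b → b ^ y ≡ b ^ y′ + 2 * 3 ^ r → y′ ≡ 0
difference-2*3^ y y′ r b≥4 e = least-exponent prime-3 (s≤s z≤n) b≥4 y y′ r e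

right-014-case₂ : ∀ {b} r u y₀ y₂ y₃ → 4 ≤ b → b ^ y₃ ≡ b ^ y₂ + 2 * 3 ^ r → b ^ y₀ + 5 * 3 ^ r ≡ 3 ^ u + b ^ y₂ → ⊥
right-014-case₂ {b} r u y₀ y₂ y₃ b≥4 e e′ with refl ← difference-2*3^ {b} y₃ y₂ r b≥4 e
  with refl ← power-minus-multiple-of-power-of-3 b y₃ 2 r b≥4 ∣-refl (divides 2 refl) e = cases r (trans (sym (*-identityʳ b)) e) e′
  where
  cases : ∀ r → b ≡ 1 + 2 * 3 ^ r → b ^ y₀ + 5 * 3 ^ r ≡ 3 ^ u + 1 → ⊥
  cases zero    refl _ = contradiction b≥4 (from-no (4 ≤? 3))
  cases (suc r) b≡ h = family-base-3 r y₀ u (trans (cong (λ b → b ^ y₀ + 5 * 3 ^ suc r) (sym b≡)) (trans h (+-comm (3 ^ u) 1)))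

no-chain-3^ : ∀ {b} x₀ x₁ y₀ y₁ y₂ → 3 ≤ b → b ^ y₁ ≡ 3 ^ x₀ + b ^ y₀ → b ^ y₂ ≡ 3 ^ x₁ + b ^ y₁ → ⊥
no-chain-3^ {b} x₀ x₁ y₀ y₁ y₂ b≥3 e e′
  with refl ← least-exponent prime-3 (s≤s (z≤n {0})) b≥3 y₂ y₁ x₁ (trans e′ (trans (+-comm (3 ^ x₁) (b ^ y₁)) (cong (b ^ y₁ +_) (sym (*-identityˡ (3 ^ x₁)))))) =
  contradiction e (<⇒≢ (+-mono-≤ (1≤3^ x₀) (1≤^ b y₀ (≤-trans (s≤s z≤n) b≥3))))

-- Since 3 · 4ˢ contains 3 exactly once, f = 1. Then 3^(e-1) = 1 + 4ˢ, and neither 3 = 1 + 2 nor 9 =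
-- 1 + 8 involves a power of 4.
no-difference-3*4^ : ∀ e f s → 3 ^ e ≡ 3 ^ f + 3 * 4 ^ s → ⊥
no-difference-3*4^ 0 f s h = contradiction h (<⇒≢ (+-mono-≤ (1≤3^ f) (≤-trans (s≤s z≤n) (*-monoʳ-≤ 3 (1≤^ 4 s (s≤s z≤n))))))
no-difference-3*4^ (suc e) 0 s h = excluded 3 (0 , 1 , 3 , 1) (1 , 3 , 4 , 0) _ e s h
no-difference-3*4^ (suc e) 1 s h with power-minus-power-of-2 3 e (2 * s) ≤-refl
  (trans (*-cancelˡ-≡ _ _ 3 (trans h (sym (*-distribˡ-+ 3 1 (4 ^ s))))) (cong suc (^-*-assoc 2 2 s)))
... | inj₂ (_ , _ , h′) = contradiction (divides s (trans (sym h′) (*-comm 2 s))) (from-no (2 ∣? 3))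
... | inj₁ refl = contradiction (*-cancelˡ-≡ 3 (1 + 4 ^ s) 3 (trans h (sym (*-distribˡ-+ 3 1 (4 ^ s)))))
  λ h′ → excluded 3 (3 , 0 , 4 , 0) (1 , 1 , 4 , 0) _ 0 s h′
no-difference-3*4^ 1 (suc (suc f)) s h = contradiction h (<⇒≢ (≤-trans (≤-trans (from-yes (4 ≤? 9))
  (*-monoʳ-≤ 3 (*-monoʳ-≤ 3 (1≤3^ f)))) (m≤m+n (3 ^ (2 + f)) (3 * 4 ^ s))))
no-difference-3*4^ (suc (suc e)) (suc (suc f)) s h = excluded₂ 9 (0 , 1 , 3 , 2) (0 , 1 , 3 , 2) (0 , 3 , 4 , 0) _ e f s h

three-four-case₅ : ∀ {N D} i j k → 4 ^ j + 4 * 3 ^ k ≡ 4 * 4 ^ i → D ≡ 2 * 3 ^ k → N ≡ 3 ^ k + 4 ^ j → Conclusion 3 4 N D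
three-four-case₅ i 0 k h _ _ = ⊥-elim (excluded 4 (1 , 4 , 3 , 0) (0 , 4 , 4 , 0) _ k i h)
three-four-case₅ {N} {D} i (suc j) k h D≡ N≡ = cases i j (*-cancelˡ-≡ _ _ 4 (trans (*-distribˡ-+ 4 (4 ^ j) (3 ^ k)) h)) N≡
  where
  cases : ∀ i j → 4 ^ j + 3 ^ k ≡ 4 ^ i → N ≡ 3 ^ k + 4 ^ suc j → Conclusion 3 4 N D
  cases i zero h N≡ with 3^+1≡2^ k (2 * i) (trans h (^-*-assoc 2 2 i))
  ... | inj₁ (_ , h′) = contradiction (divides i (trans (sym h′) (*-comm 2 i))) (from-no (2 ∣? 1))
  ... | inj₂ (refl , _) = 3-4-7-6 (refl , refl , N≡ , D≡)
  cases zero (suc j) h _ = contradiction (sym h) (<⇒≢ (+-mono-≤ (1≤^ 4 (suc j) (s≤s z≤n)) (1≤3^ k)))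
  cases (suc i) (suc j) h _ = ⊥-elim (excluded₂ 2 (0 , 1 , 4 , 1) (0 , 1 , 4 , 1) (0 , 1 , 3 , 0) _ i j k (sym h))

-- With g = 3ʳ, the number 1 + 2 g = b^y₀ divides b^y₂ = 1 + 12 g = 6 (1 + 2 g) - 5, so it would
-- divide 5.
base-3-case₃ : ∀ {b} r y₀ y₁ y₂ → 4 ≤ b → b ^ y₀ ≡ b ^ y₁ + 2 * 3 ^ r → b ^ y₂ ≡ b ^ y₀ + 10 * 3 ^ r → ⊥
base-3-case₃ {b} r y₀ y₁ y₂ b≥4 e e′ with refl ← difference-2*3^ {b} y₀ y₁ r b≥4 e
  with k , refl ← m≤n⇒∃[o]m+o≡n (<⇒≤ (^-cancelʳ-< b y₀ y₂ (≤-trans (s≤s z≤n) b≥4)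
         (subst (b ^ y₀ <_) (sym e′) (m<m+n (b ^ y₀) (≤-trans (s≤s z≤n) (*-monoʳ-≤ 10 (1≤3^ r))))))) =
  small r (∣m+n∣m⇒∣n (subst (1 + 2 * 3 ^ r ∣_) (lemma (3 ^ r)) (n∣m*n 6)) (subst₂ _∣_ e (trans e′ (trans (cong (_+ 10 * 3 ^ r) e) (lemma′ (3 ^ r))))
    (subst (b ^ y₀ ∣_) (sym (^-distribˡ-+-* b y₀ k)) (m∣m*n (b ^ k)))))
  where
  lemma : ∀ g → 6 * (1 + 2 * g) ≡ 1 + 12 * g + 5
  lemma = solve-∀
  lemma′ : ∀ g → 1 + 2 * g + 10 * g ≡ 1 + 12 * g
  lemma′ = solve-∀
  small : ∀ r → ¬ (1 + 2 * 3 ^ r ∣ 5)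
  small zero h = from-no (3 ∣? 5) h
  small (suc r) h = contradiction (∣⇒≤ h) (<⇒≱ (s≤s (≤-trans (n≤1+n 5) (*-monoʳ-≤ 2 (*-monoʳ-≤ 3 (1≤3^ r))))))

-- Relations left open by the certificates

infix  4 _≐_
infixr 5 _⊞_
infix  6 _·_

_·_ : ℕ → ℕ → Term
c · i = (c , i) ∷ []

_⊞_ : Term → Term → Term
_⊞_ = _++_

_≐_ : Term → Term → Eqn
_≐_ = _,_

δ : ℕ
δ = 0

α β : ℕ → ℕ
α i = 1 + i
β i = 6 + i

-- The goals of a certificate are the relations between powers that the linear inequalities leave open;
-- the n-th member of xs-goals is settled by the lemma xs-caseₙ wherever a lemma of that name exists.
right-013 : List Eqn
right-013 = (1 · β 0 ≐ 1 · β 1) ∷ (1 · β 1 ≐ 1 · β 3) ∷ []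

-- The first family reads 2ᵏ + 1, 2ᵏ⁺¹ + 1, 2ᵏ⁺¹ + b, 2ᵏ⁺² + 1, 2ᵏ⁺² + b, which falls under
-- `right-013`. Its second term is also 2ᵏ + b, and this other representation falls here.
right-124 : List Eqn
right-124 = (1 · β 1 ≐ 1 · β 2) ∷ (1 · β 2 ≐ 1 · β 4) ∷ []

-- The second family, with j = k - 1, reads 3ʲ + 1, 3ʲ⁺¹ + 1, 3ʲ + b, 3ʲ⁺¹ + b, 3ʲ⁺² + 1.
right-014 : List Eqn
right-014 = (1 · β 0 ≐ 1 · β 1) ∷ (1 · β 1 ≐ 1 · β 4) ∷ []

-- The pattern of the second family with the powers of 2 in the place of those of b. Solutions are 4
-- + 1, 4 + 3, 8 + 1, 8 + 3, 4 + 9 and 4 + 3, 4 + 9, 16 + 3, 16 + 9, 4 + 27.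
left-014 : List Eqn
left-014 = (1 · α 0 ≐ 1 · α 1) ∷ (1 · α 1 ≐ 1 · α 4) ∷ []

right-013-goals : Goals
right-013-goals =
  ((1 · β 2 ≐ 1 · β 0 ⊞ 1 · α 0) ∷ (1 · α 0 ≐ 1 · δ) ∷ []) ∷
  ((1 · α 0 ≐ 1 · δ) ∷ (1 · β 4 ≐ 1 · β 2 ⊞ 2 · α 0) ∷ (1 · β 0 ⊞ 3 · α 0 ≐ 1 · α 2 ⊞ 1 · β 2) ∷ []) ∷
  ((1 · α 0 ≐ 1 · δ) ∷ (1 · β 0 ≐ 1 · β 2 ⊞ 1 · α 0) ∷ (1 · β 0 ⊞ 5 · α 0 ≐ 1 · α 4 ⊞ 1 · β 4) ∷ []) ∷
  []

right-124-goals : Goals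
right-124-goals =
  ((1 · α 1 ≐ 1 · δ) ∷ (1 · β 1 ≐ 1 · α 0 ⊞ 1 · β 0) ∷ (1 · β 1 ⊞ 3 · α 1 ≐ 1 · α 3 ⊞ 1 · β 3) ∷ []) ∷
  []

right-014-goals : Goals
right-014-goals =
  ((1 · δ ≐ 2 · α 0) ∷ (1 · β 2 ≐ 1 · β 0 ⊞ 4 · α 0) ∷ []) ∷
  ((1 · δ ≐ 2 · α 0) ∷ (1 · β 3 ≐ 1 · β 2 ⊞ 2 · α 0) ∷ (1 · β 0 ⊞ 5 · α 0 ≐ 1 · α 2 ⊞ 1 · β 2) ∷ []) ∷
  []

left-014-goals : Goals
left-014-goals =
  ((1 · α 0 ≐ 2 · β 0) ∷ (1 · δ ≐ 2 · β 0) ∷ []) ∷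
  ((1 · α 2 ≐ 1 · α 0 ⊞ 4 · β 0) ∷ (1 · δ ≐ 2 · β 0) ∷ []) ∷
  ((1 · α 3 ≐ 1 · α 2 ⊞ 1 · δ) ∷ (1 · δ ≐ 2 · β 0) ∷ (1 · α 0 ⊞ 5 · β 0 ≐ 1 · α 2 ⊞ 1 · β 2) ∷ []) ∷
  []

base-2-goals : Goals
base-2-goals =
  right-013 ∷
  right-124 ∷
  ((1 · β 1 ≐ 1 · β 2 ⊞ 1 · α 3) ∷ (1 · α 1 ≐ 1 · δ ⊞ 1 · α 3) ∷ (1 · β 3 ≐ 1 · β 1 ⊞ 3 · δ) ∷ (1 · α 0 ⊞ 1 · β 0 ≐ 1 · β 2 ⊞ 2 · α 3) ∷ []) ∷
  ((1 · β 1 ≐ 1 · α 0 ⊞ 1 · β 0) ∷ (1 · β 3 ≐ 1 · β 1 ⊞ 2 · α 1) ∷ []) ∷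
  ((1 · β 1 ≐ 1 · β 4 ⊞ 3 · α 2) ∷ (1 · α 1 ≐ 1 · δ ⊞ 1 · α 2) ∷ (1 · β 2 ≐ 1 · β 4 ⊞ 2 · α 1 ⊞ 1 · α 2) ∷ []) ∷
  ((1 · β 1 ≐ 1 · α 0 ⊞ 1 · β 0) ∷ (1 · β 2 ≐ 1 · β 1 ⊞ 1 · α 1) ∷ []) ∷
  ((1 · β 2 ≐ 1 · β 4 ⊞ 1 · α 1) ∷ (2 · β 1 ≐ 2 · β 4 ⊞ 1 · α 2 ⊞ 1 · α 1) ∷ (1 · α 2 ≐ 2 · δ ⊞ 1 · α 1) ∷ []) ∷
  ((1 · δ ≐ 3 · α 2) ∷ (1 · α 0 ≐ 4 · α 2) ∷ (1 · β 0 ≐ 1 · β 1 ⊞ 1 · α 2) ∷ (1 · β 2 ≐ 1 · β 1 ⊞ 10 · α 2) ∷ []) ∷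
  []

-- For the bases 2 and 3 these follow the eight `base-2-goals`, so that `res 8` names the first of
-- them.
two-three-goals : Goals
two-three-goals =
  left-014 ∷
  ((1 · α 2 ≐ 1 · α 1 ⊞ 1 · β 1) ∷ (1 · α 1 ≐ 1 · α 0 ⊞ 1 · β 0) ∷ []) ∷
  ((1 · α 1 ≐ 1 · β 2 ⊞ 1 · β 3) ∷ (1 · β 3 ≐ 1 · β 2 ⊞ 1 · δ) ∷ (1 · α 0 ⊞ 1 · β 0 ≐ 5 · β 2) ∷ []) ∷
  ((1 · δ ≐ 2 · β 2) ∷ (4 · α 0 ≐ 1 · α 1 ⊞ 4 · β 2) ∷ (1 · α 0 ⊞ 1 · β 0 ≐ 1 · α 1 ⊞ 1 · β 2) ∷ []) ∷
  ((1 · α 2 ≐ 2 · β 1) ∷ (1 · β 1 ≐ 1 · β 0 ⊞ 1 · δ) ∷ []) ∷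
  ((5 · α 3 ⊞ 2 · β 0 ≐ 3 · α 1) ∷ (1 · β 1 ⊞ 1 · α 1 ≐ 1 · α 4 ⊞ 1 · α 3 ⊞ 1 · β 0) ∷ (1 · α 4 ≐ 1 · α 3 ⊞ 1 · δ) ∷ (1 · α 0 ⊞ 1 · β 0 ≐ 2 · α 3 ⊞ 1 · β 0) ∷ []) ∷
  ((1 · α 2 ≐ 2 · β 1) ∷ (1 · β 1 ≐ 1 · β 4 ⊞ 1 · δ) ∷ []) ∷
  ((1 · α 4 ≐ 1 · β 0 ⊞ 1 · β 1) ∷ (1 · β 1 ≐ 1 · β 0 ⊞ 1 · δ) ∷ (1 · α 0 ⊞ 1 · β 0 ≐ 5 · β 0) ∷ []) ∷
  ((1 · α 4 ≐ 1 · β 2 ⊞ 1 · β 1) ∷ (1 · β 1 ≐ 1 · β 2 ⊞ 1 · δ) ∷ (1 · α 0 ⊞ 1 · β 0 ≐ 5 · β 2) ∷ []) ∷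
  ((1 · α 1 ≐ 2 · β 0) ∷ (1 · β 0 ≐ 1 · β 3 ⊞ 1 · δ) ∷ []) ∷
  ((2 · β 0 ≐ 1 · α 2 ⊞ 2 · α 3) ∷ (1 · α 3 ≐ 1 · α 2 ⊞ 1 · δ) ∷ (1 · β 1 ⊞ 3 · α 3 ≐ 2 · α 2 ⊞ 3 · β 0) ∷ []) ∷
  ((1 · α 1 ≐ 2 · β 0) ∷ (2 · β 0 ≐ 1 · α 2 ⊞ 2 · δ) ∷ []) ∷
  []

base-3-goals : Goals
base-3-goals =
  right-014 ∷
  ((1 · β 1 ≐ 1 · α 0 ⊞ 1 · β 0) ∷ (1 · β 2 ≐ 1 · α 1 ⊞ 1 · β 1) ∷ []) ∷
  ((1 · β 0 ≐ 1 · β 1 ⊞ 2 · α 0) ∷ (1 · β 2 ≐ 1 · β 0 ⊞ 10 · α 0) ∷ []) ∷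
  []

three-four-goals : Goals
three-four-goals =
  right-014 ∷
  ((1 · β 1 ≐ 1 · α 0 ⊞ 1 · β 0) ∷ (1 · β 2 ≐ 1 · α 1 ⊞ 1 · β 1) ∷ []) ∷
  ((1 · α 0 ≐ 1 · α 4 ⊞ 3 · β 0) ∷ []) ∷
  ((1 · α 1 ≐ 1 · α 0 ⊞ 3 · β 2) ∷ []) ∷
  ((1 · β 1 ⊞ 4 · α 2 ≐ 4 · β 0) ∷ (1 · δ ≐ 2 · α 2) ∷ (1 · α 0 ⊞ 1 · β 0 ≐ 1 · α 2 ⊞ 1 · β 1) ∷ []) ∷
  []

base-4-goals : Goals
base-4-goals =
  ((1 · β 1 ≐ 1 · β 4 ⊞ 3 · α 2) ∷ (1 · α 1 ≐ 1 · δ ⊞ 1 · α 2) ∷ (1 · β 2 ≐ 1 · β 4 ⊞ 2 · α 1 ⊞ 1 · α 2) ∷ []) ∷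
  []

-- Certificate trees

right-013-tree : Tree
right-013-tree =
  -- An example of how to read the codes: question 1 compares α 1 with α 0. If α 1 ≤ α 0, the digits
  -- 66, 64, 69 add row 2, which is β 1 ≤ β 0, row 0, which is the answer, and row 5, which is D + α
  -- 0 + β 0 ≤ α 1 + β 1. What remains is D ≤ 0.
  ask 1 (inf 296356937794) (ask 103 (inf 1365079327927712153669) (ask 108 (ask 8 (inf
  21392416061784135) (ask 101 (ask 82 (ask 86 (ask 102 (inf 2619473687822125563974) (inf
  96715246179087487519227979)) (ask 102 (inf 2619473687817830596678) (ask 14 (ask 94 (ask 98 (ask
  109 (inf 24207122879348808) (inf 1448662549475776911584532631093117071)) (ask 107 (inf
  4772388057621881894782968177647278738146852942) (ask 109 (inf 492036737847728994234007755) (ask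
  117 (inf 530841941150564379483052566740674332591376) (ask 22 (res 1 (23090071344065 ∷
  22815176659969 ∷ 6963513072420966872159097985 ∷ 6886144182662080415362196417 ∷
  1531246963645752257 ∷ 102712984232230863770753 ∷ [])) (inf
  1053857273629831955395392178298073851431441)))))) (ask 107 (res 2 (21990542938817 ∷
  21715648254721 ∷ 1459188269769040577 ∷ 6421908402329551510834254721 ∷
  6576650907348311536046183233 ∷ 6654020981463826349749703553 ∷ [])) (inf
  103970332194266020537958473))) (inf 1100773431046332065832870982818594956)))) (ask 102 (ask 109
  (ask 97 (ask 113 (res 0 (172368952701321390072642 ∷ 94448752813292547744385 ∷ 21715660837505 ∷
  21440766153409 ∷ [])) (ask 104 (ask 89 (inf 11884402091596353541536335134862) (inf
  2777910907826918702271913794216722575)) (inf 1443480156270534683827973095917355278))) (inf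
  16717241425083332793671730135179)) (inf 2757141323318676087675599288898290571)) (inf
  95506320359472854049488970))) (inf 6100659185580493788744891301960))) (inf
  21233469137664774184160242958597)))

right-124-tree : Tree
right-124-tree =
  ask 7 (inf 304946872386) (ask 109 (inf 1401973379025084678213) (ask 114 (ask 107 (res 0
  (20616124043521 ∷ 20341233553729 ∷ 1333085556057313601 ∷ 1351099679701471489 ∷
  1369114903113113857 ∷ 92087497513438751494593 ∷ [])) (inf 6179888557039024485037024477255)) (inf
  21391927880581835576753099374853)))

right-014-tree : Tree
right-014-tree =
  ask 1 (inf 296356937794) (ask 104 (inf 91879727370039744989823045) (ask 109 (ask 9 (inf
  405005176395531857634135624841953351) (ask 101 (ask 82 (ask 86 (ask 102 (inf
  1095591196317977212560393752176623818) (inf 425774680825736940720588364513083467)) (ask 102 (inf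
  16717394963348040962311845118278) (ask 13 (ask 78 (ask 90 (ask 103 (inf
  17034306400679141894087250673870) (inf 6813719900398731735178653794383)) (ask 107 (inf
  21922096677396644260712115261833950874714244046) (ask 108 (inf
  204178501526753741242960509105537217659471) (ask 17 (res 1 (22540294558657 ∷ 22815189242753 ∷
  446219510639091118760863255761985 ∷ 101532374595740557644673 ∷ 1513232290254168961 ∷
  446219665381596191562983935054913 ∷ [])) (inf 596542020448185893253736906323524177364688)))))
  (inf 44691113287049276836455204621852592260539418573)) (inf
  1427964192789029990453072115385368844)))) (ask 102 (ask 103 (ask 88 (ask 92 (ask 2 (ask 3 (inf
  3110293886427491244372856808619376970) (res 0 (21990530356033 ∷ 22265425040129 ∷
  436078073625518849065832352322497 ∷ 96809972082974641890049 ∷ []))) (inf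
  203495932581615273144153681142932740440393)) (inf 8084468483019853446303639919588148488)) (inf
  202813368782820416534447219188017056252231)) (inf 2419621824565795018174262888739701195)) (inf
  420582304737830673008105641170174026))) (inf 410197552483438143739318672315187272))) (inf
  3063501733403569223730697393368465989)))

left-014-tree : Tree
left-014-tree =
  ask 76 (inf 296356937794) (ask 84 (inf 1401973379059444351045) (ask 94 (ask 98 (ask 102 (ask 15
  (inf 49001071034167763621061451618132081180809) (ask 85 (ask 88 (inf
  6576034203930119388956061073482) (ask 2 (inf 3300559971018310375792633720311554098567053451)
  (ask 115 (ask 77 (ask 183 (ask 186 (res 1 (49514483170745842488087707374279729987 ∷
  97990581718365444776769 ∷ 1459183872267785089 ∷ 22540307141441 ∷ [])) (inf
  781906698811654445357653635700622590025982053843472)) (inf 102761406397169385192227149)) (inf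
  50702498445900561285501015294506865262734)) (ask 77 (inf
  9054152912814350022768774296896517454277706125) (ask 86 (inf 6813722318250371527120673112143)
  (inf 6221979370102491143686704643580852161267630350)))))) (inf
  49681625383257312408401427131740719612041))) (inf 157551473216852402608221075609363744686536))
  (ask 2 (ask 15 (inf 6338343671758228303304458567753) (ask 82 (inf
  27903569482437039822054325631251156238409) (ask 92 (ask 89 (ask 10 (inf
  50362548386057970092255090098393999540365) (ask 88 (ask 184 (ask 176 (res 2
  (28911129784569235763138077595082429441 ∷ 356520065 ∷ 22265378902913 ∷ 22540307141441 ∷
  1495217616862585665 ∷ 441148985608250064867677161133057 ∷ [])) (inf
  451736561186688433013133010080170064)) (inf 6892952898966802919306113646670)) (inf
  1100783492850095003647286619472003275))) (inf 50362548385899511348194348869658696220811)) (inf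
  6132753930666965593662582879590079677703061770)))) (inf
  113995325038393255342324963298564152492360))) (ask 3 (inf
  48660773090118565063174321114439664009350) (ask 17 (ask 83 (ask 97 (ask 82 (ask 86 (ask 2 (inf
  28924432160328115304470128902253895614540) (ask 103 (inf
  29265046829335853920998928126245281071181) (ask 113 (ask 13 (inf
  456933928648832767374645531201241167) (ask 90 (ask 91 (inf 1623337404134343180423) (ask 102 (ask
  78 (ask 184 (ask 192 (res 0 (30904997124914171440301885933815338371 ∷
  72776328034430215744292031416361825478 ∷ 102712623977246014575873 ∷ 24189599749313 ∷ [])) (inf
  603612196371393556920430532934124672415795344769430)) (inf 7368329127717988785934543552596))
  (inf 467318680824642941615525092368384209)) (inf 73502439912401482348647028443703430545745)))
  (inf 778866475157746126402671588657136015))) (inf 6893030271381367103419981234250)))) (ask 13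
  (ask 77 (ask 78 (inf 451741552560926499661599862199877710) (ask 91 (ask 108 (ask 184 (ask 188
  (res 1 (29908060911316521636288975822733186241 ∷ 252650443919926275105795 ∷
  99170849080184802382913 ∷ 23364953445377 ∷ [])) (inf
  4861635275809082224228300109966919506036785363)) (inf 1131937670474569942131281107260276945))
  (ask 184 (ask 188 (res 1 (29908060911316521636288975822733186241 ∷ 252650443919926275105795 ∷
  99170849080184802382913 ∷ 23364953445377 ∷ [])) (inf
  4861635275809082224228298947842027327996297427)) (inf 32484733821146224211740997255308))) (inf
  29946618873997289718640390239910735052876))) (inf 100342318785554795951620171)) (inf
  3892321547172513382473))) (ask 10 (inf 96715485986478687299043466) (ask 103 (ask 89 (ask 110
  (inf 6199635750670538439339066278755397728299974927) (ask 91 (inf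
  6892951689690455197868415123536) (inf 6244237920967715805649644616055255947142824207))) (inf
  686911924600543177889122254251953626414168557617613)) (inf 100345879083159261320184395)))) (inf
  114675900156987308081787138041824328155466)) (inf 27563281918148652512071706983350959276104))
  (inf 251460352116421732675551428)))))

two-large-tree : Tree
two-large-tree =
  ask 94 (ask 98 (ask 19 (inf 313536806978) (ask 78 (inf 5942199232520128798549342224450) (ask 83
  (inf 91879708923014196303626307) (ask 88 (inf 1420420123098794360900) (ask 82 (ask 86 (ask 5
  (ask 2 (inf 21392373112176707) (ask 107 (ask 7 (inf 16559399239038446802337328922696) (ask 8
  (ask 109 (ask 9 (inf 102760207318272210310201422) (ask 117 (res 3 (6344538330411791666028483393
  ∷ 1495217066804777473 ∷ 11528488986833467897901232962 ∷ 99171191353756209914369 ∷ [])) (inf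
  21921705011390216375233387969640218770767807438))) (inf 1105975948262885174584732725990260940))
  (inf 72140952186059416435395731421019886977227))) (inf 2656425161227799363718))) (inf
  171670049004039355612004421)) (ask 5 (ask 2 (inf 21392373112176706) (ask 107 (ask 7 (inf
  1085236788529623649637986051639672904) (ask 16 (inf 6655261157518564111924725416011) (ask 9 (ask
  21 (res 2 (101532338565569111397185 ∷ 100351764959525083288449 ∷ 23639768437569 ∷ 23364894724993
  ∷ 101532392613712425390913 ∷ 100351782978321630892929 ∷ 11605783497644890854401254209 ∷
  11528413425799189978014557057 ∷ [])) (inf 2102886883280876856636718008226152846)) (inf
  116036718112370926296051677818229109621068)))) (inf 2656425161227799363718))) (inf
  171670049004039355632779396))) (ask 10 (ask 7 (ask 116 (inf
  27563281923139859918725736204685032226888) (ask 121 (inf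
  136794259234559908762400462896747459707273) (ask 1 (inf 1457314174471044857925) (inf
  2751923752600134761693504848624353803)))) (inf 21392411766816834)) (inf
  93088653189654374177112130))))))) (ask 20 (ask 22 (ask 19 (inf 322126741571) (ask 90 (ask 91
  (ask 92 (ask 88 (ask 13 (inf 335011643457) (ask 77 (inf 96715485989575182625341509) (ask 82 (inf
  1494208225568417251397) (ask 109 (ask 9 (ask 1 (ask 76 (inf 343601578049) (ask 84 (inf
  451736561186688433013133559839523022) (inf 456928937274594682278871930299875406))) (inf
  94258646604157177507573038688055373267085)) (ask 101 (ask 1 (inf
  6892952900147412555246659043396) (ask 10 (inf 94939543670430221488988078350173924294735) (ask 3
  (ask 15 (ask 113 (inf 9143836381968291625759839832405091741380313170) (ask 80 (inf
  96301036584078742478995756992462930313299) (ask 79 (ask 210 (res 7 (1639327856838316929 ∷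
  25289048462273 ∷ 4097 ∷ 281022785 ∷ 108615996377364164514753 ∷ 107435422771320136405889 ∷
  2025411823632445476832533104311245318656963 ∷ 7118260302058024698684380097 ∷ [])) (inf
  135930267456775383588414742124479625240418714255887)) (inf
  1069831152147259527419839781081760705939891666419924)))) (inf
  1796592312418031557214390835420267530)) (inf 138837651282219434479091013656686205993296)))) (inf
  464492507979473411942882473876906773447117))) (ask 101 (inf 6734494157230350599154093326402)
  (ask 108 (ask 16 (ask 80 (ask 84 (ask 8 (ask 2 (ask 96 (inf 7289175918586051590587951874252)
  (ask 76 (ask 10 (ask 201 (inf 3545936905967180719933576078902774305955512783) (ask 209 (res 4
  (31569626336625483495294982731786622017 ∷ 31901938406096821223675817336644834305 ∷
  24739288453633 ∷ 24464414740801 ∷ 481714191575007205528800990336065 ∷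
  486784716608209496703318641087489 ∷ [])) (inf 119783199142410035001168161168803291268112))) (inf
  111222780289294974490968143)) (ask 110 (inf 3523744710506220764086671546410024563387269902) (ask
  79 (ask 209 (res 4 (7350455518372346590591464513 ∷ 7273002804626807010002736193 ∷ 25838829442113
  ∷ 25563938952193 ∷ 112157897339206725805121 ∷ 801162220233288242544125153387585 ∷ [])) (inf
  116058612720858632726511693)) (ask 210 (inf 32668254729304928445206561846086456836368) (ask 209
  (inf 10704738473734834215021368675578810258703386130) (inf
  503660322143123690758872798480564302))))))) (inf 106387040117348310372778059)) (ask 11 (ask 119
  (res 5 (51508350519137387226251902330500817732 ∷ 181813793754001509983042 ∷
  461431627228850606416546465059650 ∷ 1621319780545860417 ∷ [])) (inf
  810025564986326587674042053671256147)) (inf 6111365650238731083560424109159219282))) (inf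
  107596002836362684247572549)) (inf 106387058569722502100025412)) (inf
  784048551661898267927552237330759943)) (inf 32008895775685327036891802304845))))))) (ask 11 (ask
  13 (ask 114 (ask 109 (ask 9 (ask 82 (inf 22799747995729995) (ask 89 (inf
  6813723528707270055683323723974) (inf 6892952900128907264107214930124))) (ask 7 (inf
  32167586635901961646543846375501) (ask 86 (inf 16954928332894342553111942594702) (ask 83 (inf
  2748606244354059927628) (inf 2113276627063041548188486534684737615))))) (ask 80 (ask 82 (ask 84
  (ask 83 (ask 8 (inf 24207208778563649) (ask 89 (ask 97 (ask 17 (inf 111222780289294974490771536)
  (ask 14 (inf 111222817182783130499809359) (inf 6132135154590370321293636021917647316))) (ask 14
  (inf 110013872916424419025551438) (ask 119 (res 6 (184175049052480610509762 ∷
  185355622659074637698114 ∷ 21973618691772966827030766530 ∷ 22050988763618633070118188098 ∷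
  182994457431763161457602 ∷ 1621320055398601409 ∷ [])) (inf
  2144430883588058941550841262772650253)))) (ask 2 (inf 7209870384782444057795873538129) (ask 17
  (inf 7289099756240975035567278522448) (ask 14 (ask 119 (inf
  118759023769061082899199820842763593711765) (ask 76 (res 0 (4737 ∷ 4097 ∷ 5185 ∷ 4545 ∷ []))
  (inf 2096388469049221547711370761385762192282288214))) (inf
  1147504815837488475245219031965565076)))))) (ask 107 (ask 86 (ask 96 (res 1 (4161 ∷ 4417 ∷
  268439873 ∷ 272634113 ∷ [])) (inf 12201320789067967040055874617544)) (inf
  108804947120735433462448198)) (inf 2785554340098667970689))) (inf 105178114303082319935701059))
  (inf 2693264886233024299075)) (inf 102760225769801955632218177))) (inf
  16717704447177202005939912376458)) (inf 328830423965219374967685321)) (inf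
  3818533444977764139144))) (inf 1457314174196166885638)) (inf
  113655364603780677079524239462419564594117)) (inf 6100657975437190754092152062212))) (inf
  38843856027910210)) (inf 165624147025455491472949313))) (ask 15 (ask 16 (ask 17 (ask 19 (ask 89
  (ask 97 (ask 13 (inf 21392373112242247) (ask 14 (inf 22236853876817987) (ask 77 (inf
  6417576670197134279806946443331) (ask 86 (ask 23 (ask 2 (inf 11725863558671288828177506762828)
  (ask 11 (ask 113 (ask 78 (ask 83 (ask 102 (ask 90 (ask 82 (res 1 (4673 ∷ 4097 ∷ 4929 ∷ 4993 ∷
  [])) (ask 1 (inf 52064655993829435104971497878095991341396) (ask 76 (res 0 (281022785 ∷ 4097 ∷
  268439745 ∷ 4417 ∷ [])) (inf 467313689528987082420449296557408327)))) (inf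
  74182012922693310028929046293892184080588)) (inf
  21944136768306336466652300041314592992608977169)) (inf 105178095850989616078979148)) (inf
  72820862685663663292884865837167429681355)) (inf 1775772181037231561955284143477096526)) (inf
  16875772702295192467007106121805))) (ask 123 (ask 110 (inf
  60390816138047857289078569393422945968349249613) (ask 3 (inf
  138156733517588700330573248671549806346382) (ask 104 (ask 8 (inf
  3099817942637816007207997759654920464) (ask 80 (ask 82 (inf 27255364383578943590275687448649)
  (ask 91 (inf 186177361715037107833536654) (ask 1 (inf 7130718386937618367025369972806) (inf
  462121313441080814671937776199729224)))) (inf 11963632674655517490991559999557))) (inf
  5763486592705154444163701687991010378)))) (ask 1 (ask 76 (inf 339306610753) (ask 83 (ask 3 (ask
  84 (res 1 (4545 ∷ 268440257 ∷ 4801 ∷ 4865 ∷ [])) (ask 5 (inf 6892952900165836780506188021892)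
  (inf 17034542141213930437028313104530))) (inf 2777895695325790513881857990638961163)) (inf
  6734494157211845871514358513741))) (inf 790825286582408787831118770173561386041677)))) (inf
  6338346089609867533116833661194))))) (ask 13 (inf 21392373112177031) (ask 23 (ask 85 (ask 4 (inf
  16638009634555680854922814947530) (ask 9 (inf 177713571244831708520054923) (ask 82 (ask 76 (ask
  7 (inf 103969114691142761480323150) (inf 1512655250842229735493)) (inf
  268143600724895828385832711316877143901129)) (inf 3089433269225921942978337593490931916)))) (inf
  6259116718354250457843750864393)) (inf 2637906076388554834184)))) (ask 11 (ask 14 (ask 23 (inf
  1475761200019730923592) (ask 95 (ask 22 (inf 2087395876569002803088662851297280074) (ask 82 (ask
  86 (ask 107 (ask 7 (inf 347896545347) (ask 108 (inf 6893106433726499109831396491343) (inf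
  451756843904565770662603488368001098))) (inf 6734494158410960234270043471944)) (ask 7 (inf
  343601578049) (ask 13 (ask 91 (inf 6893106433726463080759495360591) (ask 84 (ask 88 (inf
  369371381827) (ask 76 (ask 1 (inf 107595947490218865837867088) (ask 104 (inf
  7209867966524971110629363679313) (ask 109 (inf 53084838490893787050522167113356994674834) (inf
  7368329127717988785934546698316)))) (ask 2 (inf 184967236844673325437419666) (inf
  26270678018045991688809798793952836658447778377)))) (inf
  1121583421144953356507616470798369412))) (inf 23644245940240450)))) (ask 7 (ask 8 (ask 88 (inf
  100342355679042943370592392) (inf 101551263051913503143297099)) (inf
  6734571529644892829048702632008)) (inf 22518328853528641)))) (inf
  11408949699669967933571040608521))) (inf 16400477473972037479553722089607)) (inf
  46745326749672843606389130592582))) (inf 246622213833686752144916676)) (inf 21110932495138883))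
  (inf 1365079046474210213954)) (inf 88252876123093671310524481))

-- The opening question 194 asks whether β 4 is at most 5 or at least 25 times β 3. Such finer
-- comparisons are available because the base is fixed.
two-five-tree : Tree
two-five-tree =
  ask 194 (ask 94 (ask 98 (ask 19 (inf 317831774274) (ask 78 (inf 6021428603978659776320747143234)
  (ask 83 (inf 93088653189654374164594755) (ask 88 (inf 1438867148647480623172) (ask 184 (ask 5
  (ask 2 (inf 401369275160514224055320647) (ask 7 (inf 114339927441937374357509583495273541664840)
  (ask 109 (ask 122 (ask 1 (inf 100343517863890128981983304) (ask 179 (ask 101 (inf
  1770701501495984911048069424433725837) (ask 15 (ask 107 (ask 16 (inf
  27413354061691287410872639488400) (ask 9 (res 2 (1734172405089461411457214827205701 ∷
  106254813134829834474625 ∷ 402587561336246869431365 ∷ 24739280065665 ∷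
  1749384367057136315741340442825797 ∷ 106254831155275620160641 ∷
  1734172405089467176082330315924549 ∷ 11915275591124046618671719553 ∷ [])) (inf
  226971776087492717272121123595207840695057))) (inf
  14830221180956877524419975054297022716187510287)) (inf 3447737167356756077458658731747902222)))
  (ask 103 (ask 104 (inf 21921857468529841559164252167862726415815868746) (ask 16 (inf
  52063653875465002505190034889746739495055) (ask 9 (inf
  969104508343057274390573430750200641845297738090128) (ask 22 (inf
  36283429842186334377382406634878504864196658769) (ask 176 (inf
  74862588036296220642569377903873207763154) (ask 186 (inf 2471540514919818590139877095099072980)
  (ask 115 (ask 101 (inf 227654693019916243455824091915323124941458) (ask 201 (ask 276 (inf
  402566486283983329295992075625536560759956) (inf
  64940760263216602193209759201828014657966574418)) (inf
  2608251425881572066812322519395258160912644419008590604881))) (inf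
  35119920633827093414296219992644766790422656088761364)))))))) (inf
  334159049724074546737105162335929646973582)))) (inf 62352740413996815578910578639627)) (inf
  1760215335339081953049820816961110345)))) (inf 790649513667928907059495172)) (ask 107 (ask 11
  (ask 109 (ask 22 (ask 101 (inf 36127322240460685651616687514695495654350325194) (ask 103 (inf
  29013384864078460455585934359625731173058544843) (ask 7 (inf
  442380457648908787652741093326515459457293) (ask 16 (res 3 (101532338565569115591553 ∷
  11683229127120114246720955202 ∷ 11605788220083448910543070081 ∷
  1414709520972434949417201314054978 ∷ [])) (inf 552280052239298382941049358350199426712909)))))
  (ask 122 (ask 1 (inf 333818762240598465688565199894619345257163) (ask 102 (inf
  14763317917846971330447142875742132335905735308) (ask 7 (inf
  333828726258510386504163026221444004249678) (res 2 (178271964848928608756546 ∷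
  177091391241785060631426 ∷ 2720191767398851394 ∷ 2702178468417774466 ∷
  11683235031555397412005618498 ∷ 11605862598490427128432042882 ∷ 178270811930997397922625 ∷
  177090238324953378202497 ∷ []))))) (ask 102 (ask 7 (ask 82 (inf 352191512641) (ask 188 (inf
  6765589825432764675530984477424158031) (ask 1 (inf 1567996327488284393544) (inf
  552303308638578653489697406488650036609744)))) (inf 11726099305146037330469970182285)) (inf
  14725375680117463253869150328234511116)))) (inf 99133392969881409156022339)) (inf
  404996273980006070877356232)) (inf 171673590832944703378358407))))))) (ask 198 (ask 20 (ask 21
  (ask 19 (inf 330716676164) (ask 90 (ask 91 (ask 92 (ask 188 (ask 88 (ask 13 (inf 347896545345)
  (ask 77 (inf 100342318789495716208246854) (ask 82 (inf 1549549302214476038214) (ask 109 (ask 9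
  (ask 1 (ask 115 (inf 1126740223375644672325726645929967696) (ask 76 (inf 360781447234) (ask 179
  (inf 52744550931596684524367474461387753455888) (ask 182 (inf
  4906194570211333413662387497643215460259397779) (inf
  116255209507929015234778656871925698012076049426))))) (inf
  443729982257369294647012787950417848304207)) (ask 101 (ask 1 (inf
  117739485157214658341726422603310270316623) (ask 10 (inf
  226629832212594623584816350120869773312145) (ask 3 (ask 15 (ask 113 (inf
  510128899812530024562105604716334850149565244047444) (ask 80 (inf
  7805357461142219259709049771166572532239695957) (ask 177 (inf
  5191317284513785654565429208228042773803661085115093) (inf
  5189850008267630322936031053052568061082801540104918)))) (inf
  7783186704134949944021645980609244140409585746)) (inf
  139858513960110509961506816083251130204498)))) (inf
  79034828489771928873063232053127527946273555151))) (ask 101 (inf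
  117058910038620605590458331934350958329933) (ask 108 (ask 8 (inf
  1796587241738267656000806898062786639) (ask 113 (res 5 (179452610512016893813250 ∷
  180633184118610694513282 ∷ 1585290983480758785 ∷ 1603305107141694081 ∷ [])) (inf
  32404501025946561747755540480394))) (inf 8427226234143813666357274870385475729))))))) (ask 114
  (ask 14 (inf 6271988124977769676875) (ask 77 (inf 1775792463601580079791679645348462667) (ask 86
  (ask 102 (inf 117059574632255777076430279261586760990797) (ask 7 (inf
  770407700920255346206915029124928604864975) (ask 82 (res 1 (4289 ∷ 4097 ∷ 297800645 ∷ 301995013
  ∷ [])) (inf 117399197597995445673610277773810325782608)))) (inf
  52529067231952569094853729255564)))) (inf 77646329048271686376651137024522))) (ask 2 (inf
  1760215335337861221404070160128999496) (ask 7 (inf 26937983883859792111006881611849) (ask 14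
  (ask 76 (ask 80 (ask 185 (inf 116717957834980064990556356328884978188366) (ask 78 (res 0 (4225 ∷
  4289 ∷ 4673 ∷ 268439681 ∷ [])) (inf 334839624918805448006562343897045850718415))) (inf
  334159049800211165571212709533995374215373)) (inf
  36149841109995059713571469255357370950377406796)) (inf 27017213249415188501471737086026)))))
  (inf 1494208225293539410119)) (inf 114335939722374729818986413642721196769990)) (inf
  6259116718354252709634961899717))) (inf 2582564999776855654467)) (inf
  168042035558735855784820802)) (ask 20 (ask 22 (ask 19 (inf 330716676163) (ask 90 (ask 91 (ask 92
  (ask 188 (ask 88 (ask 13 (inf 347896545345) (ask 77 (inf 100342318789495716208246854) (ask 82
  (inf 1549549302214476038214) (ask 109 (ask 9 (ask 1 (ask 76 (inf 356486479937) (ask 179 (inf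
  108804947103002235043381315) (ask 84 (inf 472506065538313577704083926397747408) (inf
  1806946720130238528464846707239354704)))) (inf 443729982257369294647012787950417848304206)) (ask
  101 (ask 5 (ask 10 (inf 226629832212594623584816350120869773312144) (ask 111 (inf
  7760777071896960037933661402449598860262703249) (ask 113 (inf
  1479852300453354216774864950402679626) (ask 15 (inf
  2380831036777231967120473827402820083890441660727379) (ask 116 (inf
  7805706254213364483006251814795787797070217364) (ask 115 (inf
  29259676480688051971019194817948883535889371533) (ask 182 (ask 76 (inf
  22167495734681849185506583351428132855887102039) (inf 1490196567039316721807456473262326031))
  (inf 1644626373982031385390330531532231397999830)))))))) (inf 27333898627376542768725015920847))
  (inf 770411023736795487013989773084949024735822))) (ask 1 (inf
  29945294848439876420227209739533407289421) (ask 3 (inf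
  117402515475610213954397743972784563159246) (ask 108 (ask 16 (ask 80 (ask 84 (ask 8 (ask 2 (ask
  96 (inf 7606093404420174375773664772301) (ask 10 (ask 76 (ask 209 (res 4
  (32566562545503486896091664514096829569 ∷ 32898874614974822263271243285627147265 ∷
  25563922174401 ∷ 25289040072961 ∷ 496926230891503324355288090285185 ∷
  501996755922344414273972413142017 ∷ [])) (inf 1843343901470196319192401293945602264)) (inf
  27809505749872690361579782537551)) (ask 110 (ask 76 (inf 117267501621088493207289938) (inf
  7917319888123760741048134804007598325620279184)) (ask 76 (inf 117267501621088488912322642) (ask
  183 (ask 101 (ask 176 (inf 6556583788200997889964618875435665158480855253) (ask 196 (ask 210
  (inf 1461645189090459844040329746484693618556807653955861) (ask 209 (inf
  4735416036898983035684049812848592097133981968367774) (inf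
  545214463502781288121272051048841558))) (ask 210 (inf
  5174221043762121873237913039940542196840727829) (ask 209 (inf
  4735416036898983035684048418818976900762773079730200) (inf
  545214463502781288121272051048841558))))) (inf 3822740584834876249213089642032257450509082))
  (ask 196 (ask 176 (ask 209 (res 4 (7892062549827146272317912449 ∷
  1810232291883520173749004998301061 ∷ 27762987373953 ∷ 27488096883969 ∷ 120422164785018183886209
  ∷ 224973633307081692270390275998350353797 ∷ [])) (inf 8510557627080179337912513180999092956))
  (ask 210 (inf 8006306449353240315229021185762889551397782804) (ask 209 (inf
  50825262386069837069902875392351812912317013527) (inf 540022087414875021129082942717034965))))
  (ask 79 (ask 209 (res 4 (7892062549827146272317912449 ∷ 7814609835955506726796531073 ∷
  27762987373953 ∷ 27488096883969 ∷ 120422164785018183886209 ∷ 836656978646709994485749636932993 ∷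
  [])) (inf 534829711326968753416600219374125524)) (ask 210 (inf
  35050267644384113033324171477155054616852) (ask 209 (inf
  165723359255027216433536443178188740036119) (inf 540022087414875021129364417693745621))))))))))
  (inf 111222817182783121909809228)) (ask 11 (ask 119 (res 5
  (52837598797641391760647478406761423812 ∷ 186536232294465197319106 ∷
  481714346317512098185562441126850 ∷ 1693378474099610561 ∷ [])) (inf
  3489352475122206176598436324387389653)) (inf 17509533933067109895294228693198))) (inf
  112431779902923412871315526)) (inf 111222835636283230723768389)) (inf
  1801804971225028847620179054211629264)) (inf 52608687104491840529499819672015)))))))) (ask 10
  (ask 4 (inf 8411649103560160570675382539453136970) (ask 11 (ask 9 (inf
  413458902291261610233495628) (ask 114 (ask 14 (inf 6345776227172514988110) (ask 85 (ask 2 (inf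
  3463365398581994376491665433777668304) (ask 7 (inf 111224016263651729730764873) (ask 119 (ask 86
  (inf 1812139096606203693952474725781078099) (res 6 (185355658687871392424834 ∷
  12224838520766961954934756354 ∷ 22050991124837938484993876866 ∷
  1450204279385862447951401359258626 ∷ 184175067067153976927106 ∷ 11992724763400953428269077506 ∷
  []))) (ask 101 (ask 76 (inf 31989008863902115744342846718570924539988) (ask 77 (inf
  17840953797056846913039621228245747714143158549) (ask 86 (inf
  1827716224869922497090767320739938390) (inf 2188048990700605912161523458134748123038742)))) (inf
  14073042503580536645638020735815428338765002410034067))))) (inf
  1796561967953205224428586816386891983))) (inf 77963246534105810287736756961805))) (inf
  6271987843502797160651))) (inf 1765509124247510096565132444308079369))) (ask 11 (ask 114 (ask
  109 (ask 9 (ask 82 (inf 23081222972440650) (ask 184 (inf 6892952900165800752254629839045) (ask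
  89 (inf 6972182271624367477073199169734) (inf 27334130741152229419977512518604)))) (ask 7 (inf
  27176058860400799129899423301900) (ask 186 (inf 5104054830314780100766675139234759117) (ask 83
  (inf 2767053269902746189899) (inf 25047768561414174794770658311964721358))))) (ask 80 (ask 82
  (ask 84 (ask 183 (ask 83 (ask 14 (ask 117 (inf 32563113296134036091837218554001) (ask 89 (inf
  25896084408631362) (ask 2 (inf 7447558502699865897282484371538) (ask 76 (res 0 (4673 ∷ 4097 ∷
  5057 ∷ 4417 ∷ [])) (inf 119107281635713397247046640858832941941012))))) (ask 17 (res 6
  (107435422769945751065345 ∷ 184175013023958704329602 ∷ 11992650385408305826065560321 ∷
  21973616330553661687003624322 ∷ 1621320055377629953 ∷ 180633238179673291101058 ∷ [])) (inf
  5130016710751875878635406099946799697))) (ask 107 (inf 8447995738495497766518309876090339792)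
  (ask 16 (inf 108806127730370274496938050) (ask 14 (inf 179689890918370748404536195941778) (ask
  85 (ask 186 (inf 58310129788278895867870128500088963540) (ask 196 (inf
  27888736335459029255857679434051) (ask 116 (ask 177 (ask 77 (ask 95 (inf
  7922934727909222857463644094535) (ask 203 (inf 50779962994124563315902688903189345749699265675)
  (ask 207 (inf 6695289645990524254859921781940939513818010117542354) (inf
  18222907765889180501503933743244)))) (ask 203 (inf
  50757661908638473474964154875466533907114558602) (ask 207 (inf
  441865439516319772819926398191530599000759152434455020545998319934288631805204029160061054575226220433701470161)
  (inf 18143678394430649805203210502283)))) (ask 197 (ask 203 (inf
  8470999838587775340966168947838263836819698599002442) (ask 207 (inf
  441865439516319772819926398191530599000759152434455020545998321395812570221593037283912583815049363972781375441)
  (inf 556707113631171722431114334590488808195665))) (ask 203 (inf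
  26493710654623315359975838642016826239645843530) (ask 207 (inf
  1897797611955259482539733577359697466891550838878663096827895284554080316284894838825272574954301799473910686174852284369)
  (inf 556707113631171722101716283466330642515537))))) (ask 97 (ask 77 (inf
  7843705356450691879692234981446) (ask 201 (inf 6500905411861649284280088306635047562) (ask 207
  (inf
  7414254958502457307895226092131583453367052659857376693612185620356737901707567372579271574810331865808849)
  (inf 18143678394430649805203210502283)))) (ask 207 (inf
  599924298296016227587205387292728457822730) (inf 17985219651513588412601764020361)))))) (inf
  113640724169281570294726721)))))) (ask 107 (ask 86 (ask 96 (res 1 (4161 ∷ 4417 ∷ 268439873 ∷
  272634113 ∷ [])) (inf 12280550160526497736352302825672)) (inf 110013891387375611323416646)) (inf
  255524390821975995918045938059663))) (inf 106387058569722502091636803)) (inf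
  2711711911781710561347)) (inf 2693264886233024233538))) (inf 381893305196451453341350026679817))
  (inf 29828839474672712091080))) (inf 1494208225293539410118)) (inf
  114335939722374729818986413642721196769989)) (inf 6259116718354252709634961899716))) (inf
  39406814571266114)) (inf 168042035558735855784820801)))) (ask 15 (ask 16 (ask 17 (ask 19 (ask 23
  (ask 3 (inf 16400321520180087921608595931334) (ask 8 (inf 174086738444911174932889735) (ask 13
  (inf 1494208225293539409992) (ask 85 (ask 86 (ask 92 (inf 436159432921758250657122827482038347)
  (ask 182 (ask 82 (ask 7 (inf 105178058957501460069810254) (ask 76 (inf 1549549302214475972678)
  (ask 90 (ask 191 (res 1 (4545 ∷ 4353 ∷ 17592471262273 ∷ 293606529 ∷ [])) (inf
  95619802033721060196468239301478022185234)) (inf 95279514474424033829098317438359224189201))))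
  (ask 1 (inf 102761406397170484703723592) (ask 7 (ask 80 (ask 90 (ask 91 (ask 11 (ask 114 (ask 76
  (res 0 (4417 ∷ 4097 ∷ 4289 ∷ 306188933 ∷ [])) (inf
  7738475984754449774362000884153865045711389008)) (inf 7209947758396077006827272208464)) (inf
  1142317272432961607612961656222384339)) (inf 74182007730396738009539114018450562744531)) (inf
  73841720171099558110951302071784932442322)) (inf
  3389895322016651643058181136643182621400760465)) (inf 6271987843502797095108)))) (ask 11 (inf
  27017212040194145264628203585870) (ask 108 (ask 192 (inf
  95279504099813119635559513356549764022543) (inf 25042576260685825915078147268879782608)) (inf
  778886758419662846196376617215459471))))) (inf 22799808125206594)) (inf
  1475761199792097591361))))) (ask 123 (ask 190 (ask 191 (ask 192 (ask 189 (ask 89 (ask 113 (inf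
  2730159218530499756103) (ask 77 (inf 51043123509564089119678132250576473751693) (ask 179 (ask
  110 (inf 312721598132861537272440541117753191563722) (ask 103 (inf
  43375175025101419347125335776577893443675228304) (inf
  661512358697902132860290937661200358113553))) (ask 1 (ask 110 (inf
  100443217219263130312637318092295989335387996689) (ask 3 (inf
  129032337682914464220729798021343572165785228049) (ask 176 (inf
  117400859158186512036794245585093809078355) (ask 178 (inf 1796592312418110657086603119774860298)
  (ask 82 (inf 118081761345925837642726338966047706120276) (inf
  1801779697826829411386508416876085323)))))) (inf 225608979868749332386380851236539011301456)))))
  (ask 13 (inf 95139916522061900) (inf 11805483416748281384662563094598))) (ask 2 (inf
  52132535930678541030402462187660) (ask 7 (inf 409832051135512325219024973) (ask 13 (ask 76 (ask
  185 (inf 14808137522610664540352629149556869138001494415) (ask 90 (inf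
  3412108614646861876035054511075466697601843344) (inf
  225954257225247794496580003878041931285137))) (inf
  14786054217839405446289307284530736058618872462)) (inf
  3437454224553334239926233362604687630))))) (inf 752889224376105661656164439379411082)) (inf
  136113356965928100937066535184668608102793)) (inf 11329720328211436955799635755144)) (ask 190
  (ask 191 (ask 192 (ask 189 (ask 89 (ask 14 (inf 23644250235207745) (ask 77 (inf
  446544185097570822975576404406960205) (ask 182 (ask 82 (res 1 (18691995472833 ∷ 4097 ∷ 293606337
  ∷ 4353 ∷ [])) (ask 5 (ask 3 (inf 27175671992000204840476497805393) (inf
  444071931377091744891808510822962766217362)) (inf 1314854503439635240365457210378775218291088)))
  (ask 1 (inf 27096442626776853503595426218318) (inf
  86148765872805182109506691018407077618033164496))))) (ask 13 (inf 95139916522061900) (inf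
  6734881015835363778675750273101))) (ask 2 (inf 52132535930678541030402462187660) (ask 7 (inf
  409832051135512325219024973) (ask 13 (ask 90 (ask 186 (inf
  1786227842961310044752384740708122895) (ask 83 (ask 91 (ask 107 (ask 121 (inf
  810025643908632050113457624271618195) (inf 96303700252648857503335112031547536965908)) (inf
  1137150408049125467769978861327286482)) (inf 86193368033808304102774845654681923619868315410))
  (inf 462131375416508839275985439054626896))) (inf 443064366196729542977364739217055810258767))
  (inf 27097990057728922559869175922958))))) (inf 267122400567991431497192544643584564396810))
  (inf 266781785863568935141600774266761943384841)) (inf 21471079874903402111089221107976)))) (inf
  247831158100326934300852420)) (inf 21392411766816835)) (inf 1383526072027191443522)) (inf
  89461820389733853466460225))) (ask 15 (ask 16 (ask 17 (ask 19 (ask 113 (ask 13 (ask 22 (inf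
  1457314174196170948679) (ask 95 (ask 96 (ask 88 (inf 339306610756) (ask 179 (ask 79 (ask 1 (inf
  6576031786078479878218439721034) (ask 102 (inf 11805173929395687793811171442759) (ask 7 (inf
  1567996327488284590156) (ask 109 (ask 122 (inf 139180254621126500002876614693772065439889) (ask
  80 (inf 30285572012922498875674757657200278634575) (inf 6776050637027820389537029975301292306)))
  (inf 6972182270425333897077517975815))))) (ask 2 (inf 3421750250840855132663212399362048077)
  (inf 116044688308410820016300215284603015332045))) (ask 2 (inf 176504626978192080410640523) (inf
  8412156086893262339580352340957726156)))) (inf 136113351778701922174404297610820491673865)) (inf
  11329797699463892292066816884936))) (ask 85 (ask 86 (ask 189 (ask 108 (ask 8 (ask 101 (ask 21
  (inf 180131459778112339119833229) (ask 77 (inf 175296881764552851289473096) (ask 179 (inf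
  11884403300522173156139740037197) (ask 182 (inf
  107582613254251530626836425089159675197675998864) (ask 192 (inf
  3452904587370207918375029569605010065) (ask 89 (inf 184968435895422487249092688) (inf
  16750478337997567500885133034462317708))))))) (inf 50364869342595664481332470074980671357068))
  (ask 82 (inf 40251471429763142) (ask 84 (inf 768471423765691456642717824288620941) (ask 192 (inf
  11884558048063188795068271558798) (ask 89 (ask 97 (ask 179 (ask 79 (ask 9 (inf
  117741141474399879066079013710278880133454) (inf 30966157511039533302002219069513205874765))
  (ask 101 (ask 1 (inf 225950923794432813648710194998945262403919) (ask 104 (inf
  14897124427450823710749418965285863377959781328) (inf
  2848481566198712174492154202427644104868567238509519))) (inf
  14852957824544058215158360678349965307981726351))) (ask 101 (ask 1 (inf
  52529069649804227181844596523342) (ask 104 (inf 14874823341964733869810884937563051535375074255)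
  (ask 76 (ask 80 (ask 78 (ask 90 (res 0 (4225 ∷ 4289 ∷ 268439745 ∷ 272633985 ∷ [])) (inf
  54445983523504589017039788494537968451666)) (inf 53765418789662712088913964604611307372755))
  (inf 53765756285948181555467424538897640980560)) (inf
  53084848875487581491429880072493033586897)))) (inf
  71923177869043639079443382803554553854434282638))) (inf 3442545108569565073346847922151229840))
  (inf 182552908623070913332838729)))))) (ask 5 (ask 107 (ask 76 (inf 175296863353837578898243656)
  (ask 79 (inf 6734490532500422644816111337678) (ask 82 (ask 84 (ask 96 (res 1 (4673 ∷ 4225 ∷
  268439681 ∷ 272634433 ∷ [])) (inf 27254897736662758455280021603537)) (inf
  6972491761319625790541074268422)) (inf 255039343062465067544404820623759)))) (inf
  436210061266250646519487165591126092)) (inf 28245181113006605584748590641595604664395))) (inf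
  128121628414776731521123621209161)) (inf 16481254287008065960478035280072)) (inf
  26543384457519205712170852614471))) (ask 85 (ask 86 (ask 192 (inf
  26621375879493574230938948403528) (ask 89 (ask 182 (ask 82 (ask 7 (inf 339306610753) (ask 76
  (inf 1494208225568417185863) (ask 97 (res 1 (4545 ∷ 4289 ∷ 4097 ∷ 4417 ∷ [])) (ask 197 (ask 110
  (inf 50466702765932815537917482039520802302165977292) (ask 4 (ask 23 (inf
  17271844606223928677918675370194) (inf 2822376331875417587922)) (inf
  117399197623190256436475774182502305105094))) (ask 110 (inf
  16212692803119901877127387579152523449724570064) (ask 3 (ask 20 (inf
  17271844606223928677643810046162) (inf 12122091414049202069780866205138)) (inf
  79034284383246126412286746876431771978984924241))))))) (ask 5 (ask 3 (inf
  408623125225826798696333381) (ask 8 (inf 16956087711608213655935798280398) (ask 114 (inf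
  181711552447928180716772346050886356107338) (ask 123 (ask 80 (ask 79 (inf
  1126735390561701265424207426315813070) (ask 84 (inf 17271847025293083696011158225103) (ask 1
  (inf 227312743859785290571354847040120428101772) (ask 108 (inf
  9396337153514438238432524116617341536679334165286157) (ask 109 (inf
  8458279077078225816722480931095249166) (inf 27730277592560594189473198309462)))))) (inf
  7694309373545329795615357067404232882609783121)) (inf
  20057895139775644955511669467478688136))))) (inf 6198199741308051980484))) (ask 108 (ask 14 (inf
  23362770963529795) (ask 8 (ask 21 (inf 181340404044752516980736142) (ask 83 (inf
  23644250235207746) (ask 97 (ask 79 (inf 7051411641865382101978189987909) (ask 3 (inf
  106387058587455077732253904) (inf 5104054830314768294472168353795998090))) (inf
  182550547350038686053040336)))) (ask 1 (inf 26938370746025026897025043792134) (ask 114 (inf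
  878612498560828295661734904133983597429066) (ask 77 (inf
  552651909571978419944633809581804532270672) (ask 79 (inf
  1641530565379611358952210511812940027202065) (ask 97 (ask 9 (ask 101 (ask 80 (inf
  7289099757421578759442400739404) (inf 110013891387375611315028040)) (ask 110 (inf
  136216118420205019216309493038447251599070593165) (ask 180 (inf
  179056503648952813629942575839686616599384359054) (ask 177 (ask 91 (inf
  114849649981859247742976079) (ask 201 (inf 598563148058828126943984425477028549232332) (inf
  119781210472510299455714749272348733014352))) (inf
  162657442933794571983692037667463476019662))))) (inf 2798660049921807587526099051387683091))
  (inf 335179912477943862086847484331708526756242)))))))) (inf 3889203185028168223855543363)))
  (inf 26700605250952105205686717186308))) (inf 107674260840499515802839727342919)) (inf
  127877750552980326283996766996038))) (inf 246622213833686752144916676)) (inf 21110932495138883))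
  (inf 1365079046474210213954)) (inf 88252876123093671310524481))

-- Mixed questions such as 48, between β 3 and α 4, are informative for this pair of bases. Every
-- leaf is a contradiction.
two-four-tree : Tree
two-four-tree =
  ask 94 (ask 98 (ask 19 (inf 313536806978) (ask 143 (inf 16083404034345964010522976256194) (ask
  48 (inf 16162633405804494988844132794563) (ask 78 (inf 6100657975437190754092152193092) (ask 83
  (inf 94297597456294552025694277) (ask 88 (inf 1457314174196167016518) (ask 119 (ask 101 (ask 102
  (ask 128 (ask 28 (inf 6655263575646907598491987083339) (ask 7 (ask 116 (inf
  333673284613313541452529739) (ask 121 (ask 156 (inf 181346307034099560185266313) (ask 161 (inf
  1448672532821459540399096509967499658) (inf 22263447331215120714190232486160))) (inf
  225268032877609603059478025637169845633679))) (inf 2674817860684338036807))) (inf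
  639526739272475403196891332)) (inf 136453976847435711490088893642181097947530)) (inf
  615233255775096916873866473865299722831625)) (ask 28 (inf 6417730206137444608493731512392) (ask
  33 (inf 742509622265394065394217418410491974) (ask 22 (inf 763279126459854278724439572514013322)
  (ask 157 (inf 21788075944180853281491285049612) (ask 162 (inf 178923733028387432165671053) (ask
  38 (inf 21788075944180835548559158018182) (inf 42149712499336594153522373787782))))))))))))))
  (ask 22 (ask 19 (inf 317831774274) (ask 68 (ask 47 (ask 169 (ask 90 (ask 92 (ask 88 (ask 13 (inf
  339306610753) (ask 137 (inf 11567487024868284611392474251338) (ask 119 (inf
  332459654873957092693377227) (ask 142 (inf 16875697748931273789061659164932) (ask 44 (ask 64
  (inf 24207122879283271) (inf 2777900528161498957397053081053954126)) (inf
  1586443353036975046729)))))) (ask 65 (ask 17 (inf 425784901180118962740606304744964170) (ask 114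
  (ask 162 (inf 333668599284431808295600204) (ask 38 (ask 67 (ask 119 (inf 2785494384206338654287)
  (ask 143 (inf 262338489300009120180469953) (ask 44 (ask 69 (inf 386551251009) (inf
  17351073977682459655415202447442)) (inf 1660231455231720030288)))) (inf
  768466511098569706145602918893027404)) (inf 334877543460717968863920205))) (inf
  16796933818635732983711321489483))) (inf 172878993234931936552812615))) (inf
  1475761199744853278855)) (inf 11092109586268907305022957814022)) (inf
  16321092148721556944386951086341)) (inf 39406814571266116)) (inf 246622213833686752144916673)))
  (inf 38562376756232257))) (ask 19 (ask 40 (ask 168 (inf 245413269567046569997369539) (ask 44
  (ask 69 (inf 326421708865) (ask 89 (ask 97 (ask 13 (inf 21673848088952904) (ask 14 (inf
  22518333148495939) (ask 62 (ask 63 (inf 1531102276665789907014) (ask 163 (ask 64 (inf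
  11725945767748452797321482534989) (inf 1105965727673959959021930771393151053)) (inf
  11567407233642778167668105412748))) (inf 97924467146325541897109577)))) (ask 20 (ask 13 (inf
  21955323065663753) (ask 14 (inf 1494208506768516120778) (ask 62 (ask 23 (ask 58 (inf
  102762568542046578649661517) (ask 63 (inf 1586443353036970655822) (ask 163 (ask 109 (ask 113
  (inf 184968417466692799167922321) (inf 1453905790509454958145003879012106513)) (inf
  2777900845078976453573502822093750863)) (inf 6813724736102011038124578046415)))) (inf
  158912291136900369140850317277655617634380)) (inf 6496807250341674665991691960523)))) (inf
  11329797699463892292066816884872))) (ask 14 (ask 23 (inf 1475761200019730923592) (ask 73 (ask 13
  (inf 1512655250842225541189) (ask 22 (inf 763279126459854278688410762609819717) (inf
  331250710571570142529257799))) (inf 618479484993))) (inf 11329797700626054901908929314887))))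
  (inf 246622213833686752149110913))) (inf 89461820389733853466460226)) (inf
  242995381033766205677109441))

two-three-tree : Tree
two-three-tree =
  ask 194 (ask 94 (ask 98 (ask 19 (inf 317831774274) (ask 78 (inf 6021428603978659776320747143234)
  (ask 83 (inf 93088653189654374164594755) (ask 88 (inf 1438867148647480623172) (ask 183 (ask 5
  (ask 2 (inf 3763189835061209989187) (ask 7 (inf 57703194863796292) (ask 108 (ask 121 (ask 14
  (ask 22 (ask 1 (inf 1116360700667180889887865094040846541) (ask 16 (ask 77 (inf
  12122010415963942309393360355471) (ask 189 (ask 8 (res 9 (16712444361009887927957726278 ∷
  256192236830561065243526 ∷ 103893611902361086726914 ∷ 105074221537202142188418 ∷ [])) (inf
  1131937749447647946311774350227669138)) (ask 101 (inf
  22010909354331481841163755458809070687989269393) (inf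
  320077957483001691737003195858055674076332196364433)))) (inf
  2118489047463820238664757657450709390))) (ask 122 (ask 16 (inf 22104761313011000834088090927375)
  (ask 77 (ask 185 (ask 115 (ask 85 (ask 15 (inf 12359700948228067115679823102100) (res 13
  (107435440807983995425793 ∷ 106254831173142960935809 ∷ 103893629893944746709378 ∷
  105074203499713880134082 ∷ 105074221514387271717314 ∷ 103893611878996481413506 ∷ 4225 ∷ 4097 ∷
  []))) (ask 1 (inf 815197578972237994037771151834742931) (ask 116 (ask 101 (res 16
  (791025812421962255884689336181764 ∷ 796096337449260309950368170648708 ∷
  796096569668090330185152243704966 ∷ 791025889894744347625649132807174 ∷
  791025890047045314554297881469958 ∷ 796096569818030059687610658333830 ∷ [])) (inf
  17796048095557703983020783240689211825659708182)) (inf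
  140877372426545869389747662528797448536468)))) (inf 12280469158881003701981921149073)) (inf
  226628840443328763986793099271542659547792)) (inf 789235936374354554818835646828380304))) (ask
  115 (inf 2445578634248176187417511827979633103) (ask 107 (ask 119 (inf
  3452889454097193507484217709452657297) (ask 76 (ask 85 (inf 12280548948796773302637043515539)
  (ask 185 (ask 1 (inf 2051764519673292491645624162805450360272781393) (inf
  30967154452477368481612545046475984273554)) (inf
  33473536286799576298142872451034937207125247443))) (inf
  183072702684957515549973512675983364981266))) (inf
  269505083304576786208541251152885804958480))))) (inf 1105975948491364812688600445074538699))
  (inf 21787843827176842020105358868747)) (inf 1494208507094933438534)))) (inf
  1438867430435993944131)) (ask 10 (ask 107 (ask 11 (ask 109 (ask 22 (ask 7 (inf
  6734494157211863885363108315211) (ask 16 (res 3 (100351728930453186417473 ∷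
  11605856694073156712368448258 ∷ 11528415787018477527432700737 ∷
  1409638841199088984853680148726530 ∷ [])) (inf 334158385175755310400338143924677121672140)))
  (ask 122 (ask 1 (inf 203489956247691790241813963686027322917452) (ask 188 (inf
  2108089321654908626315028685415514510) (ask 21 (res 2 (179452574484044529542018 ∷
  102712984229482051146689 ∷ 24189524251521 ∷ 2720192866927256514 ∷ 103893611884494022775681 ∷
  11683235031555398511534023618 ∷ 11760528363774833620617798529 ∷ 178270847960344176894913 ∷ []))
  (inf 9099103550542644556428783593328098402770878862)))) (ask 115 (inf
  791158600856599098490967391366066289117453) (ask 7 (ask 82 (inf 356486479937) (ask 188 (inf
  1453849934423974028412543703234248976) (ask 120 (inf
  3434366485928691969698349185333912209458069648) (ask 182 (ask 1 (inf 1623355419082608607308)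
  (inf 96300377162297834816378117507848743158035)) (ask 101 (ask 1 (inf 1641784429957907349581)
  (ask 119 (inf 8741271889964746653033972388180717219646120098142037) (ask 85 (inf
  23505060642791532018099992527487861487581922326) (ask 185 (ask 178 (inf
  23506018887236213497902128463620809656963108815) (inf 493285631943946445623220002085011722))
  (inf 488093255856040177802933470709219412))))) (inf
  57692276238506659479649029607145011104871090707)))))) (inf
  268823843592267405364382791918637124420366))))) (inf 6576035413132679008220484993097)) (inf
  3836980470526450532484)) (inf 2637978135674818134146)) (inf 249042463586237867985272962)))))))
  (ask 198 (ask 20 (ask 21 (ask 22 (ask 19 (inf 335011643461) (ask 90 (ask 91 (ask 92 (ask 188
  (ask 88 (ask 13 (inf 352191512641) (ask 77 (inf 101551263056135894069215302) (ask 82 (inf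
  1567996327763162300486) (ask 109 (ask 9 (ask 1 (res 8 (272634753 ∷ 4097 ∷ 4929 ∷ 4161 ∷ []))
  (inf 1126745452845407735177197891650715728)) (ask 111 (inf
  1126750602367696258949314603551031376) (ask 16 (inf 1131948049058008161963617994492411985) (ask
  116 (ask 113 (inf 75204531948432143087664936532212105936978) (ask 182 (inf
  75204542333025705414796835614196495024212) (ask 1 (inf
  141218662134711585396415607286851525017748) (ask 110 (inf
  4996095472154693159716774052383637711505588309) (ask 178 (ask 210 (res 18
  (9081529581655319160136585994546007259489801 ∷ 12379510189513857599946109953 ∷ 402658305 ∷
  398463873 ∷ 113338470945800228709377 ∷ 4900203659869554549628800326660701282113033 ∷ [])) (inf
  5017874562495993094367224829416522230017294424)) (ask 101 (ask 80 (inf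
  193431027313189329434050703) (inf 142579812336404932461918203706672132259992)) (inf
  47835435675809308549666964921423009495518937816))))))) (inf
  270872869307212590838922662389576666448145))))) (ask 108 (ask 8 (inf
  1131952961281456479381772305525243983) (ask 119 (ask 76 (inf
  74863252660435627396786219892860063973457) (ask 101 (inf 804818135317846703920564733468868747)
  (ask 11 (inf 324466810889220100211693997018847470252235716231251) (inf
  9210435077073321456201008082383076270071873684)))) (inf
  74522959924053317574125394556658299371600))) (inf 462141596391088806940735062803939402))))))
  (ask 10 (ask 4 (inf 257505091894959591389331532) (ask 11 (ask 9 (inf
  259922980427676997157978190) (ask 114 (ask 14 (inf 4003003981939603865680) (ask 77 (inf
  1137130204789106882170754789410275408) (ask 86 (ask 2 (inf
  140540745461887741069329605361165331398802) (ask 183 (res 1 (4225 ∷ 268440195 ∷ 310383811 ∷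
  314578179 ∷ [])) (ask 7 (ask 116 (inf 1163122509539384601618403514557136981) (ask 80 (ask 177
  (inf 498478008031852713299393544286699598) (inf
  4538066038386342388432323351589484764630501794186264)) (inf
  9277425110857285451102882471151625852823666839))) (inf 1152707333287356925360826630206652501))))
  (inf 32642494995769094574202342408337)))) (inf 17193003305856542171417089998926))) (inf
  23926000094019651))) (inf 1531120291124432863297))) (ask 2 (inf
  1100783572173762879110209885889364041) (ask 7 (inf 16875853706265102353534611357770) (ask 14
  (ask 176 (ask 80 (ask 186 (inf 1121542935400376168950243590328942671) (ask 183 (ask 76 (ask 1
  (inf 365076414529) (ask 107 (inf 321535221914091234521637591969030753415378443370579) (ask 108
  (ask 117 (inf 2149633321235525149943467301493735573) (ask 78 (inf
  34967600124010253910624095857578033396101284373) (inf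
  467889402137809820722271908995167127470550))) (inf 7289099757421560745043899383886)))) (ask 5
  (inf 74522965116270923766760131788987380924498) (ask 102 (ask 15 (inf
  1147509807105339059036180894656036948) (ask 178 (inf
  4973141042524989475083144958202626328352587860) (inf
  30641298773017414570380477018043978070136390101))) (inf
  989551227354666471053142958079543681156051)))) (inf 1126735311488278894923330279090487376)))
  (inf 73161150275384457604033769174225509482574)) (inf 3105025530146060800759288290292728013))
  (inf 16955083074181754323953556586571))))) (inf 1512655250842225672264)) (inf
  114676227281671756188717500732872012923079)) (inf 6338346089812783687406366818374))) (inf
  39688293842944068)) (inf 2582564999776855654467)) (inf 168042035558735855784820802)) (ask 20
  (ask 21 (ask 22 (ask 19 (inf 335011643460) (ask 90 (ask 91 (ask 92 (ask 188 (ask 88 (ask 13 (inf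
  352191512641) (ask 77 (inf 101551263056135894069215302) (ask 82 (inf 1567996327763162300486)
  (ask 109 (ask 9 (ask 1 (res 8 (272634753 ∷ 4097 ∷ 4929 ∷ 4161 ∷ [])) (inf
  95619796841345282986497387048933519786063)) (ask 5 (ask 103 (ask 111 (inf
  804823284917506480166313315441180753) (ask 16 (inf 2139263939199944078368390057508405586) (ask
  182 (ask 1 (ask 115 (inf 34946453960538172594349748468423858733668237589) (ask 113 (inf
  54787278395681235837882140437303253402061) (ask 76 (inf
  3612796266649184972154420368061113173004779662) (inf
  1731902968687439441355584578198366733449765577162903)))) (inf
  60613957663326668912932031532562922695735968916)) (ask 1 (inf
  402563152778538996556907700523837552263252) (ask 15 (ask 116 (ask 113 (inf
  1505814180892885555302093902983005006) (ask 180 (inf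
  1733387350083867433151745812377820830362118197936280) (ask 177 (inf
  1734863146542768348760180301637202737054525567402137) (ask 79 (ask 101 (ask 210 (res 7
  (193619331658532041794754 ∷ 27762958013761 ∷ 4097 ∷ 17867621798530 ∷ 119241483092582813668673 ∷
  193619926135607000048834 ∷ 3615256568316119201454430369659219076982086 ∷
  119241519157663728932161 ∷ [])) (inf
  2431178330499745785085024207553384819265912880155103398684)) (inf
  180660787919985923372524086767185521852782871451)) (inf
  9366411666764723732292568172598520588350062746))))) (inf 5156120488676944949443111270004621398))
  (inf 337571224786636167512696723584332193333333)))))) (inf
  596860380831605236387664511240938778591568)) (inf 17192693820828269015733656289359))) (ask 15
  (ask 108 (ask 16 (ask 80 (ask 1 (inf 7209870385963066077553071882315) (ask 119 (ask 11 (res 5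
  (108616032405061659267777 ∷ 22051137516595592441832162116 ∷ 108616068451450864276161 ∷
  1675363800703832897 ∷ [])) (inf 2814277901152780277438167655268549012)) (ask 111 (inf
  206560514502915306442951891173800892104980) (ask 96 (inf 22818364838215488116684952699660) (ask
  103 (ask 110 (inf 185800979503239251845909036826929077618446) (ask 76 (inf
  55467183717884442337273930441885477568655) (ask 182 (inf
  3657616557299740232849367121707738100807435216) (inf 9491724022095220061381119068976449296))))
  (ask 101 (inf 7606017243255719559022328348752) (ask 177 (ask 10 (ask 8 (ask 2 (ask 196 (ask 201
  (inf 3425829150460308771550419389565340445777303585229076) (ask 209 (inf
  900332977772349424255998256937384919575518774755422) (inf
  9478025986214173575268955756532079804252553431))) (ask 201 (inf
  18019406386005262186600314312546135566793638676) (ask 209 (inf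
  4922435372825707921719480838884613666923022960692503) (inf
  275298596379651124333010062826314327524117)))) (inf 119685427047294042100072530)) (inf
  143264032533356506187360381311211881431322)) (inf 17905831904371668288077556416722)) (ask 183
  (ask 102 (ask 8 (inf 534587757647657553410915645208082910741007) (ask 176 (inf
  856736825517136035098561863186645141) (inf 9433989704148437887151534635661612230038587155)))
  (inf 2170397834709782658326678630266765454)) (ask 8 (ask 176 (ask 76 (ask 2 (ask 10 (ask 201
  (inf 624091350867815421367219759340384846744086) (ask 209 (res 4
  (35225059102511495964882818865666463297 ∷ 99361288555030785169757738545230923204 ∷
  27762945430465 ∷ 27488071717121 ∷ 537491669068826307895519099229761 ∷
  1516132710584457235910662419400132 ∷ [])) (inf 10857440704118608680086970422493256215))) (inf
  124521167219240710513229911)) (inf 122103315580011456458653780)) (ask 110 (inf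
  57169955919687743126363148769104914678356) (ask 196 (ask 201 (inf
  120827802512073934281350226348167949480755338006) (ask 209 (res 4 (8201552282087031804742612545
  ∷ 1181468000288486227917853773805123 ∷ 28862515779137 ∷ 28587595929025 ∷
  125144603325481883805249 ∷ 141231640808340397243504600048927270467 ∷ [])) (inf
  10857440704118608680086970422493256215))) (ask 209 (inf
  5196283246384712455700797017682343624235221784) (inf 550406839590687555977306982448497110)))))
  (ask 110 (inf 35050932258382160236126735308473068224915) (ask 196 (ask 210 (inf
  79288979580993326016599580244405853553429) (ask 209 (inf
  30887656400075830203378952913256412335028769304) (inf 550406839590687555978151407378629078)))
  (ask 79 (ask 209 (res 4 (8124179849022060421636437505 ∷ 8046727135096377130830796289 ∷
  28587633677825 ∷ 28312713827713 ∷ 123963993690365958825473 ∷ 851869017966747888174114109662721 ∷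
  [])) (inf 550406839590687555978151407378629078)) (ask 210 (inf
  550401768833544801979330944012386582) (ask 209 (inf
  10927749328595733416688333911196221863701251609) (inf
  555599215678593823690915605698249175))))))) (inf 2186035652669624422970583491604971866))))))))))
  (inf 265967701766227646199365828)) (inf 1137160549408675701438501388491882576)) (inf
  32325813261519449823177043607631)) (inf 139179590062905619609402352757220101652558)))))) (ask 10
  (ask 4 (inf 3099848365786774695592056591881535563) (ask 11 (ask 9 (inf
  259922980427676997157978189) (ask 114 (ask 14 (inf 4003003981939603865679) (ask 85 (ask 183 (ask
  83 (ask 2 (inf 140879039179190625816486009311916890652755) (ask 3 (inf
  13536822520834197526241290908960030574529675348) (ask 17 (res 6 (112157861310409430012865 ∷
  188897451582564077671490 ∷ 12302140117668191358469288897 ∷ 22283106062813635728772183106 ∷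
  1693378748927185857 ∷ 185355676720411847955522 ∷ [])) (inf
  7850023944806695719690874987434474881405419605)))) (ask 7 (inf
  1152722545324269736958168616269381715) (inf 1147514957199450657648343906863743059))) (ask 1 (inf
  6111426419143653694481319552451477650) (ask 15 (ask 7 (ask 16 (inf 268385571845444668276605013)
  (ask 116 (ask 80 (inf 5099282666598745363037452453744513791795529719415703) (ask 180 (ask 77
  (inf 34029410173922435231426886086521705463952) (inf
  1734837433653234277031955575120710266572499183534233)) (inf
  26449870734440265254590122083221955234793259160))) (inf
  39249975108155506612449621277971861301376188694))) (inf 3146579751507598325236497251392291284))
  (inf 77720850301460421033083328129674403947404264083)))) (inf
  1137130204789106882170754789410340944))) (inf 262345591368536191903203589))) (inf
  3929215598269886038092))) (inf 1106036795954714718670538743157948682))) (ask 11 (ask 114 (ask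
  109 (ask 9 (ask 82 (inf 23362697949151306) (ask 184 (inf 106387058564092384082264133) (ask 89
  (inf 7051411643082898173369627377862) (inf 108804947120735158580478156)))) (ask 7 (inf
  47538316819698102677959206043917) (ask 186 (inf 9096951477404996567972606008596234958) (ask 83
  (inf 2785500295451432452171) (inf 3120587446989429272087400343186702415))))) (ask 80 (ask 82
  (ask 183 (ask 83 (ask 14 (ask 117 (inf 32563113296134036091832923521169) (ask 89 (inf
  25896084408631362) (ask 108 (ask 2 (inf 7526787871797177604272291971155) (ask 76 (res 0 (4673 ∷
  4097 ∷ 5057 ∷ 4481 ∷ [])) (inf 26383620830085420864097815494639980416516620437))) (ask 2 (inf
  7526787871797177604272291971155) (ask 76 (inf 113640724205311093163294800) (inf
  26382967456050009674091165715590134505417343125)))))) (ask 17 (res 6 (107435422769945746870977 ∷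
  184175013023958704329538 ∷ 11992650385408305826061365953 ∷ 21973616330553661687003624258 ∷
  1621320055377629889 ∷ 180633238179673286906690 ∷ [])) (inf
  9117720981754171910885291552760464209))) (ask 5 (ask 108 (ask 14 (inf
  108701302544195201057534685676178) (ask 85 (ask 89 (ask 101 (ask 1 (ask 15 (inf
  116058612720576225750351944) (ask 177 (ask 77 (inf 55807481641650956866473570812737492549706)
  (ask 79 (res 12 (821445016851401466825816844280577 ∷ 507067822661747604186305686148097 ∷
  398463617 ∷ 394268929 ∷ [])) (inf 524434897170890128151268859901902923))) (inf
  2185549253194294913494679913480133985805402190))) (ask 103 (ask 77 (ask 95 (inf
  7922934727909222857463644094535) (ask 3 (ask 15 (ask 195 (res 14 (7737239764109805850401444737 ∷
  5009010607608905783122072856861641174692996 ∷ 2221417458441605016853033586712607784440964 ∷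
  7737240945241857423560414083 ∷ [])) (inf 5129270758959556592144463416852313510698156242)) (inf
  5106969673473466671977766893311908148279050449)) (inf
  56147769200947983232662937083940193173579))) (inf
  3612796945905442020886471050131354629255594126)) (inf 116058612720576225750417480))) (ask 77
  (ask 95 (inf 7764475984992160901920834256965) (ask 103 (inf
  5040066417015196911477677304244229462288892110) (ask 8 (inf
  9344175915830551503804850033008166738598756751) (ask 201 (inf
  56147769200947983232662882759540270956619) (inf
  9366477001316641423816806449859867221812838800))))) (inf
  32667927624664785958324672343559012614220))) (inf 114849668435921752450662466)) (inf
  113640724169281570294726721))) (inf 1660231737071764504642)) (inf 1641784711518787469377))) (ask
  101 (inf 799635900590705849267435026474336325) (ask 107 (ask 86 (ask 84 (ask 96 (res 1 (4225 ∷
  4481 ∷ 268439937 ∷ 272633985 ∷ [])) (inf 12439008903443559128949454274761)) (inf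
  7368329128843197953192900231239)) (inf 111222835654015789184385094)) (inf
  107599544683000878241742914)))) (inf 7452597478343844167875)) (inf 7434150452795157840066)))
  (inf 47300860804912240657952619495946)) (inf 10957532333968619274697))) (inf
  1512655250842225672263)) (inf 114676227281671756188717500732872012923078)) (inf
  6338346089812783687406366818373))) (inf 39688293842944067)) (inf 2582564999776855654466)) (inf
  168042035558735855784820801)))) (ask 15 (ask 16 (ask 17 (ask 19 (ask 23 (ask 3 (inf
  6259194090787317681292941787206) (ask 8 (inf 96716666599210298546192455) (ask 13 (inf
  1494226239966926798920) (ask 85 (ask 86 (ask 92 (inf 436164503601531596657714870784229451) (ask
  182 (ask 82 (ask 7 (inf 352191512641) (ask 76 (inf 1549549302214475972678) (ask 190 (ask 196
  (ask 97 (res 1 (4609 ∷ 4417 ∷ 4097 ∷ 297800897 ∷ [])) (ask 105 (inf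
  139857174357582210900404309622136857231759) (ask 10 (inf 2139243498487537171344421754801619344)
  (ask 110 (ask 103 (ask 107 (inf 7849894298559339417270338434524729833294004375) (inf
  6400345520045341936951357655113571247569698904)) (inf 1479857371133115756895559533245957001))
  (inf 4950840299315108469377540896549632137759752400))))) (inf
  792520747984360660352089662041640902789389)) (inf 95279514474424033826737134196924401582353))))
  (ask 5 (ask 7 (ask 80 (ask 190 (ask 191 (ask 97 (ask 1 (inf 17509914746618786197172942078159)
  (ask 2 (inf 12518157273256595790871210754133) (ask 11 (ask 113 (ask 76 (res 0 (4609 ∷ 4097 ∷
  18966890157635 ∷ 318772035 ∷ [])) (inf 75543827794320455575385091104603928002637)) (ask 176 (inf
  75885112289667438187048110177833190096985) (ask 201 (inf
  13603530798481761621129536935459975305136177305) (ask 208 (inf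
  4820063087320607316278280438003123563926127780433115) (inf
  86415660234553602218608543080175795301086725146))))) (inf
  1157899471424811988430399039775375569)))) (ask 1 (ask 110 (inf
  603605082586458680121652321431310175253505518928086) (ask 103 (inf
  14963874892795934657263726093185343290143212182) (inf 5140391400334494573249029004625249234)))
  (inf 205531676380911228248916344613969849221333))) (inf
  7716088124606300201361696496986217302109061459)) (inf
  73841730555851499385974763977076825194706)) (inf
  3389808209730699600092441128849398856342569105)) (inf 3910768572721199710276)) (inf
  23363041550663745))) (ask 11 (inf 16875852493502216138135628742862) (ask 108 (ask 83 (inf
  1116350638385891091147017593165643984) (ask 192 (inf 269845028167052454440416025017441327973136)
  (inf 1121543014473792636546497692438364369))) (inf 778866475545819873805669748970225807)))))
  (inf 22799808125206594)) (inf 1475761199792097591361))))) (ask 123 (ask 185 (ask 190 (ask 191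
  (ask 192 (ask 114 (ask 14 (ask 22 (ask 92 (inf 451746702467651368071016450426994766) (inf
  1586443634511947366479)) (ask 90 (ask 88 (inf 23925647902638153) (ask 108 (ask 8 (inf
  1623337404134343180430) (ask 86 (inf 804828197140952436400101107797065874) (ask 186 (res 10
  (785955132722994662322540977857796 ∷ 106254813135104687219713 ∷ 377492481 ∷ 24464427324225 ∷
  6808770568663213643355132737 ∷ 102713020276146129867777 ∷ [])) (inf
  804828355597277464929337874744082580)))) (ask 2 (inf
  9143400813227849929890832317291371450285621649) (ask 76 (inf
  52745215555577944425597511445778099077266) (ask 78 (inf 804817897606762811542774188998656148)
  (ask 186 (inf 140540075630318792758346830425792686457236) (ask 83 (ask 91 (ask 101 (ask 5 (ask
  77 (ask 85 (ask 1 (res 15 (7659864969897639421736392449 ∷ 7737235041707311501095737025 ∷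
  394268865 ∷ 390074369 ∷ 3549857222009808782413013080428254171506433 ∷
  3571635625794691888211656085106853706475201 ∷ [])) (inf
  3657442332733018303035854706160048862219534491)) (ask 1 (inf 118476445887447191796383832) (res
  16 (4943654128900452966741686248648748302350085 ∷ 75101863481223272479269567396512286210 ∷
  26938324293121 ∷ 1747415897200399681 ∷ 3549857222009823482954518054656639657584389 ∷
  7582492537967557002718615041 ∷ [])))) (inf 7526786661211126534153708503123)) (inf
  835967321011981406583529572043718808)) (inf 3568237990788658622369067449945873487460630679))
  (inf 77741583311966281157084696728124178071814737303)) (inf
  53766753232298651221678843430301644816533)))))))) (inf 3910727758853867765960))) (ask 110 (ask
  77 (inf 451736561185477109134803201459355726) (ask 78 (inf
  51383078756949948232336397985977526255760) (ask 92 (inf 462121313361289681453256782679113808)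
  (inf 10526024555903575291362487046117056431474278865)))) (inf
  1111163015982896434277217393267114189))) (ask 3 (inf 1105970639894990166528424397920141516) (ask
  8 (inf 1775772101886441204037304829071524173) (ask 77 (inf 451736561185477109116788807244709966)
  (ask 82 (inf 138158727339379797091131888758118366380234) (ask 83 (inf
  12042860836837704687395120283793) (ask 92 (inf 467323830731370226548696850174312529) (inf
  160954016507894465122440782898672477929938)))))))) (inf 758081600464011929368647162722320523))
  (inf 175295701158576901476057226)) (inf 11408949699669967933571040739465)) (inf
  742519842465029985352440482843852936)) (ask 185 (ask 190 (ask 186 (ask 191 (ask 188 (ask 192
  (ask 88 (ask 92 (ask 11 (ask 8 (inf 24207122879283267) (ask 113 (ask 13 (inf 377961316421) (ask
  177 (inf 477718724189357057677261503537152083) (ask 182 (ask 82 (inf 1697125506329088294983)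
  (ask 102 (inf 32328637001418105105819809722861735116886) (ask 7 (inf
  13559580952800119475260776587329520940310135383) (inf 4058344777110689808452)))) (inf
  6333464383602489436577171085405986394137821461)))) (inf 1464290463455899945766752044542787857)))
  (inf 1121558147359900332829478485836234959)) (ask 113 (inf 182550547344690940668870800) (ask 14
  (inf 1623337685609319891025) (ask 77 (inf 467313689449195967612483575436869713) (ask 182 (ask 82
  (res 1 (289411649 ∷ 4097 ∷ 297800897 ∷ 289412353 ∷ [])) (ask 1 (ask 5 (ask 110 (inf
  271549456739759588720351495742283601412887) (ask 3 (inf 267176646025829218758492233) (inf
  52072511251736317065740176057085388769385842968))) (inf 2144451086353630814478275528719860118))
  (inf 9187981204477366163294066819860055630258504085))) (inf
  2793462761767606275396762403009987091)))))) (ask 102 (inf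
  94603923986088266642293984058094752825615) (ask 7 (inf
  73502102458662124920304494602415472378063) (ask 13 (ask 85 (ask 86 (inf
  472516127592322555310866643414351954) (ask 178 (ask 1 (ask 5 (ask 4 (ask 20 (res 8 (4225 ∷ 4289
  ∷ 268439745 ∷ 272633985 ∷ [])) (inf 493280719720499308670866548359168088)) (inf
  4973140703229156976874137605349336237868908758)) (inf
  31987020189009995318575838873574603227221)) (inf 7130639804010707054510796439625)) (ask 105 (inf
  183072375555201999602129494044173681427017) (ask 120 (inf 820405325404670058945928547508420757)
  (ask 9 (ask 177 (ask 202 (inf 1357755694055312707485217800934804101772720701637528) (inf
  701531445771684612314386621757805938161309256057305)) (ask 202 (res 11 (25838825247553 ∷
  26113715737921 ∷ 31901943469967931437264630762587559490 ∷ 7350377598838992130428376385 ∷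
  112157825284636101580097 ∷ 110977251676942780863297 ∷ [])) (inf
  4995442467966357046031294054214076097601798361))) (inf 7526864032961643679494416695382))))))
  (inf 95622792806773629061181663549241531695378)) (inf
  269518375614880104866798279185113652265745))))) (inf
  268143263245882510606385806476999851180813)) (inf 1427933768478263410058815485503865100)) (inf
  331249511555160395296801035)) (inf 1417538875097646650721908482942304522)) (inf
  21550309246361933088860626092297)) (inf 1407154122921836439604710722169471240)))) (inf
  247831158100326934305046724)) (inf 21392686648918083)) (inf 1383544086700583026754)) (inf
  89463000999369244269346881))) (ask 15 (ask 17 (ask 19 (ask 113 (ask 13 (ask 22 (inf
  1438867148647484686406) (ask 96 (ask 88 (inf 330716676163) (ask 179 (ask 79 (ask 1 (inf
  21392373112176708) (ask 7 (inf 1512673265515613126730) (ask 109 (ask 80 (inf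
  28924421775734398232435240448081460068428) (inf 253878240631125014812557390)) (inf
  6734494156049740963763303153926)))) (ask 102 (ask 2 (inf 2087319737608481577751589789274669132)
  (ask 20 (inf 72483228395052798621977839005722502234253) (ask 7 (inf
  72821527350209431729895469097847934550094) (ask 76 (inf
  4794732699920795885584537033025840251452981327) (inf
  399497584153819675052980072964188728066127))))) (inf
  202479057587709943297177346881279968543051))) (ask 2 (inf 174086738444911724688703625) (inf
  202142757742824350315140722562986429186506)))) (inf 171670048950277085304258631))) (ask 85 (ask
  86 (ask 92 (inf 6338656786109643919260265939016) (ask 189 (ask 103 (ask 3 (ask 20 (inf
  16796468377472742811015380533452) (ask 177 (inf 441366941975566926539616280191172685) (ask 89
  (inf 180132658829987662826963021) (inf 446544185097570822957562005897281609)))) (ask 5 (ask 77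
  (inf 2656371116610628550728) (ask 82 (inf 1917914450946065409491275668211692050489868366) (ask 1
  (inf 51384075764069576736883350451875799040143) (inf
  51384402802632008742237803631766642819215)))) (inf 28585468672303631956840860973189833424972)))
  (ask 5 (ask 107 (ask 11 (ask 95 (ask 97 (ask 182 (ask 82 (ask 7 (inf
  30627183617980891293777890368209959125074) (ask 21 (ask 76 (inf 1623337404409221087310) (ask 78
  (ask 84 (res 1 (5057 ∷ 4417 ∷ 4545 ∷ 268440513 ∷ [])) (ask 1 (ask 4 (res 8 (4929 ∷ 4161 ∷ 4417 ∷
  4611724501661521156 ∷ [])) (inf 76225389464212289967336511222340083712212)) (inf
  13492547706493985365079025095324431738238795863))) (inf 1469462477597758890815345380062593232)))
  (inf 52406599941538595796161489938462169563219))) (ask 1 (inf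
  74185657980849287684767111721358285734162) (ask 7 (ask 9 (ask 76 (ask 79 (inf
  6355787246495443228697526659309641118661017814) (ask 184 (inf
  605079429388032008909673068497375795556223930270359) (ask 21 (inf
  3156964503680993009111747417315213464) (ask 80 (ask 192 (res 0 (4161 ∷ 4417 ∷ 268440131 ∷
  310383747 ∷ [])) (inf 609468283011693508176070676591368259779318156165910)) (inf
  141559614328366750498921758235533750567376))))) (inf
  13425252785036627775299330397494565279301173333)) (inf 1142322343164727046265772005993218132))
  (inf 724157560370762050989326419)))) (ask 7 (ask 21 (ask 192 (inf
  7209870385963066077540195106899) (ask 89 (ask 104 (inf
  53084848875646192560143946225827978084561) (ask 9 (inf 7368329128916984929487742697673) (ask 101
  (ask 76 (ask 80 (ask 78 (ask 90 (res 0 (4225 ∷ 4289 ∷ 268439745 ∷ 272633985 ∷ [])) (inf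
  514044836519596746032120702717132887)) (inf 835972312428529404965292679500267735)) (inf
  54786618963839260664660703822369914486868)) (inf 54105711553378656973882575424788008009941))
  (ask 180 (inf 205871969163087879017507874790723895689812) (ask 77 (inf
  503660322064539970709056734823448650) (inf 206212256722384362579545990093719434953301)))))) (inf
  111222835654015514298155203))) (inf 400521437807664689954983417558197181743186)) (inf
  23925725211918401))) (inf 9054152913821640560205770445711851392896598543)) (inf
  137815121892327127681420676056009962815883)) (inf 50705156901892690859327609001119400394893))
  (inf 2082157943592507658343307682559557708)) (inf 179672490699790256001469294439622341230731)))
  (inf 46985800243304360438395654373449))) (inf 6260046394115488597365634498631)) (inf
  16322176564626628349058451833030))) (ask 85 (ask 86 (ask 192 (inf
  26542146508035043253167543484743) (ask 182 (ask 82 (ask 7 (inf 330716676161) (ask 76 (inf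
  1457314174471044661318) (ask 84 (ask 97 (res 1 (4545 ∷ 4353 ∷ 4097 ∷ 272634305 ∷ [])) (ask 197
  (ask 10 (inf 2108089241960099565069525436219326860) (ask 103 (ask 4 (ask 23 (inf
  17271844606223928677918675370194) (inf 2822376331875417653330)) (inf
  313400838810721768734383159705233691312273)) (inf 72823515969561612855194786684893397450960)))
  (ask 105 (inf 137820433652499831595856134921686130295951) (ask 110 (inf
  34767260577530621790319300227509453536856179472) (ask 103 (ask 23 (ask 3 (inf
  17351073977682459654865454956755) (ask 176 (ask 107 (inf
  34857444943663249685859151090786967101012444309) (ask 195 (inf
  1072747085716146535586909557907290468671976897511574) (inf
  16346542873165926568015658637350780538656588246))) (inf
  335529499430852314383853056898559055168084))) (inf 2822376331875417588178)) (inf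
  334516612242631411848408411828162006621521)))))) (inf 11726176677579030247016398913736)))) (ask
  5 (ask 3 (inf 46903785481983133270195596099652) (ask 7 (ask 8 (inf 3873874803098799898694) (ask
  80 (ask 95 (ask 184 (ask 96 (ask 108 (ask 1 (ask 4 (ask 111 (inf
  17751467364700853250869963883286869248830210257) (ask 114 (inf
  663213464283730508793286197005578402595151) (ask 76 (inf
  2118667776469073353719189813674863369531555927) (inf
  597556907112157117465458757002049048478032)))) (inf
  12042454472521980787496241900313055084321702036)) (inf 1121553076759919319103945534759174220))
  (ask 1 (inf 107599544683001427989168330) (ask 109 (inf 27492279994374032502130466881995) (ask 23
  (ask 76 (inf 188596449346637511346356301) (ask 179 (inf 1817311269048435406568467322203144532)
  (ask 191 (inf 29258762134984592400801914313020234038670263576) (ask 84 (inf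
  598900107213863356645176053488070073255638) (inf 120120168808723297716065789509954358542421)))))
  (inf 3136164575253149255816467581376397454))))) (inf
  7671485953634120361028303468352995067320729745)) (inf 789246077656527946721203092827144268))
  (inf 1111158262297980101067489028740612300)) (inf 6085403769799220995593142697042837706))) (inf
  3836980470526454726725))) (inf 3800086419429082071107))) (ask 108 (ask 89 (ask 8 (ask 21 (inf
  178922515511472161258799244) (ask 14 (inf 23644250235207747) (ask 83 (inf 23362770963529795)
  (ask 97 (ask 79 (inf 6972182270406851124206785069123) (ask 1 (inf 105178114320815174749192272)
  (inf 3105010318725711649559585669855510666))) (inf 181341603083398508192137295))))) (ask 1 (inf
  47062940590946594241007466053893) (ask 21 (ask 114 (inf
  1575173157114431385445893455169462443901514) (ask 77 (inf
  73164805702763040126389778383794789155023) (ask 197 (ask 97 (ask 111 (inf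
  1464234607214469595998543027964018834) (ask 9 (ask 80 (inf 7209870385963048063141677629514) (ask
  190 (inf 17430458091221620562534714704075) (ask 91 (inf 112431761449141833384525900) (ask 177
  (ask 10 (inf 54105711538325260159297048371811404284046) (ask 110 (ask 191 (res 19
  (4900118588633847750770459271034263136384002 ∷ 1130751608485486044452190995625029 ∷
  1693378748931379905 ∷ 1675364075548184769 ∷ [])) (inf
  7894518246938369897985189737618380299323637969)) (inf
  7872217161452279977973233357805687511421026512))) (ask 101 (inf 7447558500338622137641042444365)
  (inf 162997730493091598354603067860809995846094)))))) (inf
  3463279118494040050480141124950950291))) (ask 10 (inf 32404577182370275393778871370127) (ask 104
  (inf 3125810167203663030602160034045166547) (ask 9 (inf
  161636580255903492883942878859352229610004) (ask 80 (inf 1142312439749583388124634661302042898)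
  (ask 190 (inf 3141357030104985800676771360531612435) (ask 91 (inf
  17588764511127188466789771510036) (ask 177 (ask 110 (ask 191 (res 17
  (74437239341971193477039168718542747077 ∷ 1130751608485486044451916117718085 ∷
  31902597579689289960189242073644275141 ∷ 481724327240955981276894231270469 ∷ [])) (inf
  22167016613448619722809246367189844040994129041)) (inf
  22144715527962529802410436067673715081751364752)) (ask 101 (inf
  493275569966098208124926076681257046) (inf 7134294163869433965685071093932491161)))))))))) (inf
  9091759179152536032524007972079995152)))) (inf 18048470946690566830193154443167728326)))) (inf
  41991409719656179256366691713350)) (inf 1410848548085172205741211714)))) (inf
  56887614760839077820768008143558)) (inf 77091104473319888301925047796677))) (inf
  245413269567046569988980931)) (inf 20829453223460930)) (inf 88252876123093671310524481))

three-large-tree : Tree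
three-large-tree =
  ask 88 (ask 92 (ask 13 (inf 304946872386) (ask 77 (inf 88254056732729053519347778) (ask 82 (inf
  1365079046452735508547) (ask 89 (ask 98 (ask 114 (inf 1438864052431326871622) (ask 19 (inf
  95506578631622530343043207) (inf 251460352098407055001518280))) (ask 5 (ask 8 (ask 109 (ask 21
  (ask 114 (inf 408622830007271155393167626) (ask 19 (inf 26858674721858122935360156991755) (ask
  119 (ask 1 (inf 116044698743552860354614838315243891459917) (ask 111 (ask 76 (ask 84 (ask 96
  (ask 102 (ask 95 (res 0 (268439745 ∷ 4353 ∷ 4225 ∷ 4289 ∷ [])) (ask 101 (inf
  31646732629712968946483604289289527361610) (res 2 (7040885505503951554288293121 ∷
  16867186863614701235850982723 ∷ 73108629992407384605703569220195857667 ∷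
  785950180913250330841911981516033 ∷ [])))) (inf 799625758999039533817612854226452560)) (inf
  1126760743649868156649084911178285649)) (inf 7051487804210459501148911239377)) (inf
  1105975869014161236810841595543224528)) (inf 5098974086087664499337848321431112142))) (ask 1
  (ask 115 (inf 791864088767561544610609963657010633973071) (ask 4 (ask 76 (inf 23081222972440647)
  (ask 84 (inf 107596002836362057182478411) (inf 467313689450407254597325240932761672))) (inf
  1121553076836093765250241008351969548))) (inf 464857713493088771253171346204679201299790)))))
  (inf 77406861371495871932915905921224)) (inf 252669314905244336029434117)) (inf
  26462607655108427789801550577991)) (inf 17912060966098234966596))) (inf
  16242328218426016139311486992643))))) (ask 15 (ask 16 (ask 13 (inf 313536806979) (ask 19 (ask 85
  (ask 86 (ask 89 (ask 94 (inf 343601578052) (ask 84 (ask 96 (ask 8 (inf 1494208506768516055107)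
  (ask 14 (inf 1549549583414574907462) (ask 82 (inf 103969170054174996888092739) (inf
  1438272885233675234628198192197730569)))) (ask 8 (inf 1494208506768515989827) (ask 9 (inf
  77644472112258005588350257463820) (ask 23 (ask 82 (ask 4 (inf 6972413178780226424551562674247)
  (ask 108 (inf 17192767562591540649041028710477) (ask 114 (inf
  139176604461867321956704248775670443475086) (ask 76 (ask 7 (inf 111222780289294991670771787)
  (inf 477698283243636524855039329756184654)) (inf
  193259246440759044881206027638504277192959601294))))) (inf
  1443465261321581502340962386339823882)) (inf 1185968385505125439516115405))))) (ask 108 (ask 14
  (inf 23362770963529796) (ask 83 (ask 91 (ask 8 (inf 23644250235207746) (ask 9 (inf
  1448657558336070121918485687307862095) (ask 76 (inf 6892952900128925277955964469324) (ask 97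
  (ask 113 (res 1 (103893611902361111892482 ∷ 6886144182662079590422287234 ∷
  255011663205825582731782 ∷ 16789814430621822355748430790 ∷ [])) (inf
  107646031931209043933190208468405884766118282386)) (inf
  6775974656063031923032838714033768013))))) (ask 8 (inf 23644250235207745) (ask 9 (inf
  1448657558336070121918486769626907016) (ask 97 (inf 17192767561410948746844349792333) (inf
  6770782279975125655320074515714147916))))) (ask 1 (inf 101551281520894641166155852) (ask 8 (ask
  21 (inf 12042783462393962345442400469127) (ask 77 (ask 95 (inf
  30626202258741530532491849295925371863119) (inf 78040928460463227693451459035601)) (inf
  128508490668683769402842144768912))) (inf 1567996609306858356802))))) (inf
  97925629330608673748222019)))) (inf 16480016332801609072625706074311)) (inf
  1396754000327757007705998327294526726)) (inf 91880889532649587102319045)) (inf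
  21674165916401796))) (inf 56295295994036354)) (inf 3670921492729360810113))) (ask 10 (ask 11
  (ask 13 (ask 14 (ask 89 (inf 21392416061784129) (ask 94 (ask 98 (ask 17 (inf
  95506578631622534638075976) (ask 22 (inf 2414424298567530500766096252263858244) (ask 19 (inf
  347896545348) (ask 78 (inf 6576111576621441592378561462340) (ask 83 (inf
  101552443665771009990066245) (ask 122 (ask 2 (inf 94598934178586625758352601934302263312457)
  (ask 115 (inf 726163677046079101185283956997218984396873) (ask 7 (inf
  52451000853386583852971257561552) (inf 269164463448422095785281429915052647318282)))) (ask 1
  (ask 5 (ask 2 (ask 76 (inf 23081222972440655) (ask 82 (inf 102760244211760349139042435) (inf
  103969151584631454360141904))) (inf 16955315195022647823843532669124)) (inf
  257508633782412279776673987)) (inf 9413651001689586707984075534673053448)))))))) (ask 17 (inf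
  6179749336964441309448) (ask 22 (ask 90 (ask 91 (ask 4 (inf 6655264788114556119293574185031)
  (ask 9 (inf 102760225787534544157802568) (ask 78 (ask 83 (ask 1 (inf
  456928937348337663107671705113788491) (ask 103 (inf 7051408014718983591550456954956) (ask 8 (inf
  6892952900165836780776779350152) (inf 106387058587454802858606791)))) (inf
  334499327076009995916322724964159883581386)) (inf 442710781165257038271349897409420904171082))))
  (inf 26858443811381872573423980577675)) (inf 250250245690268203733877194)) (inf
  18004116229957145985481)))) (ask 17 (ask 22 (inf 96715485986478691598008520) (ask 95 (ask 96
  (ask 3 (inf 175295682711551352798183563) (ask 8 (inf 1512655250842229997644) (ask 84 (ask 108
  (inf 1105991239298240724614786695999980110) (ask 76 (res 0 (276828545 ∷ 4097 ∷ 4417 ∷ 4225 ∷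
  [])) (inf 2555532642490875864114887323188579923134919))) (inf
  52371771481927386623925700463114)))) (inf 8942625368359262552787207181175880224783011018)) (inf
  1080008838684830268049963300302293385))) (inf 36683040608841579691449222497735)))) (inf
  246626954700957715666043012)) (inf 2527223641638640287875)) (inf 6050605521433429803330)) (inf
  2490329590532677828737))

three-four-tree : Tree
three-four-tree =
  ask 189 (ask 89 (ask 97 (ask 14 (inf 20829457518428226) (ask 77 (inf
  6021429814085089026340720541762) (ask 82 (inf 93088671654413121261535299) (ask 88 (ask 92 (ask
  13 (inf 330716676162) (ask 114 (inf 1475757540574450810952) (ask 19 (inf
  97924467164339936115753033) (inf 253878240631124460782747848)))) (ask 192 (ask 5 (ask 15 (ask
  108 (ask 109 (ask 13 (inf 77125243134935241) (ask 19 (ask 8 (ask 1 (ask 110 (inf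
  30286241824287697526828451479393267482703) (ask 120 (inf
  270187299183590751464210028324194500674320) (ask 76 (inf 360781447235) (inf
  13425165667766057199657715801533730224387850834)))) (inf 103076171914324681643458317320908))
  (ask 1 (inf 22026381831714690991006518280268) (ask 104 (inf
  1453865066900262660283728123109572880) (ask 9 (inf 1459057443296440289631739891334054161) (ask
  113 (res 1 (1105408036067687150069859659822214 ∷ 21741651334595402711284323208 ∷
  6963516615763078945909511298 ∷ 61356335869145912629690119064 ∷ [])) (inf
  86237512867594964459748274594475052408100491025)))))) (inf 5128344316803413377354))) (inf
  6655264784591209985991890108490)) (inf 330046470408472190978818374)) (inf
  946593879007565389970473286)) (inf 21674440802697284)) (ask 5 (ask 108 (ask 16 (ask 109 (ask 19
  (ask 8 (ask 1 (ask 76 (inf 347896545345) (ask 178 (inf 1586443634511947300931) (ask 83 (inf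
  6892952900165836780776771027081) (inf 22184221595167142539717381390599)))) (inf
  52290763777064892705807645737163)) (ask 9 (inf 5431164382570697165761864866829304846) (ask 113
  (res 1 (1090195996747649256380395675464646 ∷ 1095266676518635190640754479346566 ∷
  6731399316568164796595180482 ∷ 103893611901811385439106 ∷ [])) (inf
  5109236985348311725676752391813727182)))) (inf 23926000089825413)) (inf
  101552443643534770306285642)) (inf 58547130167459971)) (inf 328846971018912940492456517)) (inf
  7323468299503040266436)))) (inf 1069639456928499420964960772697555140))))) (ask 197 (ask 20 (ask
  21 (ask 14 (inf 21673895333462084) (ask 23 (ask 85 (ask 86 (ask 182 (ask 82 (ask 7 (inf
  339306610753) (ask 76 (inf 1494226240241804574789) (ask 114 (ask 5 (ask 107 (ask 108 (ask 176
  (ask 178 (inf 133017165755520666277183731733322401877479375307473) (inf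
  96302698164470719931271415716082474614864)) (inf
  6288905429145117677117051245432869718135144527)) (inf
  11953229032084317144818443278933251291043070095)) (inf 1448672770607499508406069118999396430))
  (inf 94599931135236061413169058408077868793933)) (ask 105 (inf
  3110233119818295484658763906861369796) (ask 110 (inf
  17662459032367888946742000243226236634345570509) (ask 3 (ask 4 (ask 176 (inf
  1464249898251040601977036646690259025) (ask 78 (inf
  154767746432452096560847926259614809876599736017) (ask 83 (ask 191 (ask 15 (inf
  20996018806014384435806410858553626842873301337574933) (ask 178 (inf
  267176645996837287567097989) (ask 91 (ask 115 (inf
  17863103799845617735190308195464177395878985944) (ask 107 (inf
  33724549205187108856952323914160803608464291429553816) (ask 13 (inf 117267575408064783750463635)
  (inf 1923366886406256116325374622163277891458381611794777)))) (inf
  360405620143574189316443871191756807973847240662)))) (inf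
  154812348603424276392670748368761657420170594003)) (inf
  86260772547128267569504586722741626859049059283)))) (inf
  51961528525924922113778193426040460393880945231)) (inf
  9092032834617357531771806144925013638))))))) (ask 5 (ask 4 (inf
  21867304104629118030958846738507) (ask 109 (ask 9 (inf 336086469231356497539432525) (ask 80 (ask
  1 (inf 1459057522859499181932010493830365262) (ask 76 (res 0 (4225 ∷ 4097 ∷ 297800644 ∷
  301995012 ∷ [])) (inf 95620793777554393114280874326798709030992))) (inf
  4112361704085459882827667481394020557))) (inf 22025762854629985571555684581451))) (inf
  22518878617731137))) (ask 1 (inf 1427903265713077277874222183171424328) (ask 109 (ask 88 (ask 8
  (ask 192 (ask 9 (ask 16 (inf 5165160399336523300943) (ask 13 (inf 373666349125) (ask 180 (inf
  1464249898481947425826677880466767953) (ask 77 (inf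
  29169819133885752551114719233217799356519743825) (inf
  444755829535253657184568244021244316942674))))) (ask 101 (inf
  1459057522240514994613410982223347790) (ask 103 (inf 95963402308759198472770127151912771387471)
  (ask 111 (inf 96302692931846726659011402081462433415248) (ask 16 (ask 177 (inf
  1490799786712827938351664910757535618368594) (ask 178 (inf
  184437170769495071645106919556553793863827) (ask 179 (inf
  6778483755038204895420613914726017720532695438263444) (inf
  5805076307353872643934164904697332117)))) (inf 445101428875005556563460112732457613787473))))))
  (inf 10753329509486997157333385309407805964)) (inf 21946302570093975470842008830028)) (inf
  4096906272138690900424179503015067850)) (inf 21867304116435362156476574597193)))) (inf
  97924448720973832705474887)) (inf 6338347299919212937426340282694)) (inf 57984446502011013)))
  (inf 3763192649291285921923)) (inf 245415649197313557788622978)) (ask 20 (ask 21 (ask 14 (inf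
  21673895333462083) (ask 23 (ask 85 (ask 86 (ask 119 (ask 19 (ask 94 (inf 356486479937) (ask 182
  (ask 82 (ask 3 (inf 6893106434888630475397039063115) (ask 7 (inf 106387003223860167248707657)
  (ask 113 (inf 789235936376772406457501667469819982) (ask 76 (inf
  467313531067826350577568004440719435) (inf 727186533611440102418717879022012921741903))))) (ask
  8 (inf 2777900686620246559913432315519959116) (inf 82872992876890190019560816771404))) (ask 8
  (inf 181340404044752791854514313) (inf 326183607246782682964446700308299)))) (ask 91 (ask 88
  (ask 92 (ask 182 (ask 82 (ask 7 (inf 360781447233) (ask 108 (inf
  30285914709744298276196062026203623129167) (ask 13 (inf
  95961413669282735222153624781946945667344) (inf 467334051320286827572933594456850512)))) (ask 11
  (inf 95622117853817826809212780859266924150990) (inf 1453885507790365116007852699959099470)))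
  (ask 110 (ask 15 (ask 11 (inf 357307238758913846027812449001209600607951) (ask 111 (ask 8 (ask
  16 (ask 77 (inf 140879039214527364336563221953944100733523) (ask 84 (ask 96 (ask 1 (inf
  12154090917309073711936661924727299208129676502) (ask 178 (res 4 (7427750031885948840398824193 ∷
  32234255539593925487187732672928551938 ∷ 1711387100152075073 ∷ 1729401223787844353 ∷
  1729407271089214209 ∷ 1711393147461833537 ∷ [])) (ask 101 (ask 76 (ask 80 (res 0 (4097 ∷ 4161 ∷
  4417 ∷ 4481 ∷ [])) (inf 524429826417376402384848762578665554)) (inf
  33688457985495129585082913834224486711378)) (inf
  84966939010798808976839454022171857282533491672)))) (inf 7526866450813282908203018485838)) (inf
  7526864032961643678936079138892))) (inf 61361819805155528)) (inf
  5462379489111187280247079725821396945)) (inf 5784393082471179471604928893348807056))) (inf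
  60235919898247364)) (inf 784058851168280274626256199280361549))) (inf 5128344316528539402571))
  (inf 1106006372108191941915943836777382474)) (inf 333673284599518789401379145))) (ask 90 (ask 92
  (ask 183 (ask 83 (ask 7 (inf 23081222972440643) (ask 108 (inf 102760244211760624016949383) (ask
  13 (inf 103969188496133450532847752) (inf 259922961962917975191388549)))) (ask 5 (ask 4 (inf
  2795465280008219400987701195767187549585933) (ask 107 (ask 9 (inf
  179455220278099939073820467921423) (ask 80 (ask 77 (inf
  74863917279424507240400912473446599753937) (ask 178 (inf
  1055259619773336256927851902765900493423570) (ask 82 (inf 1817341614051248246670649078974513235)
  (inf 1474154493238631153482354178186332183994507840253850292947)))) (inf
  2491891885764971788991541601535750291659728))) (inf 1420520102218290879891964494))) (inf
  489625933031370449257300172))) (ask 5 (ask 109 (ask 182 (inf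
  1121583500836162793919281408189792653) (ask 88 (ask 116 (inf
  21403541907843166860121668168523975247) (ask 9 (ask 101 (ask 1 (ask 76 (inf 373666349121) (ask
  179 (inf 113640724169562946487255108) (ask 84 (inf 493275569889938722340991097414942922) (inf
  7606017242093581719248761454676)))) (ask 110 (inf 11123440719925860368965) (ask 180 (inf
  10789757353444851356884318698584081876) (ask 77 (inf 728998078249423251829817604) (inf
  5477956614897730508208323194461159509))))) (ask 13 (inf 386551251012) (ask 77 (inf
  111223997798892707755655243) (inf 164559402106146911871618957641171)))) (inf
  10774585796622113187815206270445947600))) (inf 17193235426697452838257001431246))) (inf
  164085418639061184124215145663820)) (inf 488459490711601041614375371))) (inf
  5091882612644661822921)) (inf 21790239925198121946090039215560))) (inf
  97924448720973832705474886)) (inf 6338347299919212937426340282693)) (inf 57984446502011012)))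
  (inf 3763192649291285921922)) (inf 245415649197313557788622977)))) (ask 10 (ask 11 (ask 13 (ask
  14 (ask 88 (inf 322126741570) (ask 17 (inf 94297634365264102336626759) (ask 22 (ask 2 (inf
  6417576672558353550588543828040) (ask 7 (inf 99133393005628683953766473) (ask 90 (ask 183 (ask
  83 (ask 107 (inf 16955079444729513648754243600589) (ask 8 (inf 23644250235207746) (ask 76 (inf
  103969170054174996888092741) (inf 7087501930921008030004829699956998601)))) (ask 1 (inf
  28925101992134816992914877346288536977486) (ask 107 (ask 76 (inf
  29605999012613520015375773418659018113104) (ask 77 (inf
  117057580790421077082960330811392842793297) (ask 86 (ask 101 (inf
  9165680120964332095937720666027593721820479890) (ask 176 (inf
  31306445075486622354820884836207035154515) (inf 335191211088467281315206241116412137243022)))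
  (inf 444069937606086709092031136936650225812754)))) (inf
  446554405997189992644097873451548751)))) (inf 1095586205565131647290581949836886220)) (inf
  1095585887719177631140050440525512906)))) (ask 122 (ask 117 (inf 3855387526087286456522) (ask
  185 (ask 78 (inf 72141943929891743517481694123579951743179) (ask 79 (inf
  952644503438481184205766917) (ask 82 (ask 186 (ask 183 (ask 83 (inf
  1126760585424455043215683775996887248) (ask 84 (inf 958689224770274698627383562) (ask 7 (inf
  4127938593712043448789732911026405581) (inf 4122746375462690490261793888969491411)))) (inf
  259920619226423367144308944)) (inf 72821527299661710493326228694724093214991)) (inf
  1105965807136653824002748926055350478)))) (inf 16638165587185467803025824481483))) (ask 19 (inf
  22799747995926602) (ask 77 (ask 185 (ask 178 (ask 78 (inf 446549176549181654693816185072648269)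
  (ask 79 (inf 5128254526285833896134) (ask 2 (inf 5072931464038284722250) (inf
  8094853235198077929814975790545766096)))) (inf 720521301267457849705103949)) (inf
  47141473598719894246665985655372)) (inf 10392174486511757820148750041565208966720979403)))))))
  (inf 93088671636398473643819076)) (inf 246629315902213823880233155)) (inf
  1383526354051932356674)) (inf 89461838872507273959178305))) (ask 10 (ask 11 (ask 13 (ask 14 (ask
  88 (inf 317831774274) (ask 107 (ask 7 (ask 16 (inf 1438867148647484686403) (ask 21 (inf
  97924448720973557835890761) (ask 95 (ask 82 (inf 335011643460) (ask 188 (inf
  178922515511472436128514188) (ask 94 (ask 98 (ask 116 (inf 60235919906701382) (ask 121 (inf
  4112316067969904634151901298883625168) (ask 1 (inf 1567996327763162562640) (ask 19 (inf
  107595984383707030437167184) (ask 180 (inf 794448515644913246939979025136222668) (ask 185 (inf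
  90519060284358972563157838224552744311784408008) (ask 78 (inf 7368405291206751370367488688203)
  (inf 10774423534869403895718903665377156110)))))))) (inf
  137815121887256602654121469084206803779918)) (inf 180131459778112339128156229)))) (inf
  16558936216907528445971830735178)))) (ask 80 (ask 183 (ask 184 (ask 102 (ask 2 (ask 15 (inf
  177713571244831983397830792) (ask 176 (inf 34744633285871742893208193779987147682115683854) (ask
  186 (inf 269167449079649298531838163000640192119567) (ask 83 (inf 257505091894959050223910991)
  (inf 21381961183858412559535475363663841289))))) (ask 76 (inf 57984669840441414) (ask 179 (inf
  137816451160729643004841971313990422888654) (ask 83 (ask 91 (ask 84 (inf
  530848582240067564419615966485878173140305) (ask 188 (inf 2793558945142577804696554365801922898)
  (ask 3 (inf 1801749193901067427142508624430235847) (ask 20 (inf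
  74864244389135117926878224168643063513681) (inf
  13447815545663769469271587954895978638191755534))))) (inf
  1767790602028705911860508433125288804010281530474657298896)) (inf
  489625933031369899497488904))))) (ask 90 (ask 95 (ask 91 (ask 188 (inf
  784063763469108975692105660404334735) (ask 98 (ask 83 (ask 103 (inf
  73162811815449693229176058019975732527436) (ask 8 (inf
  117061568535255196404574750089346129003021) (ask 76 (inf 108804947120735708331966536) (inf
  531184882054685444910531562157265380050449)))) (ask 8 (ask 9 (inf
  27413051829480138179578146914508) (inf 57692297673959393874600488986892628740803461203)) (inf
  462121392642644618168818863337898062))) (inf 290943194337851849607289910488939268670096))) (inf
  94695046674320961283832560991858473263031849102)) (inf
  4727829442465590073734304634495573284505584205)) (inf
  17576129056574637657366588119678573699255567116))) (inf 21708845380601958011354432602186)) (inf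
  1457368500009133146306)) (inf 6338347303479524615919721578568))) (ask 80 (ask 83 (ask 184 (ask
  186 (inf 158573987065348151159775834278574141407690) (ask 91 (ask 8 (inf 22799812420173892) (ask
  76 (inf 100342337254254188427280450) (ask 102 (ask 2 (ask 115 (inf
  8089615224384909440776927215085813898) (ask 20 (inf 7051411641865382101978190053457) (ask 84
  (ask 96 (ask 108 (ask 109 (inf 1697118469467555823690) (inf 12438930319686615826924520472781))
  (ask 19 (inf 12359703366116617847484105031882) (inf 12438930319686615826924520472781))) (inf
  17272000560034289231515965587795)) (inf 6448875086011562400515360294869403338)))) (ask 3 (inf
  5425972006482790898049382680348722184) (inf 5098852233172515718606814962684133450))) (ask 103
  (inf 2762323638206073420009514221881852423) (ask 17 (ask 179 (inf
  57625219863280675727251180271693830031589968397) (ask 84 (inf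
  228917505446229556567428092148517724610603001870) (ask 5 (ask 21 (inf
  7289175918586051590038204711121) (ask 77 (ask 185 (ask 85 (ask 1 (res 2
  (31569626336625487038276791991986557889 ∷ 31901938406096893238539702000106345793 ∷ [])) (inf
  17509687462661740543288164745429)) (ask 4 (res 3 (31569626336625483495294965139617354691 ∷
  110977215646771372364609 ∷ [])) (inf 32668254729304928445206562126736812671253))) (inf
  75205206947023703048080519599075730587853)) (inf 108804928650065720436916306))) (inf
  264758757499587464043430081)))) (inf 37327768436253863724030844303166544904)))))) (ask 191 (ask
  17 (ask 76 (inf 9408463618675688316627289490160091400) (ask 3 (inf
  21947151246607902142920036384837) (inf 5420779709004062957696968951282861324))) (inf
  14499289461822935138627)) (ask 17 (ask 84 (ask 94 (inf 103969188496133729706246223) (ask 3 (inf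
  103971512808686756523343947) (ask 194 (ask 22 (inf 186177361715037107846578258) (inf
  1126755672970093630217878027580604882)) (ask 22 (inf 650411960104865397918859730) (ask 76 (ask
  95 (res 0 (4929 ∷ 4161 ∷ 268439617 ∷ 4481 ∷ [])) (inf 17351229930312246602968468685140)) (inf
  335520864560048660095252460018631421788489)))))) (inf 42650907116356582359860694379580122123))
  (inf 57001020156512504448835))))) (inf 143325930569447873583238705513673)) (inf
  6341132725237827734519804985416)) (inf 36683196572097105276799186698695)))) (inf
  246624593499701607451852996)) (inf 245420371635573641724297411)) (inf
  398951571132392806371295554)) (inf 242997760699781060984045761))

four-large-tree : Tree
four-large-tree =
  ask 88 (ask 92 (ask 13 (inf 304946872386) (ask 77 (inf 165624128578429929906045058) (ask 82 (inf
  1365079046452735508547) (ask 89 (ask 98 (ask 114 (inf 94297634347249433248596102) (ask 19 (inf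
  95506578631622530343043207) (inf 174087919033435671895343240))) (ask 5 (ask 11 (inf
  405010247151468544752426455778328647) (ask 8 (ask 109 (ask 21 (ask 114 (inf
  409831755827167263839617291) (ask 19 (inf 26937904093298206887582875713804) (ask 111 (inf
  5431326562618159661425801468796603662) (ask 119 (ask 1 (inf
  21922620033006233501799256959780050240331845199) (ask 3 (inf
  171807039205281028977002487490567375231975623950) (ask 16 (res 0 (6886220919982519116076430401 ∷
  6963590991864248239705306241 ∷ 24189524251713 ∷ 23914684093569 ∷ 180633256176754492458050 ∷
  106254813152422003745921 ∷ [])) (inf 44934416419609841143927509765882815316972718344909839))))
  (ask 1 (ask 115 (inf 73842390002827267379796620726454991388941) (ask 4 (ask 76 (inf
  7051408014718983591576227348562) (ask 84 (inf 110013891369642412904415309) (inf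
  477698441626219826915778826447618121))) (inf 357307233566378042002565787347191447028754))) (inf
  530960232341489158745514982675457682268176)))))) (inf 102839412232528812004494312734985)) (inf
  253878259171884518185369862)) (inf 16400322732647716177040764109000))) (inf 21111757141442627)))
  (inf 26383687765117981294601097576707))))) (ask 15 (ask 13 (inf 309241839682) (ask 19 (ask 85
  (ask 86 (ask 89 (ask 94 (inf 339306610756) (ask 84 (ask 96 (ask 8 (inf 1475761481219829792835)
  (ask 9 (inf 1531102557930312958019) (ask 14 (inf 1549549583414574972999) (ask 82 (inf
  22025762852250243277260836700420) (inf 1770579884257276635901389520656269642))))) (ask 8 (inf
  1475761481219829727555) (ask 9 (inf 26858677130541748092070873137355) (ask 23 (ask 82 (ask 4
  (inf 6893183807321695446780157755463) (ask 108 (inf 22184217964497439274463106957389) (ask 114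
  (inf 269505078142703752429941042425477039063501) (ask 76 (ask 7 (inf
  110013836022936288786513995) (inf 804812906179330477841859316351172686)) (inf
  343098715345162206368215348452179906295816013646))))) (inf
  1770579884257276635901389516545851722)) (inf 1571621606491284583131316940))))) (ask 9 (ask 14
  (inf 23081291691851844) (ask 23 (inf 178922515511472436128383108) (ask 97 (ask 111 (inf
  3099807801278265773540044216876729031) (ask 8 (ask 79 (inf 6972182272768070394988390973509) (ask
  121 (ask 1 (inf 444414197231599013626377807145242586317073) (inf
  51963444650616872102568356646124351902206658577)) (ask 1 (ask 76 (inf 360781447233) (ask 83 (inf
  7051411643082862144572616933522) (inf 7130641014504499352721625841746))) (inf
  343105684147262388799079658824411794083773351953)))) (inf
  12077304363042709844249548106213231368))) (inf 23981042579449172787916)))) (inf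
  26779525135058222456216339152962)))) (inf 26542146508035043250143886574150)) (inf
  1723878764468256328302892164871096261)) (inf 90673125875644800040043204)) (inf
  21392961522630851))) (inf 4851513113446772113601))) (ask 11 (ask 13 (ask 14 (ask 89 (inf
  21110936790106177) (ask 94 (ask 98 (ask 17 (inf 94297634365263831753818183) (ask 22 (inf
  2409231922479624214606869459506430020) (ask 19 (inf 343601578052) (ask 78 (inf
  6496959577595975586265136431172) (ask 83 (inf 100344680008766222927790149) (ask 122 (ask 1 (ask
  2 (inf 159933148627406810743320526843230800052298) (inf
  529821078472672685048307477131965906683401)) (inf 856151863132124751492724047965490679974344))
  (ask 1 (ask 5 (ask 2 (ask 76 (inf 22799747995729999) (ask 82 (inf 101551299945401646254784643)
  (inf 102760207318272751475884112))) (inf 11805328676604495971100796321924)) (inf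
  333673303208392999452147971)) (inf 13063840684999462150462710166977710536)))))))) (ask 17 (inf
  6161302592890731757831) (ask 22 (ask 90 (ask 91 (ask 4 (inf 6576035416656025141522169266247)
  (ask 9 (inf 101551281520894366296834120) (ask 78 (ask 83 (ask 1 (inf
  451736561260431395395188986065911883) (ask 103 (inf 6972178643278899639327738298444) (ask 8 (inf
  6813723528707306084480351142024) (inf 22104992223708611843420953248519)))) (inf
  443049397108884904735837432227314826491338)) (inf
  1204607980240613357804138691978959723761738)))) (inf 36920419244110396359882775397770)) (inf
  326413734488599683852796617)) (inf 23888627307995520434888)))) (ask 17 (ask 22 (inf
  95506541720119988713750727) (ask 95 (ask 3 (inf 172877794178270997076181129) (ask 8 (inf
  1475761199744857407562) (ask 84 (ask 108 (inf 1427923627350830235724335658008183564) (ask 76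
  (ask 1 (inf 101551226158425351416971342) (ask 104 (inf 6813721109324551349520065691727) (ask 9
  (inf 451736561186688433067176755368100040) (inf 6972182270425333897077522104392)))) (inf
  5420779630392452611508153120838648070))) (inf 5083437364805792087534751109530321227)))) (inf
  1407128532222926314527995592624508616))) (inf 26462451693052302828620065342534)))) (inf
  245420371635573641720103171)) (inf 2508776616085663252610)) (inf 19985840054730817))

-- The gaps up to the factors 5 and 6 refute every branch, so no exponential equation remains when a
-- ≥ 5.
large-large-tree : Tree
large-large-tree =
  ask 88 (ask 92 (ask 13 (inf 304946872386) (ask 77 (inf 165624128578429929906045058) (ask 82 (inf
  1365079046452735508547) (ask 89 (ask 9 (ask 21 (ask 1 (ask 5 (ask 76 (inf
  96715449092990544174907465) (ask 84 (inf 425774680747157002216999596048121925) (inf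
  430967056835063251482737966508605508))) (inf 70779801979373690502332482376356799513030)) (inf
  1074821691581909193029290789833998405)) (ask 1 (ask 5 (ask 19 (inf 97924467146325554782273673)
  (ask 76 (inf 97924393359349251354198090) (ask 97 (inf 436174565654331814447284010539483468) (inf
  2344142895688346635279336649)))) (inf 985472761734863016785613040735578185078854)) (inf
  15031928615255045814301330953885386949))) (ask 1 (inf 6259117928479164732250785906755) (ask 11
  (inf 1401926173542511208702096463356100871) (ask 8 (inf 752894295134460551008220277805220105)
  (inf 6724050816727113210437721811914654984))))) (inf 36525047311809946449890737520899))))) (ask
  15 (ask 16 (ask 13 (inf 313536806979) (ask 19 (ask 85 (ask 86 (ask 89 (ask 94 (inf 343601578052)
  (ask 82 (ask 7 (inf 335011643457) (ask 14 (inf 6576035414331677966794039230597) (ask 76 (inf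
  1494208225568417251399) (ask 96 (inf 6813723528670376567265325940932) (ask 23 (ask 10 (inf
  94601919759500852853691842164882630181132) (ask 3 (inf 17192615234765397699322645184712) (inf
  791894993790028870844743360659301851428488))) (inf 2347762644920528740758389966)))))) (ask 11
  (inf 31771904013207806080026256277834) (ask 8 (ask 21 (inf 180131459778112339119767684) (ask 14
  (inf 23925729506885702) (ask 83 (inf 23644250235207747) (ask 97 (ask 1 (inf
  105178114320815174749126735) (ask 79 (inf 30626866872739577736475023044955269759183) (inf
  117746790708674958783601181861266915198161))) (inf 2348978672754907346723079375))))) (inf
  331254234065477252923064514))))) (inf 36762735426185539383204876912007)) (inf
  732129861230494884235640838950290566)) (inf 91883250751920368699704517)) (inf
  21674715672215812))) (inf 92324093013000450)) (inf 6032104734164183417089))) (ask 10 (ask 11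
  (ask 13 (ask 14 (ask 89 (inf 21392416061784129) (ask 83 (ask 91 (ask 7 (inf 21110898135531592)
  (ask 8 (inf 21955374605140035) (ask 76 (inf 96715504454333654844375107) (ask 84 (ask 2 (ask 20
  (inf 6734494156031258190892570312776) (ask 19 (inf 23925647902703687) (ask 96 (inf
  11963554090935431648871094550729) (inf 153861966878313406410768234185935)))) (inf
  26114570419643362246946597204746993339654996044)) (inf
  1427928539574280914289989579375640971))))) (ask 7 (inf 21110898135466376) (ask 17 (ask 84 (ask
  94 (inf 99133411412684519659470923) (ask 3 (inf 176504626978191530659086476) (ask 76 (ask 22
  (inf 103969151584630913198915854) (ask 1 (inf 102760170424784058596065359) (ask 9 (inf
  105178077404245555254067280) (ask 95 (inf 462121313362500968438098448166813956) (inf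
  10093948372421199935269367763262120977))))) (inf 12056545078350315337467971642346574733)))) (inf
  1422736163486374646577225376761059658)) (inf 6161287956187643512009)))) (ask 7 (ask 16 (inf
  1438867148647484686408) (ask 21 (inf 97924448720973557835890756) (ask 95 (ask 82 (inf
  335011643460) (ask 94 (ask 1 (inf 1494208225568417251404) (ask 78 (ask 19 (inf
  103969151584630913194262605) (inf 451751693994212944256483435923964173)) (inf
  557096882666576457068499665899093393566687628750))) (inf 37079032725990507150031320254476)))
  (inf 153465820021020733507512700044490)))) (inf 2601084084568855675009)))) (inf
  91882088571014399697879172)) (inf 2527223641638644482179)) (inf 20267594208510018)) (inf
  1309810028508832858177))

-- The case distinction on the bases

unrelated-separates : ∀ f g γ →
  (∀ i j m → γ left i ≤ proj₁ (f m) * γ left j ⊎ proj₂ (f m) * γ left j ≤ γ left i) →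
  (∀ i j m → γ right i ≤ proj₁ (g m) * γ right j ⊎ proj₂ (g m) * γ right j ≤ γ right i) →
  Separates (unrelated f g) γ
unrelated-separates f g γ l r left  left  i j m = l i j m
unrelated-separates f g γ l r right right i j m = r i j m
unrelated-separates f g γ l r left  right i j m = inj₂ z≤n
unrelated-separates f g γ l r right left  i j m = inj₂ z≤n

-- Powers of 4 are powers of 2, so here powers of the two bases can be compared with each other.
2-or-4 : Bool → Bool → ℕ → ℕ × ℕ
2-or-4 right right = exact 4
2-or-4 _     _     = exact 2

2-or-4-separates : ∀ x y → Separates 2-or-4 (powers 2 4 x y)
2-or-4-separates x y left  left  i j m = separate 2 m (x i) (x j)
2-or-4-separates x y right right i j m = separate 4 m (y i) (y j)
2-or-4-separates x y left  right i j m =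
  subst (λ z → 2 ^ x i ≤ 2 ^ m * z ⊎ 2 ^ suc m * z ≤ 2 ^ x i) (sym (^-*-assoc 2 2 (y j)))
    (separate 2 m (x i) (2 * y j))
2-or-4-separates x y right left  i j m =
  subst (λ z → z ≤ 2 ^ m * 2 ^ x j ⊎ 2 ^ suc m * 2 ^ x j ≤ z) (sym (^-*-assoc 2 2 (y i)))
    (separate 2 m (2 * y i) (x j))

module Solution (a b : ℕ) {N D : ℕ} (a>0 : 0 < a) (b>0 : 0 < b) (D>0 : 0 < D) (x y : Fin 5 → ℕ)
  (h : (i : Fin 5) → N + toℕ i * D ≡ a ^ x i + b ^ y i) where

  γ : Pair
  γ = powers a b x y

  Holds : List Eqn → Set
  Holds = All (Solves (env D γ))

  progression-holds : Holds progression
  progression-holds =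
    next 0 (h 0F) (h 1F) ∷ next 1 (h 1F) (h 2F) ∷ next 2 (h 2F) (h 3F) ∷ next 3 (h 3F) (h 4F) ∷ []
    where
    next : ∀ i {t t′} → N + i * D ≡ t → N + suc i * D ≡ t′ → D + t ≡ t′
    next i refl refl = lemma N D (i * D)
      where
      lemma : ∀ N D k → D + (N + k) ≡ N + (D + k)
      lemma = solve-∀

  first : N ≡ a ^ x 0F + b ^ y 0F
  first = trans (sym (+-identityʳ N)) (h 0F)

  positive : ∀ s i → 0 < γ s i
  positive left  i = m^n>0 a {{>-nonZero a>0}} (x i)
  positive right i = m^n>0 b {{>-nonZero b>0}} (y i)

  eliminate : ∀ {G : Set} gs → All (λ es → Holds es → G) gs → Any Holds gs → G
  eliminate (g ∷ gs) (f ∷ fs) (here p)  = f p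
  eliminate (g ∷ gs) (f ∷ fs) (there p) = eliminate gs fs p

  -- At each use the check of the tree is evaluated by the type checker, and the underscore in its
  -- place is the trivial proof of `T true`. The equations in `init` allow a leaf of one tree to be
  -- split further by another tree.
  conclude : ∀ {G : Set} F gs init t → T (Certificates.check gs (question F) (rows (init ++ progression)) t) →
    Separates F γ → Holds init → All (λ es → Holds es → G) gs → G
  conclude F gs init t ok separates initial handlers = eliminate gs handlers
    (Certificates.Soundness.sound gs (question F) (env D γ) (env-positive {D} {γ} D>0 positive)
      (question-sound D γ F separates) (rows (init ++ progression)) t
      (rows-sound (env D γ) (init ++ progression) (++⁺ initial progression-holds)) ok)

  exact-coarse : ∀ c → c ≤ b → Separates (unrelated (exact a) (coarse c)) γ
  exact-coarse c c≤b = unrelated-separates (exact a) (coarse c) γ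
    (λ i j m → separate a {{>-nonZero a>0}} m (x i) (x j))
    (λ i j m → coarse-separate b {{>-nonZero b>0}} m (y i) (y j) c≤b)

  exact-exact : Separates (unrelated (exact a) (exact b)) γ
  exact-exact = unrelated-separates (exact a) (exact b) γ
    (λ i j m → separate a {{>-nonZero a>0}} m (x i) (x j))
    (λ i j m → separate b {{>-nonZero b>0}} m (y i) (y j))

  coarse-coarse : ∀ c c′ → c ≤ a → c′ ≤ b → Separates (unrelated (coarse c) (coarse c′)) γ
  coarse-coarse c c′ c≤a c′≤b = unrelated-separates (coarse c) (coarse c′) γ
    (λ i j m → coarse-separate a {{>-nonZero a>0}} m (x i) (x j) c≤a)
    (λ i j m → coarse-separate b {{>-nonZero b>0}} m (y i) (y j) c′≤b)

module Base2 {b N D : ℕ} (b≥3 : 3 ≤ b) (D>0 : 0 < D) (x y : Fin 5 → ℕ)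
  (h : (i : Fin 5) → N + toℕ i * D ≡ 2 ^ x i + b ^ y i) where

  open Solution 2 b (s≤s z≤n) (≤-trans (s≤s z≤n) b≥3) D>0 x y h public

  right-013-solved : Holds right-013 → Conclusion 2 b N D
  right-013-solved e = conclude (unrelated (exact 2) (coarse 3)) right-013-goals right-013 right-013-tree _
    (exact-coarse 3 b≥3) e
    ( (λ { (p ∷ q ∷ []) → right-013-case₁ (x 0F) (y 0F) (y 2F) b≥3 p q first })
    ∷ (λ { (_ ∷ p ∷ q ∷ []) → ⊥-elim (right-013-case₂ (x 0F) (x 2F) (y 0F) (y 2F) (y 4F) b≥3 p q) })
    ∷ (λ { (p ∷ q ∷ r ∷ []) → right-013-case₃ (x 0F) (x 4F) (y 0F) (y 2F) (y 4F) b≥3 q r p first })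
    ∷ [])

  right-124-solved : Holds right-124 → Conclusion 2 b N D
  right-124-solved e = conclude (unrelated (exact 2) (coarse 3)) right-124-goals right-124 right-124-tree _
    (exact-coarse 3 b≥3) e
    ( (λ { (p ∷ q ∷ r ∷ []) → right-124-case₁ (x 1F) (x 0F) (x 3F) (y 0F) (y 1F) (y 3F) b≥3 p q r first })
    ∷ [])

  -- The fifth goal is a parameter since its treatment depends on the base: b ≥ 5 admits
  -- `least-exponent` with m = 3, and b = 3 does not.
  base-2-cases : (∀ r e y₁ y₄ Y → b ^ y₁ ≡ b ^ y₄ + 3 * 2 ^ r → 2 ^ e ≡ D + 2 ^ r →
    b ^ Y ≡ b ^ y₄ + (2 * 2 ^ e + 2 ^ r) → ⊥) →
    All (λ es → Holds es → Conclusion 2 b N D) base-2-goals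
  base-2-cases base-2-case₅ =
      right-013-solved
    ∷ right-124-solved
    ∷ (λ { (p ∷ q ∷ r ∷ s ∷ []) →
        base-2-case₃ (x 3F) (x 1F) (y 1F) (y 2F) (y 3F) b≥3 D>0 p q r (trans first s) })
    ∷ (λ { (p ∷ q ∷ []) →
        ⊥-elim (no-chain-2^ {b} {x 0F} {y 0F} {y 1F} {y 3F} (suc (x 1F)) b≥3 p q) })
    ∷ (λ { (p ∷ q ∷ r ∷ []) → ⊥-elim (base-2-case₅ (x 2F) (x 1F) (y 1F) (y 4F) (y 2F) p q r) })
    ∷ (λ { (p ∷ q ∷ []) → ⊥-elim (no-chain-2^ {b} {x 0F} {y 0F} {y 1F} {y 2F} (x 1F) b≥3 p q) })
    ∷ (λ { (p ∷ q ∷ r ∷ []) →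
        ⊥-elim (base-2-case₇ (x 1F) (x 2F) (y 1F) (y 2F) (y 4F) b≥3 D>0 p q r) })
    ∷ (λ { (p ∷ q ∷ r ∷ s ∷ []) →
        base-2-case₈ (x 0F) (x 2F) (y 0F) (y 1F) (y 2F) b≥3 first p q r s })
    ∷ []

base-2-large : ∀ {b N D} → 6 ≤ b → 0 < D → (x y : Fin 5 → ℕ) →
  ((i : Fin 5) → N + toℕ i * D ≡ 2 ^ x i + b ^ y i) → Conclusion 2 b N D
base-2-large {b} {N} {D} b≥6 D>0 x y h =
  conclude (unrelated (exact 2) (coarse 6)) base-2-goals [] two-large-tree _ (exact-coarse 6 b≥6) []
    (base-2-cases λ r e y₁ y₄ Y → base-2-case₅ r e y₁ y₄ Y (≤-trans (n≤1+n 5) b≥6) D>0)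
  where open Base2 {b} {N} {D} (≤-trans (from-yes (3 ≤? 6)) b≥6) D>0 x y h

base-2-5 : ∀ {N D} → 0 < D → (x y : Fin 5 → ℕ) →
  ((i : Fin 5) → N + toℕ i * D ≡ 2 ^ x i + 5 ^ y i) → Conclusion 2 5 N D
base-2-5 {N} {D} D>0 x y h =
  conclude (unrelated (exact 2) (exact 5)) base-2-goals [] two-five-tree _ exact-exact []
    (base-2-cases λ r e y₁ y₄ Y → base-2-case₅ r e y₁ y₄ Y ≤-refl D>0)
  where open Base2 {5} {N} {D} (from-yes (3 ≤? 5)) D>0 x y h

base-2-4 : ∀ {N D} → 0 < D → (x y : Fin 5 → ℕ) →
  ((i : Fin 5) → N + toℕ i * D ≡ 2 ^ x i + 4 ^ y i) → ⊥
base-2-4 {N} {D} D>0 x y h = conclude 2-or-4 [] [] two-four-tree _ (2-or-4-separates x y) [] []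
  where open Base2 {4} {N} {D} (from-yes (3 ≤? 4)) D>0 x y h

base-2-3 : ∀ {N D} → 0 < D → (x y : Fin 5 → ℕ) →
  ((i : Fin 5) → N + toℕ i * D ≡ 2 ^ x i + 3 ^ y i) → Conclusion 2 3 N D
base-2-3 {N} {D} D>0 x y h =
  conclude (unrelated (exact 2) (exact 3)) (base-2-goals ++ two-three-goals) [] two-three-tree _ exact-exact []
    (++⁺ (base-2-cases λ r e y₁ y₄ Y → base-2-case₅-for-3 r e y₁ y₄ Y D>0) handlers)
  where
  open Base2 {3} {N} {D} ≤-refl D>0 x y h
  left-014-solved : Holds left-014 → Conclusion 2 3 N D
  left-014-solved e = conclude (unrelated (exact 2) (exact 3)) left-014-goals left-014 left-014-tree _ exact-exact e
    ( (λ { (p ∷ q ∷ []) → left-014-case₁ (x 0F) (y 0F) p q first })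
    ∷ (λ { (p ∷ q ∷ []) → left-014-case₂ (x 0F) (x 2F) (y 0F) p q first })
    ∷ (λ { (p ∷ q ∷ r ∷ []) →
        ⊥-elim (left-014-case₃ (x 0F) (x 2F) (x 3F) (y 0F) (y 2F) (trans p (cong (2 ^ x 2F +_) q)) r) })
    ∷ [])
  handlers : All (λ es → Holds es → Conclusion 2 3 N D) two-three-goals
  handlers =
      left-014-solved
    ∷ (λ { (p ∷ q ∷ []) → ⊥-elim (two-three-case₂ (x 0F) (x 1F) (x 2F) (y 0F) (y 1F) p q) })
    ∷ (λ { (p ∷ q ∷ r ∷ []) → sum-of-3^ (x 1F) (y 2F) (y 3F) D>0 p q (trans first r) })
    ∷ (λ { (p ∷ q ∷ r ∷ []) → two-three-case₄ (x 0F) (x 1F) (y 2F) p q (trans first r) })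
    ∷ (λ { (p ∷ q ∷ []) → ⊥-elim (no-twice-3^ (x 2F) (y 0F) (y 1F) D>0 p q) })
    ∷ (λ { (p ∷ q ∷ r ∷ s ∷ []) →
        two-three-case₆ (x 3F) (x 1F) (x 4F) (y 0F) (y 1F) D>0 p q r (trans first s) })
    ∷ (λ { (p ∷ q ∷ []) → ⊥-elim (no-twice-3^ (x 2F) (y 4F) (y 1F) D>0 p q) })
    ∷ (λ { (p ∷ q ∷ r ∷ []) → sum-of-3^ (x 4F) (y 0F) (y 1F) D>0 p q (trans first r) })
    ∷ (λ { (p ∷ q ∷ r ∷ []) → sum-of-3^ (x 4F) (y 2F) (y 1F) D>0 p q (trans first r) })
    ∷ (λ { (p ∷ q ∷ []) → ⊥-elim (no-twice-3^ (x 1F) (y 3F) (y 0F) D>0 p q) })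
    ∷ (λ { (p ∷ q ∷ r ∷ []) →
        ⊥-elim (two-three-case₁₁ (x 2F) (x 3F) (y 0F) (y 1F) D>0 p q r) })
    ∷ (λ { (p ∷ q ∷ []) → ⊥-elim (two-three-case₁₂ (x 1F) (x 2F) (y 0F) D>0 p q) })
    ∷ []

module Base3 {b N D : ℕ} (b≥4 : 4 ≤ b) (D>0 : 0 < D) (x y : Fin 5 → ℕ)
  (h : (i : Fin 5) → N + toℕ i * D ≡ 3 ^ x i + b ^ y i) where

  open Solution 3 b (s≤s z≤n) (≤-trans (s≤s z≤n) b≥4) D>0 x y h public

  right-014-solved : Holds right-014 → Conclusion 3 b N D
  right-014-solved e = conclude (unrelated (exact 3) (coarse 4)) right-014-goals right-014 right-014-tree _
    (exact-coarse 4 b≥4) e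
    ( (λ { (p ∷ q ∷ []) → right-014-case₁ (x 0F) (y 0F) (y 2F) b≥4 q p first })
    ∷ (λ { (_ ∷ p ∷ q ∷ []) → ⊥-elim (right-014-case₂ (x 0F) (x 2F) (y 0F) (y 2F) (y 3F) b≥4 p q) })
    ∷ [])

  chain-excluded : Holds ((1 · β 1 ≐ 1 · α 0 ⊞ 1 · β 0) ∷ (1 · β 2 ≐ 1 · α 1 ⊞ 1 · β 1) ∷ []) → Conclusion 3 b N D
  chain-excluded (p ∷ q ∷ []) =
    ⊥-elim (no-chain-3^ (x 0F) (x 1F) (y 0F) (y 1F) (y 2F) (≤-trans (n≤1+n 3) b≥4) p q)

base-3-large : ∀ {b N D} → 5 ≤ b → 0 < D → (x y : Fin 5 → ℕ) →
  ((i : Fin 5) → N + toℕ i * D ≡ 3 ^ x i + b ^ y i) → Conclusion 3 b N D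
base-3-large {b} {N} {D} b≥5 D>0 x y h =
  conclude (unrelated (exact 3) (coarse 5)) base-3-goals [] three-large-tree _ (exact-coarse 5 b≥5) []
    ( right-014-solved
    ∷ chain-excluded
    ∷ (λ { (p ∷ q ∷ []) → ⊥-elim (base-3-case₃ (x 0F) (y 0F) (y 1F) (y 2F) b≥4 p q) })
    ∷ [])
  where
  b≥4 = ≤-trans (n≤1+n 4) b≥5
  open Base3 {b} {N} {D} b≥4 D>0 x y h

base-3-4 : ∀ {N D} → 0 < D → (x y : Fin 5 → ℕ) →
  ((i : Fin 5) → N + toℕ i * D ≡ 3 ^ x i + 4 ^ y i) → Conclusion 3 4 N D
base-3-4 {N} {D} D>0 x y h =
  conclude (unrelated (exact 3) (exact 4)) three-four-goals [] three-four-tree _ exact-exact []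
    ( right-014-solved
    ∷ chain-excluded
    ∷ (λ { (p ∷ []) → ⊥-elim (no-difference-3*4^ (x 0F) (x 4F) (y 0F) p) })
    ∷ (λ { (p ∷ []) → ⊥-elim (no-difference-3*4^ (x 1F) (x 0F) (y 2F) p) })
    ∷ (λ { (p ∷ q ∷ r ∷ []) → three-four-case₅ (y 0F) (y 1F) (x 2F) p q (trans first r) })
    ∷ [])
  where open Base3 {4} {N} {D} ≤-refl D>0 x y h

-- Powers of 4 are powers of 2 with even exponents, so this is an instance of the system for base 2.
base-4-case₁ : ∀ {b D} r e y₁ y₄ Y → 5 ≤ b → 0 < D → b ^ y₁ ≡ b ^ y₄ + 3 * 4 ^ r → 4 ^ e ≡ D + 4 ^ r →
  b ^ Y ≡ b ^ y₄ + (2 * 4 ^ e + 4 ^ r) → ⊥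
base-4-case₁ {b} {D} r e y₁ y₄ Y b≥5 D>0 rewrite ^-*-assoc 2 2 r | ^-*-assoc 2 2 e =
  base-2-case₅ (2 * r) (2 * e) y₁ y₄ Y b≥5 D>0

base-4 : ∀ {b N D} → 5 ≤ b → 0 < D → (x y : Fin 5 → ℕ) →
  ((i : Fin 5) → N + toℕ i * D ≡ 4 ^ x i + b ^ y i) → ⊥
base-4 {b} {N} {D} b≥5 D>0 x y h =
  conclude (unrelated (exact 4) (coarse 5)) base-4-goals [] four-large-tree _ (exact-coarse 5 b≥5) []
    ( (λ { (p ∷ q ∷ r ∷ []) → base-4-case₁ (x 2F) (x 1F) (y 1F) (y 4F) (y 2F) b≥5 D>0 p q r })
    ∷ [])
  where open Solution 4 b {N} {D} (s≤s z≤n) (≤-trans (s≤s z≤n) b≥5) D>0 x y h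

large-bases : ∀ {a b N D} → 5 ≤ a → 6 ≤ b → 0 < D → (x y : Fin 5 → ℕ) →
  ((i : Fin 5) → N + toℕ i * D ≡ a ^ x i + b ^ y i) → ⊥
large-bases {a} {b} {N} {D} a≥5 b≥6 D>0 x y h =
  conclude (unrelated (coarse 5) (coarse 6)) [] [] large-large-tree _ (coarse-coarse 5 6 a≥5 b≥6) [] []
  where open Solution a b {N} {D} (≤-trans (s≤s z≤n) a≥5) (≤-trans (s≤s z≤n) b≥6) D>0 x y h

theorem1 : (a b N D : ℕ) → 1 < a → a < b → 0 < N → 0 < D →
    (x y : Fin 5 → ℕ) →
    ((i : Fin 5) → N + toℕ i * D ≡ a ^ x i + b ^ y i) →
    Family1 a b N D ⊎ Family2 a b N D ⊎ Sporadic a b N D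
theorem1 0 b N D () _ _ _ _ _ _
theorem1 1 b N D (s≤s ()) _ _ _ _ _ _
theorem1 2 b N D _ a<b _ D>0 x y h with m≤n⇒m<n∨m≡n a<b
... | inj₂ refl = base-2-3 D>0 x y h
... | inj₁ b≥4 with m≤n⇒m<n∨m≡n b≥4
... | inj₂ refl = ⊥-elim (base-2-4 D>0 x y h)
... | inj₁ b≥5 with m≤n⇒m<n∨m≡n b≥5
... | inj₂ refl = base-2-5 D>0 x y h
... | inj₁ b≥6 = base-2-large b≥6 D>0 x y h
theorem1 3 b N D _ a<b _ D>0 x y h with m≤n⇒m<n∨m≡n a<b
... | inj₂ refl = base-3-4 D>0 x y h
... | inj₁ b≥5 = base-3-large b≥5 D>0 x y h
theorem1 4 b N D _ a<b _ D>0 x y h = ⊥-elim (base-4 a<b D>0 x y h)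
theorem1 (suc (suc (suc (suc (suc a))))) b N D _ a<b _ D>0 x y h = ⊥-elim
  (large-bases (s≤s (s≤s (s≤s (s≤s (s≤s z≤n))))) (≤-trans (s≤s (s≤s (s≤s (s≤s (s≤s (s≤s z≤n)))))) a<b) D>0 x y h)
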